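{- The model of $\mathrm{SCI}$ in $\mathbf{MonRel}$ is fully abstract: for every context $\Gamma$, every type $A$ and all terms $\Gamma\vdash M:A$ and $\Gamma\vdash N:A$ of $\mathrm{SCI}$, $[\![M]\!]=[\![N]\!]$ if and only if $M\cong N$, where $\cong$ is contextual equivalence of $\mathrm{SCI}$.
   Context: **The language SCI.** Types: $A::=\mathtt{nat}\mid\mathtt{comm}\mid\mathtt{var}\mid A\multimap A$ (the first three are the base types). Terms: $M::=n\mid M\odot M\mid\mathtt{skip}\mid M;M\mid M:=M\mid\,!M\mid\mathtt{while}\ M\ \mathtt{do}\ M\mid\mathtt{ifzero}\ M\ \mathtt{then}\ M\ \mathtt{else}\ M\mid x\mid\lambda x^A.M\mid MM\mid\mathtt{new}\ x\ \mathtt{in}\ M$, where $n\in\mathbb N$, $x$ is an identifier, and $\odot$ ranges over a fixed collection of arithmetic operations on $\mathbb N$ including $+$ and (truncated) $-$. Terms are taken up to $\alpha$-equivalence ($\lambda x$ and $\mathtt{new}\ x$ bind $x$). A context $\Gamma$ is a list $x_1:A_1,\dots,x_n:A_n$ with distinct identifiers. **Typing** (all judgments must be well-formed, so $\Gamma,\Delta$ have disjoint identifiers in the application rule): $x:A\vdash x:A$; if $\Gamma,x:A\vdash M:B$ then $\Gamma\vdash\lambda x^A.M:A\multimap B$; if $\Gamma\vdash M:A\multimap B$ and $\Delta\vdash N:A$ then $\Gamma,\Delta\vdash MN:B$; weakening (from $\Gamma\vdash M:B$ infer $\Gamma,x:A\vdash M:B$); exchange (permuting $\Gamma$); $\vdash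 n:\mathtt{nat}$; $\vdash\mathtt{skip}:\mathtt{comm}$; and, with the same $\Gamma$ in all premises and conclusion: $M\odot N:\mathtt{nat}$ if $M,N:\mathtt{nat}$; $M;N:B$ if $M:\mathtt{comm}$, $N:B$, $B$ a base type; $M:=N:\mathtt{comm}$ if $M:\mathtt{var}$, $N:\mathtt{nat}$; $!M:\mathtt{nat}$ if $M:\mathtt{var}$; $\mathtt{while}\ M\ \mathtt{do}\ N:\mathtt{comm}$ if $M:\mathtt{nat}$, $N:\mathtt{comm}$; $\mathtt{ifzero}\ M\ \mathtt{then}\ N_1\ \mathtt{else}\ N_2:B$ if $M:\mathtt{nat}$, $N_1,N_2:B$, $B$ a base type; and $\Gamma\vdash\mathtt{new}\ x\ \mathtt{in}\ M:B$ if $\Gamma,x:\mathtt{var}\vdash M:B$ with $B\in\{\mathtt{comm},\mathtt{nat}\}$. **Operational semantics.** Judgments $\sigma,M\Downarrow\sigma',V$, where $M,V$ are typed in a context $\Gamma$ of $\mathtt{var}$-typed identifiers, $\sigma,\sigma'$ are stores (functions from the identifiers of $\Gamma$ to $\mathbb N$), and $V$ is a value: a numeral, $\mathtt{skip}$, an identifier, or a $\lambda$-abstraction. $(\sigma\mid x\mapsto n)$ is $\sigma$ updated/extended to send $x$ to $n$. Rules: $\sigma,V\Downarrow\sigma,V$; if $\sigma,M\Downarrow\sigma',\lambda x^A.M'$ and $\sigma',M'[N/x]\Downarrow\sigma'',V$ then $\sigma,MN\Downarrow\sigma'',V$; if $\sigma,M_1\Downarrow\sigma',n_1$ and $\sigma',M_2\Downarrow\sigma'',n_2$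 then $\sigma,M_1\odot M_2\Downarrow\sigma'',n_1\odot n_2$; if $\sigma,N\Downarrow\sigma',n$ and $\sigma',M\Downarrow\sigma'',x$ then $\sigma,M:=N\Downarrow(\sigma''\mid x\mapsto n),\mathtt{skip}$; if $\sigma,M\Downarrow\sigma',x$ then $\sigma,!M\Downarrow\sigma',\sigma'(x)$; if $\sigma,M\Downarrow\sigma',\mathtt{skip}$ and $\sigma',N\Downarrow\sigma'',V$ then $\sigma,M;N\Downarrow\sigma'',V$; if $\sigma,M\Downarrow\sigma',n$ with $n\neq0$ then $\sigma,\mathtt{while}\ M\ \mathtt{do}\ N\Downarrow\sigma',\mathtt{skip}$; if $\sigma,M\Downarrow\sigma',0$, $\sigma',N\Downarrow\sigma'',\mathtt{skip}$ and $\sigma'',\mathtt{while}\ M\ \mathtt{do}\ N\Downarrow\sigma''',\mathtt{skip}$ then $\sigma,\mathtt{while}\ M\ \mathtt{do}\ N\Downarrow\sigma''',\mathtt{skip}$; $\mathtt{ifzero}$ evaluates its guard and then the first branch (guard value $0$) or the second (guard value $\neq0$), threading the store; if $(\sigma\mid x\mapsto0),M\Downarrow(\sigma'\mid x\mapsto n),V$ then $\sigma,\mathtt{new}\ x\ \mathtt{in}\ M\Downarrow\sigma',V$ (with $x$ not in the domain of $\sigma,\sigma'$). For closed terms the empty store is omitted. **Contextual equivalence.** For $\Gamma\vdash M,N:A$ in SCI, $M\cong N$ iff for every SCI context (term with a hole, possibly capturing) $C[-]$ with $\vdash C[M],C[N]:B$, $B\in\{\mathtt{comm},\mathtt{nat}\}$,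 and every value $\vdash V:B$: $C[M]\Downarrow V\iff C[N]\Downarrow V$. **Denotational semantics.** Put $\alpha\mathtt{nat}=\mathbb N$, $\alpha\mathtt{comm}=\{*\}$, $\alpha\mathtt{var}=\{\mathsf{read}(n),\mathsf{write}(n)\mid n\in\mathbb N\}$, $\alpha(A\multimap B)=(\alpha A)^*\times\alpha B$; $X^*$ is the free monoid of finite sequences, $\varepsilon$ the empty sequence. For $\Gamma=x_1:A_1,\dots,x_n:A_n$, $[\![\Gamma\vdash M:B]\!]\subseteq(\alpha A_1)^*\times\cdots\times(\alpha A_n)^*\times\alpha B$; elements are written $(\vec s,b)$, and $\vec s\,\vec s'$ is componentwise concatenation. Clauses: $[\![x:A\vdash x:A]\!]=\{(a,a)\mid a\in\alpha A\}$; $[\![\lambda x^A.M]\!]=\{(\vec s,(s,b))\mid(\vec s,s,b)\in[\![M]\!]\}$; $[\![MN]\!]=\{(\vec s,\vec t^{\,1}\cdots\vec t^{\,k},b)\mid\exists a_1,\dots,a_k.\ (\vec s,(a_1\cdots a_k,b))\in[\![M]\!],\ (\vec t^{\,i},a_i)\in[\![N]\!]\ (1\le i\le k)\}$; weakening inserts $\varepsilon$ for the new identifier; exchange permutes components; $[\![n]\!]=\{n\}$; $[\![\mathtt{skip}]\!]=\{*\}$; $[\![M_1\odot M_2]\!]=\{(\vec s\,\vec s',m_1\odot m_2)\mid(\vec s,m_1)\in[\![M_1]\!],(\vec s',m_2)\in[\![M_2]\!]\}$; $[\![M;N]\!]=\{(\vec s\,\vec s',b)\mid(\vec s,*)\in[\![M]\!],(\vec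 s',b)\in[\![N]\!]\}$; $[\![M:=N]\!]=\{(\vec s\,\vec s',*)\mid\exists n.\,(\vec s,n)\in[\![N]\!],(\vec s',\mathsf{write}(n))\in[\![M]\!]\}$; $[\![!M]\!]=\{(\vec s,n)\mid(\vec s,\mathsf{read}(n))\in[\![M]\!]\}$; $[\![\mathtt{while}\ M\ \mathtt{do}\ N]\!]=\{(\vec s^{\,1}\vec t^{\,1}\cdots\vec s^{\,j}\vec t^{\,j}\vec s,*)\mid j\ge0,\ \forall i.\,(\vec s^{\,i},0)\in[\![M]\!]\wedge(\vec t^{\,i},*)\in[\![N]\!],\ \exists m\ne0.\,(\vec s,m)\in[\![M]\!]\}$; $[\![\mathtt{ifzero}\ M\ \mathtt{then}\ N_1\ \mathtt{else}\ N_2]\!]=\{(\vec s\,\vec t,b)\mid(\vec s,0)\in[\![M]\!],(\vec t,b)\in[\![N_1]\!]\}\cup\{(\vec s\,\vec t,b)\mid\exists m\ne0.\,(\vec s,m)\in[\![M]\!],(\vec t,b)\in[\![N_2]\!]\}$; $[\![\mathtt{new}\ x\ \mathtt{in}\ M]\!]=\{(\vec s,b)\mid\exists s.\,(\vec s,s,b)\in[\![M]\!],\ s\text{ a cell trace}\}$, where $s\in(\alpha\mathtt{var})^*$ is a cell trace iff every $\mathsf{read}(n)$ in $s$ carries the value of the most recent preceding $\mathsf{write}$, or $0$ if there is none. **MonRel.** Objects are monoids; morphisms $P\to Q$ are relations $R\subseteq P\times Q$ with $e_P\,R\,e_Q$; $a_iRb_i$ ($i=1,2$) implies $a_1a_2\,R\,b_1b_2$;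 $a\,R\,e_Q$ implies $a=e_P$; $a\,R\,b_1b_2$ implies $a=a_1a_2$ for some $a_i$ with $a_iRb_i$. Composition is relational. A morphism into a free monoid $X^*$ is determined by its restriction to $P\times X$, which may be arbitrary, so $[\![\Gamma\vdash M:B]\!]$ is the same thing as a $\mathbf{MonRel}$-morphism $(\alpha A_1)^*\times\cdots\times(\alpha A_n)^*\to(\alpha B)^*$ (product monoid as source).
   Formalization: In contextual equivalence, contexts capture an identifier of Γ only by a binder of its type in Γ; if capture at other types were allowed, h g; f g and f g; h g (h,f:comm⊸comm, g:comm) would have equal denotations yet be separated by rebinding at nat. -}

module Defs where

open import Data.Fin.Base using (Fin; zero; suc; _↑ˡ_; _↑ʳ_)
open import Data.Fin.Permutation using (Permutation′; _⟨$⟩ʳ_; _⟨$⟩ˡ_)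
import Data.List.Base as List
open List using (List)
open import Data.Nat.Base using (ℕ; zero; suc; _+_; _∸_)
open import Data.Product.Base using (Σ-syntax; ∃-syntax; _×_; _,_)
open import Data.Sum.Base using (_⊎_)
open import Data.Unit.Base using (⊤; tt)
open import Data.Vec.Base using (Vec; []; _∷_; _++_; lookup; tabulate; _[_]≔_)
open import Data.Vec.Relation.Unary.All using (All; []; _∷_)
open import Data.Vec.Relation.Unary.All.Properties using (++⁺; tabulate⁺; lookup⁺)
open import Function.Bundles using (_⇔_)
open import Function.Definitions using (Injective)
open import Relation.Binary.PropositionalEquality.Core using (_≡_; _≢_)

private
  variable
    k m n : ℕ

-- The fixed collection of operations ⊙ on ℕ, as a family indexed by its
-- operation symbols; any collection with addition and truncated
-- subtraction is allowed.
record Arithmetic : Set₁ where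
  field
    Op       : Set
    apply    : Op → ℕ → ℕ → ℕ
    plus     : Op
    minus    : Op
    plus-+   : ∀ a b → apply plus a b ≡ a + b
    minus-∸  : ∀ a b → apply minus a b ≡ a ∸ b

infixr 7 _⊸_

data Ty : Set where
  nat comm var : Ty
  _⊸_          : Ty → Ty → Ty

data Base : Ty → Set where
  nat  : Base nat
  comm : Base comm
  var  : Base var

data Ground : Ty → Set where
  nat  : Ground nat
  comm : Ground comm

-- A context is read right to left: its head is the most recently added
-- identifier, so "Γ , x : A" is A ∷ Γ and "Γ , Δ" is Δ ++ Γ.
Cxt : ℕ → Set
Cxt = Vec Ty

private
  variable
    A B : Ty
    Γ   : Cxt m
    Δ   : Cxt n
    Θ   : Cxt k

------------------------------------------------------------------------
-- Traces

data VarAct : Set where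
  read write : ℕ → VarAct

α : Ty → Set
α nat     = ℕ
α comm    = ⊤
α var     = VarAct
α (A ⊸ B) = List (α A) × α B

Traces : Cxt n → Set
Traces = All (λ A → List (α A))

ε : Traces Γ
ε {Γ = []}    = []
ε {Γ = A ∷ Γ} = List.[] ∷ ε

infixr 6 _∙_

_∙_ : Traces Γ → Traces Γ → Traces Γ
[]       ∙ []       = []
(s ∷ ss) ∙ (t ∷ ts) = (s List.++ t) ∷ (ss ∙ ts)

-- The extension of R to a relation into the free monoid on X:
-- Star R t (a₁ ⋯ aₖ) iff t = t¹ ⋯ tᵏ with R tⁱ aᵢ for all i.
data Star {Γ : Cxt n} {X : Set} (R : Traces Γ → X → Set) : Traces Γ → List X → Set where
  []  : Star R ε List.[]
  _∷_ : ∀ {t u a as} → R t a → Star R u as → Star R (t ∙ u) (a List.∷ as)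

-- Cell v s: s is the trace of a cell that currently holds v.
data Cell : ℕ → List VarAct → Set where
  []    : ∀ {v} → Cell v List.[]
  read  : ∀ {v s} → Cell v s → Cell v (read v List.∷ s)
  write : ∀ {v w s} → Cell w s → Cell v (write w List.∷ s)

CellTrace : List VarAct → Set
CellTrace = Cell 0

permute : Permutation′ n → Cxt n → Cxt n
permute π Γ = tabulate (λ i → lookup Γ (π ⟨$⟩ˡ i))

permuteTraces : (π : Permutation′ n) → Traces Γ → Traces (permute π Γ)
permuteTraces π s = tabulate⁺ (λ i → lookup⁺ s (π ⟨$⟩ˡ i))

module SCI (𝓐 : Arithmetic) where

  open Arithmetic 𝓐

  infixl 8 _·_
  infix  7 !_
  infixl 6 _⟨_⟩_
  infix  5 _:=_
  infixr 4 _⨾_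

  -- Terms with identifiers drawn from Fin n, in de Bruijn form: ƛ and new
  -- bind index zero. Syntactic equality is α-equivalence.
  data Tm (n : ℕ) : Set where
    num    : ℕ → Tm n
    _⟨_⟩_  : Tm n → Op → Tm n → Tm n
    skip   : Tm n
    _⨾_    : Tm n → Tm n → Tm n
    _:=_   : Tm n → Tm n → Tm n
    !_     : Tm n → Tm n
    while  : Tm n → Tm n → Tm n
    ifzero : Tm n → Tm n → Tm n → Tm n
    ident  : Fin n → Tm n
    ƛ      : Ty → Tm (suc n) → Tm n
    _·_    : Tm n → Tm n → Tm n
    new    : Tm (suc n) → Tm n

  liftRen : (Fin m → Fin n) → Fin (suc m) → Fin (suc n)
  liftRen ρ zero    = zero
  liftRen ρ (suc i) = suc (ρ i)

  rename : (Fin m → Fin n) → Tm m → Tm n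
  rename ρ (num a)         = num a
  rename ρ (M ⟨ o ⟩ N)     = rename ρ M ⟨ o ⟩ rename ρ N
  rename ρ skip            = skip
  rename ρ (M ⨾ N)         = rename ρ M ⨾ rename ρ N
  rename ρ (M := N)        = rename ρ M := rename ρ N
  rename ρ (! M)           = ! rename ρ M
  rename ρ (while M N)     = while (rename ρ M) (rename ρ N)
  rename ρ (ifzero M N N′) = ifzero (rename ρ M) (rename ρ N) (rename ρ N′)
  rename ρ (ident i)       = ident (ρ i)
  rename ρ (ƛ A M)         = ƛ A (rename (liftRen ρ) M)
  rename ρ (M · N)         = rename ρ M · rename ρ N
  rename ρ (new M)         = new (rename (liftRen ρ) M)

  weaken : Tm n → Tm (suc n)
  weaken = rename suc

  closed : Tm 0 → Tm n
  closed = rename (λ ())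

  liftSub : (Fin m → Tm n) → Fin (suc m) → Tm (suc n)
  liftSub θ zero    = ident zero
  liftSub θ (suc i) = weaken (θ i)

  subst : (Fin m → Tm n) → Tm m → Tm n
  subst θ (num a)         = num a
  subst θ (M ⟨ o ⟩ N)     = subst θ M ⟨ o ⟩ subst θ N
  subst θ skip            = skip
  subst θ (M ⨾ N)         = subst θ M ⨾ subst θ N
  subst θ (M := N)        = subst θ M := subst θ N
  subst θ (! M)           = ! subst θ M
  subst θ (while M N)     = while (subst θ M) (subst θ N)
  subst θ (ifzero M N N′) = ifzero (subst θ M) (subst θ N) (subst θ N′)
  subst θ (ident i)       = θ i
  subst θ (ƛ A M)         = ƛ A (subst (liftSub θ) M)
  subst θ (M · N)         = subst θ M · subst θ N
  subst θ (new M)         = new (subst (liftSub θ) M)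

  single : Tm n → Fin (suc n) → Tm n
  single N zero    = N
  single N (suc i) = ident i

  _[_] : Tm (suc n) → Tm n → Tm n
  M [ N ] = subst (single N) M

  ----------------------------------------------------------------------
  -- Typing

  infix 2 _⊢_∶_

  data _⊢_∶_ : Cxt n → Tm n → Ty → Set where
    axiom    : A ∷ [] ⊢ ident zero ∶ A
    lam      : ∀ {M} → A ∷ Γ ⊢ M ∶ B → Γ ⊢ ƛ A M ∶ A ⊸ B
    app      : ∀ {Γ : Cxt m} {Δ : Cxt n} {M N} →
               Γ ⊢ M ∶ A ⊸ B → Δ ⊢ N ∶ A →
               Δ ++ Γ ⊢ rename (n ↑ʳ_) M · rename (_↑ˡ m) N ∶ B
    weak     : ∀ {M} → Γ ⊢ M ∶ B → A ∷ Γ ⊢ weaken M ∶ B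
    exchange : ∀ {Γ : Cxt n} {M} (π : Permutation′ n) →
               Γ ⊢ M ∶ B → permute π Γ ⊢ rename (π ⟨$⟩ʳ_) M ∶ B
    numeral  : ∀ {a} → [] ⊢ num a ∶ nat
    skip     : [] ⊢ skip ∶ comm
    arith    : ∀ {M N o} → Γ ⊢ M ∶ nat → Γ ⊢ N ∶ nat → Γ ⊢ M ⟨ o ⟩ N ∶ nat
    seq      : ∀ {M N} → Base B → Γ ⊢ M ∶ comm → Γ ⊢ N ∶ B → Γ ⊢ M ⨾ N ∶ B
    assign   : ∀ {M N} → Γ ⊢ M ∶ var → Γ ⊢ N ∶ nat → Γ ⊢ M := N ∶ comm
    deref    : ∀ {M} → Γ ⊢ M ∶ var → Γ ⊢ ! M ∶ nat
    while    : ∀ {M N} → Γ ⊢ M ∶ nat → Γ ⊢ N ∶ comm → Γ ⊢ while M N ∶ comm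
    ifzero   : ∀ {M N N′} → Base B →
               Γ ⊢ M ∶ nat → Γ ⊢ N ∶ B → Γ ⊢ N′ ∶ B → Γ ⊢ ifzero M N N′ ∶ B
    new      : ∀ {M} → Ground B → var ∷ Γ ⊢ M ∶ B → Γ ⊢ new M ∶ B

  ----------------------------------------------------------------------
  -- Operational semantics

  data Value {n} : Tm n → Set where
    num   : ∀ a → Value (num a)
    skip  : Value skip
    ident : ∀ i → Value (ident i)
    ƛ     : ∀ A M → Value (ƛ A M)

  Store : ℕ → Set
  Store = Vec ℕ

  infix 2 _∣_⇓_∣_

  -- In the rule for new, the local cell is index zero of the extended
  -- store, and the result is required not to mention it.
  data _∣_⇓_∣_ {n} : Store n → Tm n → Store n → Tm n → Set where
    value   : ∀ {σ V} → Value V → σ ∣ V ⇓ σ ∣ V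
    app     : ∀ {σ σ′ σ″ A M M′ N V} →
              σ ∣ M ⇓ σ′ ∣ ƛ A M′ → σ′ ∣ M′ [ N ] ⇓ σ″ ∣ V →
              σ ∣ M · N ⇓ σ″ ∣ V
    arith   : ∀ {σ σ′ σ″ M N o a b} →
              σ ∣ M ⇓ σ′ ∣ num a → σ′ ∣ N ⇓ σ″ ∣ num b →
              σ ∣ M ⟨ o ⟩ N ⇓ σ″ ∣ num (apply o a b)
    assign  : ∀ {σ σ′ σ″ M N a x} →
              σ ∣ N ⇓ σ′ ∣ num a → σ′ ∣ M ⇓ σ″ ∣ ident x →
              σ ∣ M := N ⇓ σ″ [ x ]≔ a ∣ skip
    deref   : ∀ {σ σ′ M x} →
              σ ∣ M ⇓ σ′ ∣ ident x →
              σ ∣ ! M ⇓ σ′ ∣ num (lookup σ′ x)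
    seq     : ∀ {σ σ′ σ″ M N V} →
              σ ∣ M ⇓ σ′ ∣ skip → σ′ ∣ N ⇓ σ″ ∣ V →
              σ ∣ M ⨾ N ⇓ σ″ ∣ V
    stop    : ∀ {σ σ′ M N a} →
              σ ∣ M ⇓ σ′ ∣ num a → a ≢ 0 →
              σ ∣ while M N ⇓ σ′ ∣ skip
    loop    : ∀ {σ σ′ σ″ σ‴ M N} →
              σ ∣ M ⇓ σ′ ∣ num 0 → σ′ ∣ N ⇓ σ″ ∣ skip → σ″ ∣ while M N ⇓ σ‴ ∣ skip →
              σ ∣ while M N ⇓ σ‴ ∣ skip
    ifzero₁ : ∀ {σ σ′ σ″ M N N′ V} →
              σ ∣ M ⇓ σ′ ∣ num 0 → σ′ ∣ N ⇓ σ″ ∣ V →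
              σ ∣ ifzero M N N′ ⇓ σ″ ∣ V
    ifzero₂ : ∀ {σ σ′ σ″ M N N′ V a} →
              σ ∣ M ⇓ σ′ ∣ num a → a ≢ 0 → σ′ ∣ N′ ⇓ σ″ ∣ V →
              σ ∣ ifzero M N N′ ⇓ σ″ ∣ V
    new     : ∀ {σ σ′ M V a} →
              0 ∷ σ ∣ M ⇓ a ∷ σ′ ∣ weaken V →
              σ ∣ new M ⇓ σ′ ∣ V

  infix 2 _⇓_

  _⇓_ : Tm 0 → Tm 0 → Set
  M ⇓ V = [] ∣ M ⇓ [] ∣ V

  ----------------------------------------------------------------------
  -- Contextual equivalence

  -- Context Γ Θ: terms, with identifiers typed by Θ, containing one hole
  -- for terms typed in Γ. At the hole, ρ names the identifier (bound by the
  -- context, or free in it) that each identifier of Γ stands for; distinct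
  -- identifiers stay distinct and an identifier is captured only at its own
  -- type.
  data Context (Γ : Cxt m) : Cxt n → Set where
    hole    : {Θ : Cxt n} (ρ : Fin m → Fin n) → Injective _≡_ _≡_ ρ →
              (∀ i → lookup Θ (ρ i) ≡ lookup Γ i) → Context Γ Θ
    arithˡ  : {Θ : Cxt n} → Context Γ Θ → Op → Tm n → Context Γ Θ
    arithʳ  : {Θ : Cxt n} → Tm n → Op → Context Γ Θ → Context Γ Θ
    seqˡ    : {Θ : Cxt n} → Context Γ Θ → Tm n → Context Γ Θ
    seqʳ    : {Θ : Cxt n} → Tm n → Context Γ Θ → Context Γ Θ
    assignˡ : {Θ : Cxt n} → Context Γ Θ → Tm n → Context Γ Θ
    assignʳ : {Θ : Cxt n} → Tm n → Context Γ Θ → Context Γ Θ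
    deref   : {Θ : Cxt n} → Context Γ Θ → Context Γ Θ
    whileˡ  : {Θ : Cxt n} → Context Γ Θ → Tm n → Context Γ Θ
    whileʳ  : {Θ : Cxt n} → Tm n → Context Γ Θ → Context Γ Θ
    ifzero₀ : {Θ : Cxt n} → Context Γ Θ → Tm n → Tm n → Context Γ Θ
    ifzero₁ : {Θ : Cxt n} → Tm n → Context Γ Θ → Tm n → Context Γ Θ
    ifzero₂ : {Θ : Cxt n} → Tm n → Tm n → Context Γ Θ → Context Γ Θ
    lam     : {Θ : Cxt n} (A : Ty) → Context Γ (A ∷ Θ) → Context Γ Θ
    appˡ    : {Θ : Cxt n} → Context Γ Θ → Tm n → Context Γ Θ
    appʳ    : {Θ : Cxt n} → Tm n → Context Γ Θ → Context Γ Θ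
    new     : {Θ : Cxt n} → Context Γ (var ∷ Θ) → Context Γ Θ

  plug : {Γ : Cxt m} {Θ : Cxt n} → Context Γ Θ → Tm m → Tm n
  plug (hole ρ _ _)     M = rename ρ M
  plug (arithˡ C o N)   M = plug C M ⟨ o ⟩ N
  plug (arithʳ N o C)   M = N ⟨ o ⟩ plug C M
  plug (seqˡ C N)       M = plug C M ⨾ N
  plug (seqʳ N C)       M = N ⨾ plug C M
  plug (assignˡ C N)    M = plug C M := N
  plug (assignʳ N C)    M = N := plug C M
  plug (deref C)        M = ! plug C M
  plug (whileˡ C N)     M = while (plug C M) N
  plug (whileʳ N C)     M = while N (plug C M)
  plug (ifzero₀ C N N′) M = ifzero (plug C M) N N′
  plug (ifzero₁ N C N′) M = ifzero N (plug C M) N′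
  plug (ifzero₂ N N′ C) M = ifzero N N′ (plug C M)
  plug (lam A C)        M = ƛ A (plug C M)
  plug (appˡ C N)       M = plug C M · N
  plug (appʳ N C)       M = N · plug C M
  plug (new C)          M = new (plug C M)

  infix 2 _⊢_≅_

  -- P and Q are C[M] and C[N] as closed terms. Since Θ need not be empty, C
  -- may leave identifiers of Γ uncaptured, provided they do not occur in M
  -- or N.
  _⊢_≅_ : Cxt m → Tm m → Tm m → Set
  Γ ⊢ M ≅ N =
    ∀ {n} {Θ : Cxt n} (C : Context Γ Θ) (P Q : Tm 0) {B : Ty} →
    plug C M ≡ closed P → plug C N ≡ closed Q →
    Ground B → [] ⊢ P ∶ B → [] ⊢ Q ∶ B →
    ∀ (V : Tm 0) → Value V → [] ⊢ V ∶ B →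
    (P ⇓ V) ⇔ (Q ⇓ V)

  ----------------------------------------------------------------------
  -- Denotational semantics

  -- The MonRel morphism from Traces Γ to (α B)* denoted by a judgement,
  -- given by its restriction to the generators α B.
  ⟦_⟧ : {Γ : Cxt n} {M : Tm n} → Γ ⊢ M ∶ B → Traces Γ → α B → Set
  ⟦ axiom ⟧ s b = s ≡ List.[ b ] ∷ []
  ⟦ lam d ⟧ s (t , b) = ⟦ d ⟧ (t ∷ s) b
  ⟦ app {A = A} {Γ = Γ} {Δ = Δ} d e ⟧ r b =
    Σ[ s ∈ Traces Γ ] Σ[ t ∈ Traces Δ ] Σ[ as ∈ List (α A) ]
      r ≡ ++⁺ t s × ⟦ d ⟧ s (as , b) × Star ⟦ e ⟧ t as
  ⟦ weak d ⟧ r b = ∃[ s ] r ≡ List.[] ∷ s × ⟦ d ⟧ s b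
  ⟦ exchange π d ⟧ r b = ∃[ s ] r ≡ permuteTraces π s × ⟦ d ⟧ s b
  ⟦ numeral {a = a} ⟧ r b = b ≡ a
  ⟦ skip ⟧ r b = ⊤
  ⟦ arith {o = o} d e ⟧ r b =
    ∃[ s ] ∃[ t ] ∃[ a₁ ] ∃[ a₂ ]
      r ≡ s ∙ t × b ≡ apply o a₁ a₂ × ⟦ d ⟧ s a₁ × ⟦ e ⟧ t a₂
  ⟦ seq _ d e ⟧ r b = ∃[ s ] ∃[ t ] r ≡ s ∙ t × ⟦ d ⟧ s tt × ⟦ e ⟧ t b
  ⟦ assign d e ⟧ r _ =
    ∃[ s ] ∃[ t ] ∃[ a ] r ≡ s ∙ t × ⟦ e ⟧ s a × ⟦ d ⟧ t (write a)
  ⟦ deref d ⟧ r a = ⟦ d ⟧ r (read a)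
  ⟦ while {Γ = Γ} d e ⟧ r _ =
    ∃[ j ] ∃[ u ] ∃[ s ] ∃[ a ]
      r ≡ u ∙ s × Star iteration u (List.replicate j tt) × a ≢ 0 × ⟦ d ⟧ s a
    where
    iteration : Traces Γ → ⊤ → Set
    iteration v _ = ∃[ s ] ∃[ t ] v ≡ s ∙ t × ⟦ d ⟧ s 0 × ⟦ e ⟧ t tt
  ⟦ ifzero _ d e e′ ⟧ r b =
    (∃[ s ] ∃[ t ] r ≡ s ∙ t × ⟦ d ⟧ s 0 × ⟦ e ⟧ t b) ⊎
    (∃[ s ] ∃[ t ] ∃[ a ] r ≡ s ∙ t × a ≢ 0 × ⟦ d ⟧ s a × ⟦ e′ ⟧ t b)
  ⟦ new _ d ⟧ s b = ∃[ t ] ⟦ d ⟧ (t ∷ s) b × CellTrace t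

  infix 2 _≐_

  _≐_ : {Γ : Cxt n} → (R S : Traces Γ → α B → Set) → Set
  _≐_ {B = B} {Γ = Γ} R S = ∀ (s : Traces Γ) (b : α B) → R s b ⇔ S s b

{-# OPTIONS --safe #-}
module Submission where

-- Denotations are determined by raw terms, so everything is proved about an
-- inductive semantics Den on terms, with application restricted to arguments
-- using other identifiers than the function. Evaluation is sound by a
-- substitution lemma and adequate by a Kripke logical relation indexed by
-- traces of store actions; denotationally equal terms are therefore
-- contextually equivalent.
--
-- Conversely, a trace a of type A yields a test: a function of type A is
-- applied to an argument that emulates the required traces one after the other,
-- keeping count in a local variable, and performs the tests for its own
-- arguments. Without bad variables an argument of type var must be a cell, and
-- a cell cannot distinguish reading n from writing n; the test for a thus
-- accepts a whole down-set of a partial order. If M ≅ N and a is a trace of M,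
-- then N has a trace a₁ ≤ a, and M has a trace a₂ ≤ a₁. Denotations are cliques
-- of coherence spaces and a₂ ≤ a makes a₂ and a coherent, so a₂ = a, hence
-- a₁ = a.

open import Defs
open import Data.Fin.Base using (Fin; zero; suc; _↑ˡ_; _↑ʳ_; punchIn; punchOut)
open import Data.Fin.Permutation
  using (Permutation; Permutation′; permutation; id; insert; insert-punchIn; _⟨$⟩ʳ_;
         _⟨$⟩ˡ_; inverseˡ; inverseʳ; ↔⇒≡)
open import Data.Fin.Properties
  using (_≟_; any?; suc-injective; punchIn-punchOut; punchOut-injective; ↑ʳ-injective;
         ↑ˡ-injective)
open import Data.List.Base as List using (List; []; _∷_)
open import Data.List.Properties
  using (++-assoc; ++-identityʳ; ++-conicalˡ; ++-conicalʳ; ∷-injectiveˡ; ∷-injectiveʳ;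
         drop-map)
open import Data.Nat.Base using (ℕ; zero; suc; _+_; _∸_; _≤_)
open import Data.Nat.Properties
  using (≤-refl; ≤-reflexive; n≮n; m+1+n≰m; +-identityʳ; +-suc; ≤-trans; ≤-antisym;
         m∸n≡0⇒m≤n; m≤n⇒m∸n≡0)
open import Data.List.Relation.Unary.All using ([]; _∷_) renaming (All to ListAll)
open import Data.List.Relation.Binary.Pointwise as Pointwise using (Pointwise; []; _∷_)
open import Data.Product.Base using (Σ; ∃-syntax; _×_; _,_; proj₁; proj₂)
open import Data.Sum.Base using (_⊎_; inj₁; inj₂)
open import Data.Empty using (⊥)
open import Data.Unit.Base using (⊤; tt)
open import Data.Vec.Base using ([]; _∷_; _++_; lookup; tabulate; replicate; _[_]≔_)
open import Data.Vec.Properties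
  using (tabulate-cong; tabulate∘lookup; lookup∘tabulate; lookup∘update; lookup∘update′;
         lookup-replicate; lookup-++ˡ; lookup-++ʳ)
open import Data.Vec.Relation.Unary.All using ([]; _∷_; head; tail)
open import Data.Vec.Relation.Unary.All.Properties using (++⁺; tabulate⁺; lookup⁺)
open import Function.Base using (_∘_; case_of_)
open import Function.Definitions using (Injective)
open import Function.Bundles using (_⇔_; mk⇔; Equivalence)
open import Relation.Binary.PropositionalEquality
  using (_≡_; _≢_; refl; sym; trans; cong; cong₂; subst₂) renaming (subst to transport)
open import Relation.Nullary using (Dec; yes; no; contradiction; ¬_)
open import Relation.Nullary.Decidable using (_⊎-dec_; ¬?; decidable-stable)

-- A cell reveals its content only between two accesses, and reading a value leaves the same store
-- as writing that value again, so a test relying on a cell cannot be exact. Since exactness is lost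
-- there anyway, numbers too are compared one-sidedly, by truncated subtraction, which evaluates the
-- tested term once. Polarity makes this harmless: what a test accepts is related to the tested
-- trace by an order that meets coherence in equality only, what an emulation supplies by an order
-- contained in coherence, and the two exchange roles at arguments. Derivations of `⊢` are unsuited
-- to induction along evaluation: weakening and exchange may be inserted anywhere, and application
-- renames both subterms. In the logical relation actions are ordered on each cell separately; no
-- interleaving between cells is tracked, because a function and its argument use different cells.

private
  variable
    k m n : ℕ
    A B : Ty
    X : Set

-- Components of traces and their concatenation.

get : {Γ : Cxt n} → Traces Γ → ∀ i → lookup Γ i ≡ A → List (α A)
get (t ∷ s) zero    refl = t
get (t ∷ s) (suc i) p    = get s i p

tab : (Γ : Cxt n) → (∀ i {A} → lookup Γ i ≡ A → List (α A)) → Traces Γ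
tab []      f = []
tab (_ ∷ Γ) f = f zero refl ∷ tab Γ (λ i → f (suc i))

get-tab : (Γ : Cxt n) (f : ∀ i {A} → lookup Γ i ≡ A → List (α A)) →
          ∀ i (p : lookup Γ i ≡ A) → get (tab Γ f) i p ≡ f i p
get-tab (_ ∷ Γ) f zero    refl = refl
get-tab (_ ∷ Γ) f (suc i) p    = get-tab Γ (λ i → f (suc i)) i p

-- Components are addressed by an index and a proof that the type there is `A`. With `A` free,
-- components over different contexts are compared without transport along equations of types.
traces-ext : {Γ : Cxt n} {s t : Traces Γ} →
             (∀ i {A} (p : lookup Γ i ≡ A) → get s i p ≡ get t i p) → s ≡ t
traces-ext {s = []}    {[]}    eq = refl
traces-ext {s = _ ∷ _} {_ ∷ _} eq = cong₂ _∷_ (eq zero refl) (traces-ext (λ i → eq (suc i)))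

get-ε : (Γ : Cxt n) → ∀ i (p : lookup Γ i ≡ A) → get {Γ = Γ} ε i p ≡ []
get-ε (_ ∷ Γ) zero    refl = refl
get-ε (_ ∷ Γ) (suc i) p    = get-ε Γ i p

get-∙ : {Γ : Cxt n} (s t : Traces Γ) → ∀ i (p : lookup Γ i ≡ A) →
        get (s ∙ t) i p ≡ get s i p List.++ get t i p
get-∙ (_ ∷ _) (_ ∷ _) zero    refl = refl
get-∙ (_ ∷ s) (_ ∷ t) (suc i) p    = get-∙ s t i p

∙-assoc : {Γ : Cxt n} (s t u : Traces Γ) → (s ∙ t) ∙ u ≡ s ∙ (t ∙ u)
∙-assoc []      []      []      = refl
∙-assoc (a ∷ s) (b ∷ t) (c ∷ u) = cong₂ _∷_ (++-assoc a b c) (∙-assoc s t u)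

∙-identityˡ : {Γ : Cxt n} (s : Traces Γ) → ε ∙ s ≡ s
∙-identityˡ []      = refl
∙-identityˡ (_ ∷ s) = cong (_ ∷_) (∙-identityˡ s)

∙-identityʳ : {Γ : Cxt n} (s : Traces Γ) → s ∙ ε ≡ s
∙-identityʳ []      = refl
∙-identityʳ (a ∷ s) = cong₂ _∷_ (++-identityʳ a) (∙-identityʳ s)

single-trace : {Γ : Cxt n} → ∀ i → lookup Γ i ≡ A → α A → Traces Γ
single-trace {Γ = _ ∷ _} zero    refl a = (a ∷ []) ∷ ε
single-trace {Γ = _ ∷ _} (suc i) p    a = [] ∷ single-trace i p a

get-single : (Γ : Cxt n) → ∀ i (p q : lookup Γ i ≡ A) a → get {Γ = Γ} (single-trace i p a) i q ≡ a ∷ []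
get-single (_ ∷ Γ) zero    refl refl a = refl
get-single (_ ∷ Γ) (suc i) p    q    a = get-single Γ i p q a

get-single-≢ : (Γ : Cxt n) → ∀ {i j} (p : lookup Γ i ≡ A) (q : lookup Γ j ≡ B) a → i ≢ j →
               get {Γ = Γ} (single-trace i p a) j q ≡ []
get-single-≢ (_ ∷ Γ) {zero}  {zero}  p    q    a i≢j = contradiction refl i≢j
get-single-≢ (_ ∷ Γ) {zero}  {suc j} refl q    a i≢j = get-ε Γ j q
get-single-≢ (_ ∷ Γ) {suc i} {zero}  p    refl a i≢j = refl
get-single-≢ (_ ∷ Γ) {suc i} {suc j} p    q    a i≢j = get-single-≢ Γ p q a (i≢j ∘ cong suc)

infix 4 _#_

-- What the split of the context in an application amounts to for traces: function and argument may
-- live over one context as long as they act on different identifiers.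
_#_ : {Γ : Cxt n} → Traces Γ → Traces Γ → Set
_#_ {Γ = Γ} s t = ∀ i {A} (p : lookup Γ i ≡ A) → get s i p ≡ [] ⊎ get t i p ≡ []

Star-cong : {Γ : Cxt n} {R : Traces Γ → X → Set} {s t : Traces Γ} {as : List X} →
            s ≡ t → Star R s as → Star R t as
Star-cong refl ps = ps

Star-++ : {Γ : Cxt n} {R : Traces Γ → X → Set} {s t : Traces Γ} {as bs : List X} →
          Star R s as → Star R t bs → Star R (s ∙ t) (as List.++ bs)
Star-++ {R = R} {t = t} {bs = bs} [] qs = Star-cong (sym (∙-identityˡ t)) qs
Star-++ {R = R} {t = t} (_∷_ {t = u} {u = v} p ps) qs =
  Star-cong (sym (∙-assoc u v t)) (p ∷ Star-++ ps qs)

-- Embeddings of contexts and their action on traces.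

record Emb (Γ : Cxt m) (Θ : Cxt n) : Set where
  field
    fun       : Fin m → Fin n
    injective : ∀ {i j} → fun i ≡ fun j → i ≡ j
    typed     : ∀ i → lookup Θ (fun i) ≡ lookup Γ i

open Emb

module _ {Γ : Cxt m} {Θ : Cxt n} (φ : Emb Γ Θ) where

  pushAt : Traces Γ → ∀ {j} → Dec (∃[ i ] fun φ i ≡ j) → lookup Θ j ≡ A → List (α A)
  pushAt s (yes (i , refl)) q = get s i (trans (sym (typed φ i)) q)
  pushAt s (no _)           q = []

  pushAll : Traces Γ → ∀ j {A} → lookup Θ j ≡ A → List (α A)
  pushAll s j q = pushAt s (any? (λ i → fun φ i ≟ j)) q

  push : Traces Γ → Traces Θ
  push s = tab Θ (pushAll s)

  get-push : ∀ s i (p : lookup Γ i ≡ A) (q : lookup Θ (fun φ i) ≡ A) →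
             get (push s) (fun φ i) q ≡ get s i p
  get-push s i p q = trans (get-tab Θ (pushAll s) (fun φ i) q)
      (lemma (any? (λ j → fun φ j ≟ fun φ i)) p q)
    where
    same : ∀ {j} (d : fun φ j ≡ fun φ i) {A} (p : lookup Γ i ≡ A) (q : lookup Θ (fun φ i) ≡ A) →
           pushAt s (yes (j , d)) q ≡ get s i p
    same {j} d p q with injective φ d
    same refl refl q | refl with typed φ i
    -- The equation `typed φ i` can be matched only after one of its sides has become a variable.
    same {j} refl refl q | refl | t with lookup Θ (fun φ j)
    same refl refl refl | refl | refl | _ = refl
    lemma : ∀ (d : Dec (∃[ j ] fun φ j ≡ fun φ i)) {A} (p : lookup Γ i ≡ A)
        (q : lookup Θ (fun φ i) ≡ A) →
            pushAt s d q ≡ get s i p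
    lemma (yes (j , d)) p q = same d p q
    lemma (no ¬d)       p q = contradiction (i , refl) ¬d

  get-push-fresh : ∀ s j → (∀ i → fun φ i ≢ j) → (q : lookup Θ j ≡ A) → get (push s) j q ≡ []
  get-push-fresh s j fresh q = trans (get-tab Θ (pushAll s) j q) (lemma (any? (λ i → fun φ i ≟ j)))
    where
    lemma : (d : Dec (∃[ i ] fun φ i ≡ j)) → pushAt s d q ≡ []
    lemma (yes (i , d)) = contradiction d (fresh i)
    lemma (no _)        = refl

  -- Components in the image of the embedding are prescribed, all others are empty, and this
  -- determines the trace. Equations about `push`, among them its agreement with the given clauses
  -- for weakening and exchange, are instances.
  push-unique : ∀ {s r} →
                (∀ i {A} (p : lookup Γ i ≡ A) (q : lookup Θ (fun φ i) ≡ A) →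
                    get r (fun φ i) q ≡ get s i p) →
                (∀ j → (∀ i → fun φ i ≢ j) → ∀ {A} (q : lookup Θ j ≡ A) → get r j q ≡ []) →
                r ≡ push s
  push-unique {s} {r} image fresh = traces-ext λ j q → lemma j q (any? (λ i → fun φ i ≟ j))
    where
    lemma : ∀ j {A} (q : lookup Θ j ≡ A) → Dec (∃[ i ] fun φ i ≡ j) → get r j q ≡ get (push s) j q
    lemma j q (yes (i , refl)) = trans (image i p q) (sym (get-push s i p q))
      where p = trans (sym (typed φ i)) q
    lemma j q (no ¬d) = trans (fresh j f q) (sym (get-push-fresh s j f q))
      where f = λ i d → ¬d (i , d)

  push-ε : push ε ≡ ε
  push-ε = sym (push-unique (λ i p q → trans (get-ε Θ (fun φ i) q) (sym (get-ε Γ i p)))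
                            (λ j _ q → get-ε Θ j q))

  push-∙ : ∀ s t → push (s ∙ t) ≡ push s ∙ push t
  push-∙ s t = sym (push-unique image fresh)
    where
    image : ∀ i {A} (p : lookup Γ i ≡ A) (q : lookup Θ (fun φ i) ≡ A) →
            get (push s ∙ push t) (fun φ i) q ≡ get (s ∙ t) i p
    image i p q = trans (get-∙ (push s) (push t) (fun φ i) q)
      (trans (cong₂ List._++_ (get-push s i p q) (get-push t i p q)) (sym (get-∙ s t i p)))
    fresh : ∀ j → (∀ i → fun φ i ≢ j) → ∀ {A} (q : lookup Θ j ≡ A) → get (push s ∙ push t) j q ≡ []
    fresh j f q = trans (get-∙ (push s) (push t) j q)
      (cong₂ List._++_ (get-push-fresh s j f q) (get-push-fresh t j f q))

  push-single : ∀ i (p : lookup Γ i ≡ A) (q : lookup Θ (fun φ i) ≡ A) a →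
                push (single-trace i p a) ≡ single-trace (fun φ i) q a
  push-single i refl q a = sym (push-unique image fresh)
    where
    image : ∀ j {B} (p′ : lookup Γ j ≡ B) (q′ : lookup Θ (fun φ j) ≡ B) →
            get {Γ = Θ} (single-trace (fun φ i) q a) (fun φ j) q′ ≡ get {Γ = Γ}
                (single-trace i refl a) j p′
    image j p′ q′ with i ≟ j
    image j refl q′ | yes refl =
      trans (get-single Θ (fun φ j) q q′ a) (sym (get-single Γ j refl refl a))
    image j p′ q′ | no i≢j =
      trans (get-single-≢ Θ q q′ a (i≢j ∘ injective φ)) (sym (get-single-≢ Γ refl p′ a i≢j))
    fresh : ∀ j → (∀ i → fun φ i ≢ j) → ∀ {B} (q′ : lookup Θ j ≡ B) →
            get {Γ = Θ} (single-trace (fun φ i) q a) j q′ ≡ []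
    fresh j f q′ = get-single-≢ Θ q q′ a (f i)

  push-#⁺ : ∀ {s t} → s # t → push s # push t
  push-#⁺ {s} {t} s#t j q with any? (λ i → fun φ i ≟ j)
  ... | no ¬d = inj₁ (get-push-fresh s j (λ i d → ¬d (i , d)) q)
  ... | yes (i , refl) with s#t i (trans (sym (typed φ i)) q)
  ...   | inj₁ e = inj₁ (trans (get-push s i _ q) e)
  ...   | inj₂ e = inj₂ (trans (get-push t i _ q) e)

  push-#⁻ : ∀ {s t} → push s # push t → s # t
  push-#⁻ {s} {t} s#t i p with s#t (fun φ i) (trans (typed φ i) p)
  ... | inj₁ e = inj₁ (trans (sym (get-push s i p _)) e)
  ... | inj₂ e = inj₂ (trans (sym (get-push t i p _)) e)

module FullAbstraction (𝓐 : Arithmetic) where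

  open Arithmetic 𝓐
  open SCI 𝓐

  private
    variable
      Γ Δ : Cxt n
      Θ : Cxt k

  liftEmb : Emb Γ Θ → Emb (A ∷ Γ) (A ∷ Θ)
  liftEmb φ .fun = liftRen (fun φ)
  liftEmb φ .injective {zero}  {zero}  e = refl
  liftEmb φ .injective {suc i} {suc j} e = cong suc (injective φ (suc-injective e))
  liftEmb φ .typed zero    = refl
  liftEmb φ .typed (suc i) = typed φ i

  push-lift : (φ : Emb Γ Θ) (t : List (α A)) (s : Traces Γ) →
              push (liftEmb φ) (t ∷ s) ≡ t ∷ push φ s
  push-lift {Γ = Γ} {Θ = Θ} {A = A} φ t s = sym (push-unique (liftEmb φ) image fresh)
    where
    image : ∀ i {B} (p : lookup (A ∷ Γ) i ≡ B) (q : lookup (A ∷ Θ) (liftRen (fun φ) i) ≡ B) →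
            get (t ∷ push φ s) (liftRen (fun φ) i) q ≡ get (t ∷ s) i p
    image zero    refl refl = refl
    image (suc i) p    q    = get-push φ s i p q
    fresh : ∀ j → (∀ i → liftRen (fun φ) i ≢ j) → ∀ {B} (q : lookup (A ∷ Θ) j ≡ B) →
            get (t ∷ push φ s) j q ≡ []
    fresh zero    f q = contradiction refl (f zero)
    fresh (suc j) f q = get-push-fresh φ s j (λ i e → f (suc i) (cong suc e)) q

  -- A denotation that does not depend on a typing derivation. Interference
  -- control survives only as the condition s # t in the clause for application.
  data Den : ∀ {n} (Γ : Cxt n) → Tm n → (A : Ty) → Traces Γ → α A → Set where
    num     : ∀ {s a} → s ≡ ε → Den Γ (num a) nat s a
    skip    : ∀ {s} → s ≡ ε → Den Γ skip comm s tt
    ident   : ∀ {i s a} (p : lookup Γ i ≡ A) → s ≡ single-trace i p a → Den Γ (ident i) A s a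
    arith   : ∀ {M N o r s t a b c} → r ≡ s ∙ t → c ≡ apply o a b →
              Den Γ M nat s a → Den Γ N nat t b → Den Γ (M ⟨ o ⟩ N) nat r c
    seq     : ∀ {M N r s t b} → Base B → r ≡ s ∙ t →
              Den Γ M comm s tt → Den Γ N B t b → Den Γ (M ⨾ N) B r b
    assign  : ∀ {M N r s t a} → r ≡ s ∙ t →
              Den Γ N nat s a → Den Γ M var t (write a) → Den Γ (M := N) comm r tt
    deref   : ∀ {M s a} → Den Γ M var s (read a) → Den Γ (! M) nat s a
    stop    : ∀ {M N s a} → a ≢ 0 → Den Γ M nat s a → Den Γ (while M N) comm s tt
    loop    : ∀ {M N r s t u} → r ≡ s ∙ (t ∙ u) →
              Den Γ M nat s 0 → Den Γ N comm t tt → Den Γ (while M N) comm u tt →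
              Den Γ (while M N) comm r tt
    ifzero₁ : ∀ {M N N′ r s t b} → Base B → r ≡ s ∙ t →
              Den Γ M nat s 0 → Den Γ N B t b → Den Γ (ifzero M N N′) B r b
    ifzero₂ : ∀ {M N N′ r s t a b} → Base B → r ≡ s ∙ t → a ≢ 0 →
              Den Γ M nat s a → Den Γ N′ B t b → Den Γ (ifzero M N N′) B r b
    lam     : ∀ {M s t b} → Den (A ∷ Γ) M B (t ∷ s) b → Den Γ (ƛ A M) (A ⊸ B) s (t , b)
    app     : ∀ {M N r s t as b} → r ≡ s ∙ t → s # t →
              Den Γ M (A ⊸ B) s (as , b) → Star (Den Γ N A) t as → Den Γ (M · N) B r b
    new     : ∀ {M s t b} → Ground B → CellTrace t →
              Den (var ∷ Γ) M B (t ∷ s) b → Den Γ (new M) B s b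

  Den-cong : ∀ {M s t a} → s ≡ t → Den Γ M A s a → Den Γ M A t a
  Den-cong refl d = d

  mutual

    rename-Den : (φ : Emb Γ Θ) → ∀ {M s a} → Den Γ M A s a → Den Θ (rename (fun φ) M) A (push φ s) a
    rename-Den φ (num refl) = num (push-ε φ)
    rename-Den φ (skip refl) = skip (push-ε φ)
    rename-Den φ (ident {i = i} p refl) =
      ident (trans (typed φ i) p) (push-single φ i p _ _)
    rename-Den φ (arith {s = s} {t} refl e d d′) =
      arith (push-∙ φ s t) e (rename-Den φ d) (rename-Den φ d′)
    rename-Den φ (seq {s = s} {t} β refl d d′) =
      seq β (push-∙ φ s t) (rename-Den φ d) (rename-Den φ d′)
    rename-Den φ (assign {s = s} {t} refl d d′) =
      assign (push-∙ φ s t) (rename-Den φ d) (rename-Den φ d′)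
    rename-Den φ (deref d) = deref (rename-Den φ d)
    rename-Den φ (stop a≢0 d) = stop a≢0 (rename-Den φ d)
    rename-Den φ (loop {s = s} {t} {u} refl d d′ d″) =
      loop (trans (push-∙ φ s (t ∙ u)) (cong (push φ s ∙_) (push-∙ φ t u)))
        (rename-Den φ d) (rename-Den φ d′) (rename-Den φ d″)
    rename-Den φ (ifzero₁ {s = s} {t} β refl d d′) =
      ifzero₁ β (push-∙ φ s t) (rename-Den φ d) (rename-Den φ d′)
    rename-Den φ (ifzero₂ {s = s} {t} β refl a≢0 d d′) =
      ifzero₂ β (push-∙ φ s t) a≢0 (rename-Den φ d) (rename-Den φ d′)
    rename-Den φ (lam {M = M} {s} {t} d) =
      lam (Den-cong (push-lift φ t s) (rename-Den (liftEmb φ) d))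
    rename-Den φ (app {s = s} {t} refl s#t d ds) =
      app (push-∙ φ s t) (push-#⁺ φ s#t) (rename-Den φ d) (rename-Star φ ds)
    rename-Den φ (new {s = s} {t} γ c d) =
      new γ c (Den-cong (push-lift φ t s) (rename-Den (liftEmb φ) d))

    rename-Star : (φ : Emb Γ Θ) → ∀ {M s as} →
                  Star (Den Γ M A) s as → Star (Den Θ (rename (fun φ) M) A) (push φ s) as
    rename-Star φ [] = Star-cong (sym (push-ε φ)) []
    rename-Star φ (_∷_ {t = s} {u = t} d ds) =
      Star-cong (sym (push-∙ φ s t)) (rename-Den φ d ∷ rename-Star φ ds)

  mutual

    -- Identifiers outside the image of `φ` do not occur in the renamed term, so nothing happens on
    -- them. This inverts the clauses of `weak`, `exchange` and `app`, where terms occur renamed,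
    -- and the plugging of a hole.
    rename-Den⁻ : (φ : Emb Γ Θ) → ∀ M {r a} → Den Θ (rename (fun φ) M) A r a →
                  ∃[ s ] r ≡ push φ s × Den Γ M A s a
    rename-Den⁻ φ (num _) (num refl) = ε , sym (push-ε φ) , num refl
    rename-Den⁻ φ skip (skip refl) = ε , sym (push-ε φ) , skip refl
    rename-Den⁻ φ (ident i) (ident p refl) =
      _ , sym (push-single φ i (trans (sym (typed φ i)) p) p _) , ident _ refl
    rename-Den⁻ φ (M ⟨ o ⟩ N) (arith refl e d d′)
      with rename-Den⁻ φ M d | rename-Den⁻ φ N d′
    ... | s , refl , f | t , refl , f′ = s ∙ t , sym (push-∙ φ s t) , arith refl e f f′
    rename-Den⁻ φ (M ⨾ N) (seq β refl d d′)
      with rename-Den⁻ φ M d | rename-Den⁻ φ N d′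
    ... | s , refl , f | t , refl , f′ = s ∙ t , sym (push-∙ φ s t) , seq β refl f f′
    rename-Den⁻ φ (M := N) (assign refl d d′)
      with rename-Den⁻ φ N d | rename-Den⁻ φ M d′
    ... | s , refl , f | t , refl , f′ = s ∙ t , sym (push-∙ φ s t) , assign refl f f′
    rename-Den⁻ φ (! M) (deref d) with rename-Den⁻ φ M d
    ... | s , e , f = s , e , deref f
    rename-Den⁻ φ (while M N) (stop a≢0 d) with rename-Den⁻ φ M d
    ... | s , e , f = s , e , stop a≢0 f
    rename-Den⁻ φ (while M N) (loop refl d d′ d″)
      with rename-Den⁻ φ M d | rename-Den⁻ φ N d′ | rename-Den⁻ φ (while M N) d″
    ... | s , refl , f | t , refl , f′ | u , refl , f″ =
      s ∙ (t ∙ u) ,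
      sym (trans (push-∙ φ s (t ∙ u)) (cong (push φ s ∙_) (push-∙ φ t u))) ,
      loop refl f f′ f″
    rename-Den⁻ φ (ifzero M N N′) (ifzero₁ β refl d d′)
      with rename-Den⁻ φ M d | rename-Den⁻ φ N d′
    ... | s , refl , f | t , refl , f′ = s ∙ t , sym (push-∙ φ s t) , ifzero₁ β refl f f′
    rename-Den⁻ φ (ifzero M N N′) (ifzero₂ β refl a≢0 d d′)
      with rename-Den⁻ φ M d | rename-Den⁻ φ N′ d′
    ... | s , refl , f | t , refl , f′ = s ∙ t , sym (push-∙ φ s t) , ifzero₂ β refl a≢0 f f′
    rename-Den⁻ φ (ƛ A M) (lam d) with rename-Den⁻ (liftEmb φ) M d
    ... | t ∷ s , e , f with trans e (push-lift φ t s)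
    ...   | refl = s , refl , lam f
    rename-Den⁻ φ (M · N) (app refl s#t d ds)
      with rename-Den⁻ φ M d | rename-Star⁻ φ N ds
    ... | s , refl , f | t , refl , fs =
      s ∙ t , sym (push-∙ φ s t) , app refl (push-#⁻ φ s#t) f fs
    rename-Den⁻ φ (new M) (new γ c d) with rename-Den⁻ (liftEmb φ) M d
    ... | t ∷ s , e , f with trans e (push-lift φ t s)
    ...   | refl = s , refl , new γ c f

    rename-Star⁻ : (φ : Emb Γ Θ) → ∀ M {r as} → Star (Den Θ (rename (fun φ) M) A) r as →
                   ∃[ s ] r ≡ push φ s × Star (Den Γ M A) s as
    rename-Star⁻ φ M [] = ε , sym (push-ε φ) , []
    rename-Star⁻ φ M (d ∷ ds) with rename-Den⁻ φ M d | rename-Star⁻ φ M ds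
    ... | s , refl , f | t , refl , fs = s ∙ t , sym (push-∙ φ s t) , f ∷ fs

  -- Simple types with disjointness

  Occ : Fin n → Tm n → Set
  Occ x (num a)         = ⊥
  Occ x (M ⟨ o ⟩ N)     = Occ x M ⊎ Occ x N
  Occ x skip            = ⊥
  Occ x (M ⨾ N)         = Occ x M ⊎ Occ x N
  Occ x (M := N)        = Occ x M ⊎ Occ x N
  Occ x (! M)           = Occ x M
  Occ x (while M N)     = Occ x M ⊎ Occ x N
  Occ x (ifzero M N N′) = Occ x M ⊎ Occ x N ⊎ Occ x N′
  Occ x (ident i)       = x ≡ i
  Occ x (ƛ A M)         = Occ (suc x) M
  Occ x (M · N)         = Occ x M ⊎ Occ x N
  Occ x (new M)         = Occ (suc x) M

  infix 3 _⊩_∶_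

  -- Unlike `⊢`, whose structural rules apply anywhere, this judgement is directed by the term:
  -- derivations can be inverted along evaluation, and substitution preserves them when its values
  -- use different identifiers. The split of the context becomes the absence of common identifiers.
  data _⊩_∶_ : ∀ {n} → Cxt n → Tm n → Ty → Set where
    num    : ∀ {a} → Γ ⊩ num a ∶ nat
    skip   : Γ ⊩ skip ∶ comm
    ident  : ∀ {i} → lookup Γ i ≡ A → Γ ⊩ ident i ∶ A
    arith  : ∀ {M N o} → Γ ⊩ M ∶ nat → Γ ⊩ N ∶ nat → Γ ⊩ M ⟨ o ⟩ N ∶ nat
    seq    : ∀ {M N} → Base B → Γ ⊩ M ∶ comm → Γ ⊩ N ∶ B → Γ ⊩ M ⨾ N ∶ B
    assign : ∀ {M N} → Γ ⊩ M ∶ var → Γ ⊩ N ∶ nat → Γ ⊩ M := N ∶ comm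
    deref  : ∀ {M} → Γ ⊩ M ∶ var → Γ ⊩ ! M ∶ nat
    while  : ∀ {M N} → Γ ⊩ M ∶ nat → Γ ⊩ N ∶ comm → Γ ⊩ while M N ∶ comm
    ifzero : ∀ {M N N′} → Base B → Γ ⊩ M ∶ nat → Γ ⊩ N ∶ B → Γ ⊩ N′ ∶ B →
             Γ ⊩ ifzero M N N′ ∶ B
    lam    : ∀ {M} → A ∷ Γ ⊩ M ∶ B → Γ ⊩ ƛ A M ∶ A ⊸ B
    app    : ∀ {M N} → (∀ x → Occ x M → ¬ Occ x N) →
             Γ ⊩ M ∶ A ⊸ B → Γ ⊩ N ∶ A → Γ ⊩ M · N ∶ B
    new    : ∀ {M} → Ground B → var ∷ Γ ⊩ M ∶ B → Γ ⊩ new M ∶ B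

  Occ-rename⁻ : (ρ : Fin m → Fin n) → ∀ M {y} → Occ y (rename ρ M) → ∃[ x ] y ≡ ρ x × Occ x M
  Occ-rename⁻ ρ (M ⟨ o ⟩ N)     (inj₁ p) = case Occ-rename⁻ ρ M p of λ (x , e , q) → x , e , inj₁ q
  Occ-rename⁻ ρ (M ⟨ o ⟩ N)     (inj₂ p) = case Occ-rename⁻ ρ N p of λ (x , e , q) → x , e , inj₂ q
  Occ-rename⁻ ρ (M ⨾ N)         (inj₁ p) = case Occ-rename⁻ ρ M p of λ (x , e , q) → x , e , inj₁ q
  Occ-rename⁻ ρ (M ⨾ N)         (inj₂ p) = case Occ-rename⁻ ρ N p of λ (x , e , q) → x , e , inj₂ q
  Occ-rename⁻ ρ (M := N)        (inj₁ p) = case Occ-rename⁻ ρ M p of λ (x , e , q) → x , e , inj₁ q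
  Occ-rename⁻ ρ (M := N)        (inj₂ p) = case Occ-rename⁻ ρ N p of λ (x , e , q) → x , e , inj₂ q
  Occ-rename⁻ ρ (! M)           p        = Occ-rename⁻ ρ M p
  Occ-rename⁻ ρ (while M N)     (inj₁ p) = case Occ-rename⁻ ρ M p of λ (x , e , q) → x , e , inj₁ q
  Occ-rename⁻ ρ (while M N)     (inj₂ p) = case Occ-rename⁻ ρ N p of λ (x , e , q) → x , e , inj₂ q
  Occ-rename⁻ ρ (ifzero M N N′) (inj₁ p) = case Occ-rename⁻ ρ M p of λ (x , e , q) → x , e , inj₁ q
  Occ-rename⁻ ρ (ifzero M N N′) (inj₂ (inj₁ p)) =
    case Occ-rename⁻ ρ N p of λ (x , e , q) → x , e , inj₂ (inj₁ q)
  Occ-rename⁻ ρ (ifzero M N N′) (inj₂ (inj₂ p)) =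
    case Occ-rename⁻ ρ N′ p of λ (x , e , q) → x , e , inj₂ (inj₂ q)
  Occ-rename⁻ ρ (ident i)       refl     = i , refl , refl
  Occ-rename⁻ ρ (ƛ A M)         p with Occ-rename⁻ (liftRen ρ) M p
  ... | suc x , e , q = x , suc-injective e , q
  Occ-rename⁻ ρ (M · N)         (inj₁ p) = case Occ-rename⁻ ρ M p of λ (x , e , q) → x , e , inj₁ q
  Occ-rename⁻ ρ (M · N)         (inj₂ p) = case Occ-rename⁻ ρ N p of λ (x , e , q) → x , e , inj₂ q
  Occ-rename⁻ ρ (new M)         p with Occ-rename⁻ (liftRen ρ) M p
  ... | suc x , e , q = x , suc-injective e , q

  rename-⊩ : (φ : Emb Γ Θ) → ∀ {M} → Γ ⊩ M ∶ A → Θ ⊩ rename (fun φ) M ∶ A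
  rename-⊩ φ num              = num
  rename-⊩ φ skip             = skip
  rename-⊩ φ (ident p)        = ident (trans (typed φ _) p)
  rename-⊩ φ (arith d e)      = arith (rename-⊩ φ d) (rename-⊩ φ e)
  rename-⊩ φ (seq β d e)      = seq β (rename-⊩ φ d) (rename-⊩ φ e)
  rename-⊩ φ (assign d e)     = assign (rename-⊩ φ d) (rename-⊩ φ e)
  rename-⊩ φ (deref d)        = deref (rename-⊩ φ d)
  rename-⊩ φ (while d e)      = while (rename-⊩ φ d) (rename-⊩ φ e)
  rename-⊩ φ (ifzero β d e f) = ifzero β (rename-⊩ φ d) (rename-⊩ φ e) (rename-⊩ φ f)
  rename-⊩ φ (lam d)          = lam (rename-⊩ (liftEmb φ) d)
  rename-⊩ φ (app {M = M} {N} dis d e) = app dis′ (rename-⊩ φ d) (rename-⊩ φ e)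
    where
    dis′ : ∀ x → Occ x (rename (fun φ) M) → ¬ Occ x (rename (fun φ) N)
    dis′ x p q with Occ-rename⁻ (fun φ) M p | Occ-rename⁻ (fun φ) N q
    ... | y , refl , p′ | z , e , q′ with injective φ e
    ...   | refl = dis y p′ q′
  rename-⊩ φ (new γ d)        = new γ (rename-⊩ (liftEmb φ) d)

  -- The structural rules as embeddings.

  weakEmb : {Γ : Cxt n} → Emb Γ (A ∷ Γ)
  weakEmb .fun       = suc
  weakEmb .injective = suc-injective
  weakEmb .typed i   = refl

  push-weak : {Γ : Cxt n} (s : Traces Γ) → push (weakEmb {A = A}) s ≡ [] ∷ s
  push-weak {A = A} {Γ = Γ} s = sym (push-unique weakEmb image fresh)
    where
    image : ∀ i {B} (p q : lookup Γ i ≡ B) → get s i q ≡ get s i p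
    image i refl refl = refl
    fresh : ∀ j → (∀ i → suc i ≢ j) → ∀ {B} (q : lookup (A ∷ Γ) j ≡ B) → get ([] ∷ s) j q ≡ []
    fresh zero    f refl = refl
    fresh (suc j) f q    = contradiction refl (f j)

  leftEmb : (Δ : Cxt n) (Γ : Cxt m) → Emb Δ (Δ ++ Γ)
  leftEmb {m = m} Δ Γ .fun   = _↑ˡ m
  leftEmb Δ Γ .injective     = ↑ˡ-injective _ _ _
  leftEmb Δ Γ .typed         = lookup-++ˡ Δ Γ

  rightEmb : (Δ : Cxt n) (Γ : Cxt m) → Emb Γ (Δ ++ Γ)
  rightEmb {n = n} Δ Γ .fun  = n ↑ʳ_
  rightEmb Δ Γ .injective    = ↑ʳ-injective _ _ _
  rightEmb Δ Γ .typed        = lookup-++ʳ Δ Γ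

  get-++ˡ : {Δ : Cxt n} {Γ : Cxt m} (t : Traces Δ) (s : Traces Γ) → ∀ i {A}
            (p : lookup Δ i ≡ A) (q : lookup (Δ ++ Γ) (i ↑ˡ m) ≡ A) →
                get (++⁺ t s) (i ↑ˡ m) q ≡ get t i p
  get-++ˡ (_ ∷ t) s zero    refl refl = refl
  get-++ˡ (_ ∷ t) s (suc i) p    q    = get-++ˡ t s i p q

  get-++ʳ : {Δ : Cxt n} {Γ : Cxt m} (t : Traces Δ) (s : Traces Γ) → ∀ i {A}
            (p : lookup Γ i ≡ A) (q : lookup (Δ ++ Γ) (n ↑ʳ i) ≡ A) →
                get (++⁺ t s) (n ↑ʳ i) q ≡ get s i p
  get-++ʳ []      s i refl refl = refl
  get-++ʳ (_ ∷ t) s i p    q    = get-++ʳ t s i p q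

  data SplitView (n : ℕ) {m : ℕ} : Fin (n + m) → Set where
    inˡ : ∀ i → SplitView n (i ↑ˡ m)
    inʳ : ∀ i → SplitView n (n ↑ʳ i)

  splitView : ∀ n {m} (j : Fin (n + m)) → SplitView n j
  splitView zero    j       = inʳ j
  splitView (suc n) zero    = inˡ zero
  splitView (suc n) (suc j) with splitView n j
  ... | inˡ i = inˡ (suc i)
  ... | inʳ i = inʳ i

  push-left : {Δ : Cxt n} {Γ : Cxt m} (t : Traces Δ) → push (leftEmb Δ Γ) t ≡ ++⁺ t ε
  push-left {n = n} {m = m} {Δ = Δ} {Γ} t =
    sym (push-unique (leftEmb Δ Γ) (λ i p q → get-++ˡ t ε i p q) fresh)
    where
    fresh : ∀ j → (∀ i → i ↑ˡ m ≢ j) → ∀ {A} (q : lookup (Δ ++ Γ) j ≡ A) → get (++⁺ t ε) j q ≡ []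
    fresh j f q with splitView n j
    ... | inˡ i = contradiction refl (f i)
    ... | inʳ i = trans (get-++ʳ t ε i (trans (sym (lookup-++ʳ Δ Γ i)) q) q) (get-ε Γ i _)

  push-right : {Δ : Cxt n} {Γ : Cxt m} (s : Traces Γ) → push (rightEmb Δ Γ) s ≡ ++⁺ (ε {Γ = Δ}) s
  push-right {n = n} {m = m} {Δ = Δ} {Γ} s =
    sym (push-unique (rightEmb Δ Γ) (λ i p q → get-++ʳ (ε {Γ = Δ}) s i p q) fresh)
    where
    fresh : ∀ j → (∀ i → n ↑ʳ i ≢ j) → ∀ {A} (q : lookup (Δ ++ Γ) j ≡ A) →
        get (++⁺ (ε {Γ = Δ}) s) j q ≡ []
    fresh j f q with splitView n j
    ... | inˡ i = trans (get-++ˡ (ε {Γ = Δ}) s i (trans (sym (lookup-++ˡ Δ Γ i)) q) q) (get-ε Δ i _)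
    ... | inʳ i = contradiction refl (f i)

  ++⁺-∙ : {Δ : Cxt n} {Γ : Cxt m} (t t′ : Traces Δ) (s s′ : Traces Γ) →
          ++⁺ t s ∙ ++⁺ t′ s′ ≡ ++⁺ (t ∙ t′) (s ∙ s′)
  ++⁺-∙ []      []       s s′ = refl
  ++⁺-∙ (_ ∷ t) (_ ∷ t′) s s′ = cong (_ ∷_) (++⁺-∙ t t′ s s′)

  -- The halves of a concatenated context share no identifier, so pairing their traces is
  -- concatenating their extensions by empty components. The function's trace comes first to match
  -- `app` of `Den`.
  push-++ : {Δ : Cxt n} {Γ : Cxt m} (t : Traces Δ) (s : Traces Γ) →
            ++⁺ t s ≡ push (rightEmb Δ Γ) s ∙ push (leftEmb Δ Γ) t
  push-++ {Δ = Δ} {Γ} t s = sym (trans (cong₂ _∙_ (push-right {Δ = Δ} s) (push-left {Γ = Γ} t))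
    (trans (++⁺-∙ ε t s ε) (cong₂ ++⁺ (∙-identityˡ t) (∙-identityʳ s))))

  ↑ʳ≢↑ˡ : ∀ n {m} (i : Fin m) (j : Fin n) → n ↑ʳ i ≢ j ↑ˡ m
  ↑ʳ≢↑ˡ (suc n) i (suc j) e = ↑ʳ≢↑ˡ n i j (suc-injective e)

  right#left : {Δ : Cxt n} {Γ : Cxt m} (t : Traces Δ) (s : Traces Γ) →
               push (rightEmb Δ Γ) s # push (leftEmb Δ Γ) t
  right#left {n = n} {m = m} {Δ = Δ} {Γ} t s j q with splitView n j
  ... | inˡ i = inj₁ (get-push-fresh (rightEmb Δ Γ) s (i ↑ˡ m) (λ i′ → ↑ʳ≢↑ˡ n i′ i) q)
  ... | inʳ i = inj₂ (get-push-fresh (leftEmb Δ Γ) t (n ↑ʳ i) (λ i′ e → ↑ʳ≢↑ˡ n i i′ (sym e)) q)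

  permuteEmb : (π : Permutation′ n) (Γ : Cxt n) → Emb Γ (permute π Γ)
  permuteEmb π Γ .fun = π ⟨$⟩ʳ_
  permuteEmb π Γ .injective {i} {j} e =
    trans (sym (inverseˡ π)) (trans (cong (π ⟨$⟩ˡ_) e) (inverseˡ π))
  permuteEmb π Γ .typed i =
    trans (lookup∘tabulate _ (π ⟨$⟩ʳ i)) (cong (lookup Γ) (inverseˡ π))

  get-tabulate⁺ : {g : Fin n → Ty} (f : ∀ i → List (α (g i))) → ∀ i (p : g i ≡ A) q →
                  get (tabulate⁺ f) i q ≡ transport (List ∘ α) p (f i)
  get-tabulate⁺ f zero    refl refl = refl
  get-tabulate⁺ f (suc i) p    q    = get-tabulate⁺ (f ∘ suc) i p q

  get-lookup⁺ : {Γ : Cxt n} (s : Traces Γ) → ∀ i (p : lookup Γ i ≡ A) →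
                transport (List ∘ α) p (lookup⁺ s i) ≡ get s i p
  get-lookup⁺ (_ ∷ s) zero    refl = refl
  get-lookup⁺ (_ ∷ s) (suc i) p    = get-lookup⁺ s i p

  push-permute : (π : Permutation′ n) {Γ : Cxt n} (s : Traces Γ) →
                 push (permuteEmb π Γ) s ≡ permuteTraces π s
  push-permute π {Γ} s = sym (push-unique (permuteEmb π Γ) image fresh)
    where
    get-cong : ∀ {i j} → i ≡ j → ∀ {A} (p : lookup Γ i ≡ A) (q : lookup Γ j ≡ A) → get s i p ≡ get s j q
    get-cong refl refl refl = refl
    image : ∀ i {A} (p : lookup Γ i ≡ A) (q : lookup (permute π Γ) (π ⟨$⟩ʳ i) ≡ A) →
            get (permuteTraces π s) (π ⟨$⟩ʳ i) q ≡ get s i p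
    image i p q = trans (get-tabulate⁺ _ (π ⟨$⟩ʳ i) p′ q)
      (trans (get-lookup⁺ s _ p′) (get-cong (inverseˡ π) p′ p))
      where p′ = trans (cong (lookup Γ) (inverseˡ π)) p
    fresh : ∀ j → (∀ i → π ⟨$⟩ʳ i ≢ j) → ∀ {A} (q : lookup (permute π Γ) j ≡ A) →
            get (permuteTraces π s) j q ≡ []
    fresh j f q = contradiction (inverseʳ π) (f (π ⟨$⟩ˡ j))

  -- Agreement with the given typing and the given semantics.

  ⊢⇒⊩ : {Γ : Cxt n} {M : Tm n} → Γ ⊢ M ∶ A → Γ ⊩ M ∶ A
  ⊢⇒⊩ axiom = ident refl
  ⊢⇒⊩ (lam d) = lam (⊢⇒⊩ d)
  ⊢⇒⊩ (app {n = n} {Γ = Γ} {Δ = Δ} {M} {N} d e) =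
    app dis (rename-⊩ (rightEmb Δ Γ) (⊢⇒⊩ d)) (rename-⊩ (leftEmb Δ Γ) (⊢⇒⊩ e))
    where
    dis : ∀ x → Occ x (rename (n ↑ʳ_) M) → ¬ Occ x (rename (_↑ˡ _) N)
    dis x p q with Occ-rename⁻ (n ↑ʳ_) M p | Occ-rename⁻ (_↑ˡ _) N q
    ... | y , refl , _ | z , e , _ = ↑ʳ≢↑ˡ n y z e
  ⊢⇒⊩ (weak d) = rename-⊩ weakEmb (⊢⇒⊩ d)
  ⊢⇒⊩ (exchange {Γ = Γ} π d) = rename-⊩ (permuteEmb π Γ) (⊢⇒⊩ d)
  ⊢⇒⊩ numeral = num
  ⊢⇒⊩ skip = skip
  ⊢⇒⊩ (arith d e) = arith (⊢⇒⊩ d) (⊢⇒⊩ e)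
  ⊢⇒⊩ (seq β d e) = seq β (⊢⇒⊩ d) (⊢⇒⊩ e)
  ⊢⇒⊩ (assign d e) = assign (⊢⇒⊩ d) (⊢⇒⊩ e)
  ⊢⇒⊩ (deref d) = deref (⊢⇒⊩ d)
  ⊢⇒⊩ (while d e) = while (⊢⇒⊩ d) (⊢⇒⊩ e)
  ⊢⇒⊩ (ifzero β d e f) = ifzero β (⊢⇒⊩ d) (⊢⇒⊩ e) (⊢⇒⊩ f)
  ⊢⇒⊩ (new γ d) = new γ (⊢⇒⊩ d)

  -- The constructor `app` of `Den` leaves the type of the argument open; a typing of the function
  -- pins it down. This allows an element of `Den` to be read back along a derivation.
  Den-type : ∀ {M s a} → Γ ⊩ M ∶ A → Den Γ M B s a → A ≡ B
  Den-type num               (num _)             = refl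
  Den-type skip              (skip _)            = refl
  Den-type (ident p)         (ident q _)         = trans (sym p) q
  Den-type (arith _ _)       (arith _ _ _ _)     = refl
  Den-type (seq _ _ d)       (seq _ _ _ e)       = Den-type d e
  Den-type (assign _ _)      (assign _ _ _)      = refl
  Den-type (deref _)         (deref _)           = refl
  Den-type (while _ _)       (stop _ _)          = refl
  Den-type (while _ _)       (loop _ _ _ _)      = refl
  Den-type (ifzero _ _ d _)  (ifzero₁ _ _ _ e)   = Den-type d e
  Den-type (ifzero _ _ _ d)  (ifzero₂ _ _ _ _ e) = Den-type d e
  Den-type (lam d)           (lam e)             = cong (_ ⊸_) (Den-type d e)
  Den-type (app _ d _)       (app _ _ e _)       = case Den-type d e of λ { refl → refl }
  Den-type (new _ d)         (new _ _ e)         = Den-type d e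

  mutual

    ⟦⟧⇒Den : {Γ : Cxt n} {M : Tm n} (d : Γ ⊢ M ∶ A) → ∀ {s a} → ⟦ d ⟧ s a → Den Γ M A s a
    ⟦⟧⇒Den axiom refl = ident refl refl
    ⟦⟧⇒Den (lam d) x = lam (⟦⟧⇒Den d x)
    ⟦⟧⇒Den (app {Γ = Γ} {Δ = Δ} d e) (s , t , as , refl , x , xs) =
      app (push-++ t s) (right#left t s) (rename-Den (rightEmb Δ Γ) (⟦⟧⇒Den d x))
        (rename-Star (leftEmb Δ Γ) (⟦⟧⇒Star e xs))
    ⟦⟧⇒Den (weak d) (s , refl , x) = Den-cong (push-weak s) (rename-Den weakEmb (⟦⟧⇒Den d x))
    ⟦⟧⇒Den (exchange {Γ = Γ} π d) (s , refl , x) =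
      Den-cong (push-permute π s) (rename-Den (permuteEmb π Γ) (⟦⟧⇒Den d x))
    ⟦⟧⇒Den numeral {[]} refl = num refl
    ⟦⟧⇒Den skip {[]} _ = skip refl
    ⟦⟧⇒Den (arith d e) (s , t , a , b , r , c , x , y) = arith r c (⟦⟧⇒Den d x) (⟦⟧⇒Den e y)
    ⟦⟧⇒Den (seq β d e) (s , t , r , x , y) = seq β r (⟦⟧⇒Den d x) (⟦⟧⇒Den e y)
    ⟦⟧⇒Den (assign d e) (s , t , a , r , x , y) = assign r (⟦⟧⇒Den e x) (⟦⟧⇒Den d y)
    ⟦⟧⇒Den (deref d) x = deref (⟦⟧⇒Den d x)
    -- `Den` unfolds one iteration at a time, whereas the given clause lists all `j` iterations at
    -- once; hence an induction on `j`.
    ⟦⟧⇒Den (while d e) (j , u , s , a , refl , xs , a≢0 , y) = go j xs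
      where
      go : ∀ j {u} → Star _ u (List.replicate j tt) → Den _ (while _ _) comm (u ∙ s) tt
      go zero    [] = Den-cong (sym (∙-identityˡ s)) (stop a≢0 (⟦⟧⇒Den d y))
      go (suc j) (_∷_ {u = u} (s′ , t′ , refl , x , x′) xs) =
        loop (trans (∙-assoc (s′ ∙ t′) u s) (∙-assoc s′ t′ (u ∙ s)))
          (⟦⟧⇒Den d x) (⟦⟧⇒Den e x′) (go j xs)
    ⟦⟧⇒Den (ifzero β d e f) (inj₁ (s , t , r , x , y)) = ifzero₁ β r (⟦⟧⇒Den d x) (⟦⟧⇒Den e y)
    ⟦⟧⇒Den (ifzero β d e f) (inj₂ (s , t , a , r , a≢0 , x , y)) =
      ifzero₂ β r a≢0 (⟦⟧⇒Den d x) (⟦⟧⇒Den f y)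
    ⟦⟧⇒Den (new γ d) (t , x , c) = new γ c (⟦⟧⇒Den d x)

    ⟦⟧⇒Star : {Γ : Cxt n} {M : Tm n} (d : Γ ⊢ M ∶ A) → ∀ {s as} →
              Star ⟦ d ⟧ s as → Star (Den Γ M A) s as
    ⟦⟧⇒Star d []       = []
    ⟦⟧⇒Star d (x ∷ xs) = ⟦⟧⇒Den d x ∷ ⟦⟧⇒Star d xs

  mutual

    Den⇒⟦⟧ : {Γ : Cxt n} {M : Tm n} (d : Γ ⊢ M ∶ A) → ∀ {s a} → Den Γ M A s a → ⟦ d ⟧ s a
    Den⇒⟦⟧ axiom (ident refl e) = e
    Den⇒⟦⟧ (lam d) (lam x) = Den⇒⟦⟧ d x
    Den⇒⟦⟧ (app {Γ = Γ} {Δ = Δ} {M} {N} d e) (app refl _ x xs)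
      with rename-Den⁻ (rightEmb Δ Γ) M x | rename-Star⁻ (leftEmb Δ Γ) N xs
    ... | s , refl , y | t , refl , ys with Den-type (⊢⇒⊩ d) y
    ...   | refl = s , t , _ , sym (push-++ t s) , Den⇒⟦⟧ d y , Star⇒⟦⟧ e ys
    Den⇒⟦⟧ (weak {M = M} d) x with rename-Den⁻ weakEmb M x
    ... | s , refl , y = s , push-weak s , Den⇒⟦⟧ d y
    Den⇒⟦⟧ (exchange {Γ = Γ} {M} π d) x with rename-Den⁻ (permuteEmb π Γ) M x
    ... | s , refl , y = s , push-permute π s , Den⇒⟦⟧ d y
    Den⇒⟦⟧ numeral (num _) = refl
    Den⇒⟦⟧ skip _ = tt
    Den⇒⟦⟧ (arith d e) (arith r c x y) = _ , _ , _ , _ , r , c , Den⇒⟦⟧ d x , Den⇒⟦⟧ e y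
    Den⇒⟦⟧ (seq β d e) (seq _ r x y) = _ , _ , r , Den⇒⟦⟧ d x , Den⇒⟦⟧ e y
    Den⇒⟦⟧ (assign d e) (assign r x y) = _ , _ , _ , r , Den⇒⟦⟧ e x , Den⇒⟦⟧ d y
    Den⇒⟦⟧ (deref d) (deref x) = Den⇒⟦⟧ d x
    Den⇒⟦⟧ (while d e) (stop a≢0 x) =
      0 , ε , _ , _ , sym (∙-identityˡ _) , [] , a≢0 , Den⇒⟦⟧ d x
    Den⇒⟦⟧ (while d e) (loop {s = s} {t} refl x y z) with Den⇒⟦⟧ (while d e) z
    ... | j , u , s′ , a , refl , xs , a≢0 , y′ =
      suc j , (s ∙ t) ∙ u , s′ , a ,
      sym (trans (∙-assoc (s ∙ t) u s′) (∙-assoc s t (u ∙ s′))) ,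
      (s , t , refl , Den⇒⟦⟧ d x , Den⇒⟦⟧ e y) ∷ xs , a≢0 , y′
    Den⇒⟦⟧ (ifzero β d e f) (ifzero₁ _ r x y) = inj₁ (_ , _ , r , Den⇒⟦⟧ d x , Den⇒⟦⟧ e y)
    Den⇒⟦⟧ (ifzero β d e f) (ifzero₂ _ r a≢0 x y) =
      inj₂ (_ , _ , _ , r , a≢0 , Den⇒⟦⟧ d x , Den⇒⟦⟧ f y)
    Den⇒⟦⟧ (new γ d) (new _ c x) = _ , Den⇒⟦⟧ d x , c

    Star⇒⟦⟧ : {Γ : Cxt n} {M : Tm n} (d : Γ ⊢ M ∶ A) → ∀ {s as} →
              Star (Den Γ M A) s as → Star ⟦ d ⟧ s as
    Star⇒⟦⟧ d []       = []
    Star⇒⟦⟧ d (x ∷ xs) = Den⇒⟦⟧ d x ∷ Star⇒⟦⟧ d xs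

  -- Substitution

  mutual

    Den-support : ∀ {M s a} → Den Γ M A s a → ∀ x {B} (p : lookup Γ x ≡ B) → ¬ Occ x M → get s x p ≡ []
    Den-support {Γ = Γ} (num refl)  x p ∉ = get-ε Γ x p
    Den-support {Γ = Γ} (skip refl) x p ∉ = get-ε Γ x p
    Den-support {Γ = Γ} (ident q refl) x p ∉ = get-single-≢ Γ q p _ (λ e → ∉ (sym e))
    Den-support (arith {s = s} {t} refl _ d e) x p ∉ =
      get-∙-[] s t x p (Den-support d x p (∉ ∘ inj₁)) (Den-support e x p (∉ ∘ inj₂))
    Den-support (seq {s = s} {t} _ refl d e) x p ∉ =
      get-∙-[] s t x p (Den-support d x p (∉ ∘ inj₁)) (Den-support e x p (∉ ∘ inj₂))
    Den-support (assign {s = s} {t} refl d e) x p ∉ =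
      get-∙-[] s t x p (Den-support d x p (∉ ∘ inj₂)) (Den-support e x p (∉ ∘ inj₁))
    Den-support (deref d) x p ∉ = Den-support d x p ∉
    Den-support (stop _ d) x p ∉ = Den-support d x p (∉ ∘ inj₁)
    Den-support (loop {s = s} {t} {u} refl d e f) x p ∉ =
      get-∙-[] s (t ∙ u) x p (Den-support d x p (∉ ∘ inj₁))
        (get-∙-[] t u x p (Den-support e x p (∉ ∘ inj₂)) (Den-support f x p ∉))
    Den-support (ifzero₁ {s = s} {t} _ refl d e) x p ∉ =
      get-∙-[] s t x p (Den-support d x p (∉ ∘ inj₁)) (Den-support e x p (∉ ∘ inj₂ ∘ inj₁))
    Den-support (ifzero₂ {s = s} {t} _ refl _ d e) x p ∉ =
      get-∙-[] s t x p (Den-support d x p (∉ ∘ inj₁)) (Den-support e x p (∉ ∘ inj₂ ∘ inj₂))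
    Den-support (lam d) x p ∉ = Den-support d (suc x) p ∉
    Den-support (app {s = s} {t} refl _ d ds) x p ∉ =
      get-∙-[] s t x p (Den-support d x p (∉ ∘ inj₁)) (Star-support ds x p (∉ ∘ inj₂))
    Den-support (new _ _ d) x p ∉ = Den-support d (suc x) p ∉

    Star-support : ∀ {M s as} → Star (Den Γ M A) s as → ∀ x {B} (p : lookup Γ x ≡ B) → ¬ Occ x M →
        get s x p ≡ []
    Star-support {Γ = Γ} [] x p ∉ = get-ε Γ x p
    Star-support (_∷_ {t = s} {u = t} d ds) x p ∉ =
        get-∙-[] s t x p (Den-support d x p ∉) (Star-support ds x p ∉)

    get-∙-[] : (s t : Traces Γ) → ∀ x (p : lookup Γ x ≡ A) → get s x p ≡ [] → get t x p ≡ [] →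
        get (s ∙ t) x p ≡ []
    get-∙-[] s t x p e e′ = trans (get-∙ s t x p) (cong₂ List._++_ e e′)

  disjoint⇒# : ∀ {M N s a t as} → (∀ x → Occ x M → ¬ Occ x N) →
               Den Γ M A s a → Star (Den Γ N B) t as → s # t
  disjoint⇒# {s = s} {t = t} dis d ds x p with get s x p in eq
  ... | [] = inj₁ refl
  -- A nonempty component excludes `x` from `N`: if it occurred there, it would not occur in `M`,
  -- and the component would be empty.
  ... | _ ∷ _ = inj₂ (Star-support ds x p λ q →
          case trans (sym eq) (Den-support d x p (λ r → dis x r q)) of λ ())

  Occ? : ∀ x (M : Tm n) → Dec (Occ x M)
  Occ? x (num a)         = no λ ()
  Occ? x (M ⟨ o ⟩ N)     = Occ? x M ⊎-dec Occ? x N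
  Occ? x skip            = no λ ()
  Occ? x (M ⨾ N)         = Occ? x M ⊎-dec Occ? x N
  Occ? x (M := N)        = Occ? x M ⊎-dec Occ? x N
  Occ? x (! M)           = Occ? x M
  Occ? x (while M N)     = Occ? x M ⊎-dec Occ? x N
  Occ? x (ifzero M N N′) = Occ? x M ⊎-dec (Occ? x N ⊎-dec Occ? x N′)
  Occ? x (ident i)       = x ≟ i
  Occ? x (ƛ A M)         = Occ? (suc x) M
  Occ? x (M · N)         = Occ? x M ⊎-dec Occ? x N
  Occ? x (new M)         = Occ? (suc x) M

  -- For a substitution θ whose values have disjoint identifiers, o assigns to
  -- an identifier y the variable x such that y may occur in θ x.
  Owner : (Fin n → Fin m) → (Fin m → Tm n) → Tm m → Set
  Owner o θ M = ∀ x → Occ x M → ∀ y → Occ y (θ x) → o y ≡ x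

  Owner-lift : {o : Fin n → Fin m} {θ : Fin m → Tm n} {M : Tm (suc m)} →
               (∀ x → Occ (suc x) M → ∀ y → Occ y (θ x) → o y ≡ x) →
               Owner (liftRen o) (liftSub θ) M
  Owner-lift own zero    p y refl = refl
  Owner-lift {θ = θ} own (suc x) p y q with Occ-rename⁻ suc (θ x) q
  ... | z , refl , q′ = cong suc (own x p z q′)

  Occ-subst⁻ : (θ : Fin m → Tm n) → ∀ M {y} → Occ y (subst θ M) → ∃[ x ] Occ x M × Occ y (θ x)
  Occ-subst⁻ θ (M ⟨ o ⟩ N)     (inj₁ p) = case Occ-subst⁻ θ M p of λ (x , q , r) → x , inj₁ q , r
  Occ-subst⁻ θ (M ⟨ o ⟩ N)     (inj₂ p) = case Occ-subst⁻ θ N p of λ (x , q , r) → x , inj₂ q , r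
  Occ-subst⁻ θ (M ⨾ N)         (inj₁ p) = case Occ-subst⁻ θ M p of λ (x , q , r) → x , inj₁ q , r
  Occ-subst⁻ θ (M ⨾ N)         (inj₂ p) = case Occ-subst⁻ θ N p of λ (x , q , r) → x , inj₂ q , r
  Occ-subst⁻ θ (M := N)        (inj₁ p) = case Occ-subst⁻ θ M p of λ (x , q , r) → x , inj₁ q , r
  Occ-subst⁻ θ (M := N)        (inj₂ p) = case Occ-subst⁻ θ N p of λ (x , q , r) → x , inj₂ q , r
  Occ-subst⁻ θ (! M)           p        = Occ-subst⁻ θ M p
  Occ-subst⁻ θ (while M N)     (inj₁ p) = case Occ-subst⁻ θ M p of λ (x , q , r) → x , inj₁ q , r
  Occ-subst⁻ θ (while M N)     (inj₂ p) = case Occ-subst⁻ θ N p of λ (x , q , r) → x , inj₂ q , r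
  Occ-subst⁻ θ (ifzero M N N′) (inj₁ p) = case Occ-subst⁻ θ M p of λ (x , q , r) → x , inj₁ q , r
  Occ-subst⁻ θ (ifzero M N N′) (inj₂ (inj₁ p)) =
    case Occ-subst⁻ θ N p of λ (x , q , r) → x , inj₂ (inj₁ q) , r
  Occ-subst⁻ θ (ifzero M N N′) (inj₂ (inj₂ p)) =
    case Occ-subst⁻ θ N′ p of λ (x , q , r) → x , inj₂ (inj₂ q) , r
  Occ-subst⁻ θ (ident i)       p        = i , refl , p
  Occ-subst⁻ θ (ƛ A M)         p        = Occ-lift⁻ θ M p
    where
    Occ-lift⁻ : (θ : Fin m → Tm n) → ∀ M {y} → Occ (suc y) (subst (liftSub θ) M) →
        ∃[ x ] Occ (suc x) M × Occ y (θ x)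
    Occ-lift⁻ θ M p with Occ-subst⁻ (liftSub θ) M p
    ... | suc x , q , r with Occ-rename⁻ suc (θ x) r
    ...   | _ , refl , r′ = x , q , r′
  Occ-subst⁻ θ (M · N)         (inj₁ p) = case Occ-subst⁻ θ M p of λ (x , q , r) → x , inj₁ q , r
  Occ-subst⁻ θ (M · N)         (inj₂ p) = case Occ-subst⁻ θ N p of λ (x , q , r) → x , inj₂ q , r
  Occ-subst⁻ θ (new M)         p with Occ-subst⁻ (liftSub θ) M p
  ... | suc x , q , r with Occ-rename⁻ suc (θ x) r
  ...   | _ , refl , r′ = x , q , r′

  liftSub-⊩ : {Γ : Cxt m} {Θ : Cxt n} {θ : Fin m → Tm n} → (∀ x → Θ ⊩ θ x ∶ lookup Γ x) →
              ∀ x → A ∷ Θ ⊩ liftSub θ x ∶ lookup (A ∷ Γ) x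
  liftSub-⊩ τ zero    = ident refl
  liftSub-⊩ τ (suc x) = rename-⊩ weakEmb (τ x)

  subst-⊩ : {Γ : Cxt m} {Θ : Cxt n} (o : Fin n → Fin m) (θ : Fin m → Tm n) →
      (∀ x → Θ ⊩ θ x ∶ lookup Γ x) →
            ∀ {M} → Owner o θ M → Γ ⊩ M ∶ A → Θ ⊩ subst θ M ∶ A
  subst-⊩ o θ τ own num = num
  subst-⊩ o θ τ own skip = skip
  subst-⊩ o θ τ own (ident refl) = τ _
  subst-⊩ o θ τ own (arith d e) =
    arith (subst-⊩ o θ τ (λ x → own x ∘ inj₁) d) (subst-⊩ o θ τ (λ x → own x ∘ inj₂) e)
  subst-⊩ o θ τ own (seq β d e) =
    seq β (subst-⊩ o θ τ (λ x → own x ∘ inj₁) d) (subst-⊩ o θ τ (λ x → own x ∘ inj₂) e)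
  subst-⊩ o θ τ own (assign d e) =
    assign (subst-⊩ o θ τ (λ x → own x ∘ inj₁) d) (subst-⊩ o θ τ (λ x → own x ∘ inj₂) e)
  subst-⊩ o θ τ own (deref d) = deref (subst-⊩ o θ τ own d)
  subst-⊩ o θ τ own (while d e) =
    while (subst-⊩ o θ τ (λ x → own x ∘ inj₁) d) (subst-⊩ o θ τ (λ x → own x ∘ inj₂) e)
  subst-⊩ o θ τ own (ifzero β d e f) =
    ifzero β (subst-⊩ o θ τ (λ x → own x ∘ inj₁) d) (subst-⊩ o θ τ (λ x → own x ∘ inj₂ ∘ inj₁) e)
      (subst-⊩ o θ τ (λ x → own x ∘ inj₂ ∘ inj₂) f)
  subst-⊩ o θ τ own (lam {M = M} d) =
    lam (subst-⊩ (liftRen o) (liftSub θ) (liftSub-⊩ τ) (Owner-lift {M = M} (λ x → own x)) d)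
  subst-⊩ o θ τ own (app {M = M} {N} dis d e) =
    app dis′ (subst-⊩ o θ τ (λ x → own x ∘ inj₁) d) (subst-⊩ o θ τ (λ x → own x ∘ inj₂) e)
    where
    dis′ : ∀ y → Occ y (subst θ M) → ¬ Occ y (subst θ N)
    dis′ y p q with Occ-subst⁻ θ M p | Occ-subst⁻ θ N q
    ... | x , p₁ , p₂ | z , q₁ , q₂ with trans (sym (own x (inj₁ p₁) y p₂)) (own z (inj₂ q₁) y q₂)
    ...   | refl = dis x p₁ q₁
  subst-⊩ o θ τ own (new {M = M} γ d) =
    new γ (subst-⊩ (liftRen o) (liftSub θ) (liftSub-⊩ τ) (Owner-lift {M = M} (λ x → own x)) d)

  -- The share of a trace owned by one variable.

  module _ (o : Fin n → Fin m) where

    restrictAt : (Θ : Cxt n) → Traces Θ → (x : Fin m) → ∀ y {A} → lookup Θ y ≡ A → List (α A)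
    restrictAt Θ r x y p with o y ≟ x
    ... | yes _ = get r y p
    ... | no  _ = []

    restrict : {Θ : Cxt n} → Traces Θ → Fin m → Traces Θ
    restrict {Θ} r x = tab Θ (restrictAt Θ r x)

    get-restrict-≡ : {Θ : Cxt n} (r : Traces Θ) → ∀ {x y A} (p : lookup Θ y ≡ A) → o y ≡ x →
                     get (restrict r x) y p ≡ get r y p
    get-restrict-≡ {Θ} r {x} {y} p e rewrite get-tab Θ (restrictAt Θ r x) y p with o y ≟ x
    ... | yes _ = refl
    ... | no ¬e = contradiction e ¬e

    get-restrict-≢ : {Θ : Cxt n} (r : Traces Θ) → ∀ {x y A} (p : lookup Θ y ≡ A) → o y ≢ x →
                     get (restrict r x) y p ≡ []
    get-restrict-≢ {Θ} r {x} {y} p ¬e rewrite get-tab Θ (restrictAt Θ r x) y p with o y ≟ x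
    ... | yes e = contradiction e ¬e
    ... | no  _ = refl

    restrict-∙ : {Θ : Cxt n} (r s : Traces Θ) → ∀ x → restrict (r ∙ s) x ≡ restrict r x ∙ restrict s x
    restrict-∙ {Θ} r s x =
        traces-ext λ y p → trans (lemma y p (o y ≟ x)) (sym (get-∙ (restrict r x) (restrict s x) y p))
      where
      lemma : ∀ y {A} (p : lookup Θ y ≡ A) → Dec (o y ≡ x) →
              get (restrict (r ∙ s) x) y p ≡ get (restrict r x) y p List.++ get (restrict s x) y p
      lemma y p (yes e) = trans (get-restrict-≡ (r ∙ s) p e) (trans (get-∙ r s y p)
        (sym (cong₂ List._++_ (get-restrict-≡ r p e) (get-restrict-≡ s p e))))
      lemma y p (no ¬e) = trans (get-restrict-≢ (r ∙ s) p ¬e)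
        (sym (cong₂ List._++_ (get-restrict-≢ r p ¬e) (get-restrict-≢ s p ¬e)))

    restrict-all : {Θ : Cxt n} (r : Traces Θ) → ∀ x →
                   (∀ y {A} (p : lookup Θ y ≡ A) → o y ≢ x → get r y p ≡ []) → restrict r x ≡ r
    restrict-all {Θ} r x supp = traces-ext λ y p → lemma y p (o y ≟ x)
      where
      lemma : ∀ y {A} (p : lookup Θ y ≡ A) → Dec (o y ≡ x) → get (restrict r x) y p ≡ get r y p
      lemma y p (yes e) = get-restrict-≡ r p e
      lemma y p (no ¬e) = trans (get-restrict-≢ r p ¬e) (sym (supp y p ¬e))

    restrict-none : {Θ : Cxt n} (r : Traces Θ) → ∀ x →
                    (∀ y {A} (p : lookup Θ y ≡ A) → o y ≡ x → get r y p ≡ []) → restrict r x ≡ ε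
    restrict-none {Θ} r x supp = traces-ext λ y p → trans (lemma y p (o y ≟ x)) (sym (get-ε Θ y p))
      where
      lemma : ∀ y {A} (p : lookup Θ y ≡ A) → Dec (o y ≡ x) → get (restrict r x) y p ≡ []
      lemma y p (yes e) = trans (get-restrict-≡ r p e) (supp y p e)
      lemma y p (no ¬e) = get-restrict-≢ r p ¬e

    restrict-ε : {Θ : Cxt n} → ∀ x → restrict {Θ} ε x ≡ ε
    restrict-ε {Θ} x = restrict-none ε x (λ y p _ → get-ε Θ y p)

  restrict-zero : (o : Fin n → Fin m) {Θ : Cxt n} (t : List (α A)) (r : Traces Θ) →
                  get {Γ = A ∷ Θ} (restrict (liftRen o) (t ∷ r) zero) zero refl ≡ t
  restrict-zero o t r = get-restrict-≡ (liftRen o) (t ∷ r) {zero} {zero} refl refl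

  restrict-suc : (o : Fin n → Fin m) {Θ : Cxt n} (t : List (α A)) (r : Traces Θ) → ∀ x →
                 restrict (liftRen o) (t ∷ r) (suc x) ≡ [] ∷ restrict o r x
  restrict-suc {A = A} o {Θ} t r x = traces-ext lemma
    where
    lemma : ∀ y {B} (p : lookup (A ∷ Θ) y ≡ B) →
            get (restrict (liftRen o) (t ∷ r) (suc x)) y p ≡ get ([] ∷ restrict o r x) y p
    lemma zero refl = get-restrict-≢ (liftRen o) (t ∷ r) {suc x} {zero} refl (λ ())
    lemma (suc y) p with o y ≟ x
    ... | yes e = trans (get-restrict-≡ (liftRen o) (t ∷ r) {suc x} {suc y} p (cong suc e))
                        (sym (get-restrict-≡ o r p e))
    ... | no ¬e = trans (get-restrict-≢ (liftRen o) (t ∷ r) {suc x} {suc y} p (¬e ∘ suc-injective))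
                        (sym (get-restrict-≢ o r p ¬e))

  Star-ident : {Γ : Cxt n} → ∀ {i r as} (p : lookup Γ i ≡ A) → Star (Den Γ (ident i) A) r as →
      get r i p ≡ as
  Star-ident {Γ = Γ} {i = i} p [] = get-ε Γ i p
  Star-ident {Γ = Γ} {i = i} p (_∷_ {u = u} (ident q refl) ds) =
    trans (get-∙ (single-trace i q _) u i p) (cong₂ List._++_ (get-single Γ i q p _) (Star-ident p ds))

  record Decomposition {Γ : Cxt m} {Θ : Cxt n} (o : Fin n → Fin m) (θ : Fin m → Tm n)
                       (r : Traces Θ) (s : Traces Γ) : Set where
    constructor decomposition
    field part : ∀ x {A} (p : lookup Γ x ≡ A) → Star (Den Θ (θ x) A) (restrict o r x) (get s x p)

  open Decomposition

  Decomposition-ε : {Γ : Cxt m} {Θ : Cxt n} (o : Fin n → Fin m) (θ : Fin m → Tm n) →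
                    Decomposition {Γ = Γ} {Θ} o θ ε ε
  Decomposition-ε {Γ = Γ} {Θ} o θ .part x p rewrite get-ε Γ x p =
      Star-cong (sym (restrict-ε o {Θ} x)) []

  Decomposition-∙ : {Γ : Cxt m} {Θ : Cxt n} (o : Fin n → Fin m)
      (θ : Fin m → Tm n) {r r′ : Traces Θ} {s s′ : Traces Γ} →
                    Decomposition o θ r s → Decomposition o θ r′ s′ →
                        Decomposition o θ (r ∙ r′) (s ∙ s′)
  Decomposition-∙ o θ {r} {r′} {s} {s′} D D′ .part x p rewrite get-∙ s s′ x p =
    Star-cong (sym (restrict-∙ o r r′ x)) (Star-++ (part D x p) (part D′ x p))

  Decomposition-lift⁻ : {Γ : Cxt m} {Θ : Cxt n} {o : Fin n → Fin m} {θ : Fin m → Tm n}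
                        {t t′ : List (α A)} {r : Traces Θ} {s : Traces Γ} →
                        Decomposition {Γ = A ∷ Γ} {A ∷ Θ} (liftRen o) (liftSub θ) (t ∷ r) (t′ ∷ s) →
                        t ≡ t′ × Decomposition o θ r s
  Decomposition-lift⁻ {o = o} {θ} {t} {r = r} D =
    trans (sym (restrict-zero o t r)) (Star-ident refl (part D zero refl)) ,
        decomposition (λ x p → lemma x (part D (suc x) p))
    where
    lemma : ∀ x {A as} → Star (Den _ (weaken (θ x)) A) (restrict (liftRen o) (t ∷ r) (suc x)) as →
            Star (Den _ (θ x) A) (restrict o r x) as
    lemma x ds with rename-Star⁻ weakEmb (θ x) (Star-cong (restrict-suc o t r x) ds)
    ... | u , e , ds′ with trans e (push-weak u)
    ...   | refl = ds′

  mutual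

    -- Soundness follows evaluation backwards, so the traces of an instance have to be led back to
    -- `M`. Each use of `θ x` counts as one action on `x`. As the values of `θ` own different
    -- identifiers, `r` falls into one share per variable, and shares are concatenated wherever a
    -- clause of `Den` concatenates.
    subst-Den⁻ : {Γ : Cxt m} {Θ : Cxt n} (o : Fin n → Fin m) (θ : Fin m → Tm n) →
                 (∀ x → Θ ⊩ θ x ∶ lookup Γ x) →
                 ∀ {M r b} → Owner o θ M → Γ ⊩ M ∶ A → Den Θ (subst θ M) B r b →
                 ∃[ s ] Den Γ M B s b × Decomposition o θ r s
    subst-Den⁻ o θ τ own num (num refl) = ε , num refl , Decomposition-ε o θ
    subst-Den⁻ o θ τ own skip (skip refl) = ε , skip refl , Decomposition-ε o θ
    subst-Den⁻ {Γ = Γ} {Θ} o θ τ {r = r} {b} own (ident {i = i} refl) d with Den-type (τ i) d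
    ... | refl = single-trace i refl b , ident refl refl , D
      where
      D : Decomposition o θ r (single-trace i refl b)
      D .part x p with i ≟ x
      -- All of `r` comes from `θ i`, whose identifiers are owned by `i`, so the share of `i` is `r`
      -- itself.
      D .part x refl | yes refl rewrite get-single Γ i refl refl b =
        Star-cong (trans (∙-identityʳ r) (sym (restrict-all o r i λ y q ¬e →
          Den-support d y q (λ occ → ¬e (own i refl y occ))))) (d ∷ [])
      D .part x p | no i≢x rewrite get-single-≢ Γ refl p b i≢x =
        Star-cong (sym (restrict-none o r x λ y q e →
          Den-support d y q (λ occ → i≢x (trans (sym (own i refl y occ)) e)))) []
    subst-Den⁻ o θ τ own (arith d e) (arith refl c x y)
      with subst-Den⁻ o θ τ (λ z → own z ∘ inj₁) d x | subst-Den⁻ o θ τ (λ z → own z ∘ inj₂) e y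
    ... | s , f , D | t , g , E = s ∙ t , arith refl c f g , Decomposition-∙ o θ D E
    subst-Den⁻ o θ τ own (seq _ d e) (seq β refl x y)
      with subst-Den⁻ o θ τ (λ z → own z ∘ inj₁) d x | subst-Den⁻ o θ τ (λ z → own z ∘ inj₂) e y
    ... | s , f , D | t , g , E = s ∙ t , seq β refl f g , Decomposition-∙ o θ D E
    subst-Den⁻ o θ τ own (assign d e) (assign refl x y)
      with subst-Den⁻ o θ τ (λ z → own z ∘ inj₂) e x | subst-Den⁻ o θ τ (λ z → own z ∘ inj₁) d y
    ... | s , f , D | t , g , E = s ∙ t , assign refl f g , Decomposition-∙ o θ D E
    subst-Den⁻ o θ τ own (deref d) (deref x) with subst-Den⁻ o θ τ own d x
    ... | s , f , D = s , deref f , D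
    subst-Den⁻ o θ τ own (while d e) (stop a≢0 x) with subst-Den⁻ o θ τ (λ z → own z ∘ inj₁) d x
    ... | s , f , D = s , stop a≢0 f , D
    subst-Den⁻ o θ τ own (while d e) (loop refl x y z)
      with subst-Den⁻ o θ τ (λ z → own z ∘ inj₁) d x | subst-Den⁻ o θ τ (λ z → own z ∘ inj₂) e y
         | subst-Den⁻ o θ τ own (while d e) z
    ... | s , f , D | t , g , E | u , h , F =
      s ∙ (t ∙ u) , loop refl f g h , Decomposition-∙ o θ D (Decomposition-∙ o θ E F)
    subst-Den⁻ o θ τ own (ifzero _ d e _) (ifzero₁ β refl x y)
      with subst-Den⁻ o θ τ (λ z → own z ∘ inj₁) d x | subst-Den⁻ o θ τ (λ z → own z ∘ inj₂ ∘ inj₁) e y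
    ... | s , f , D | t , g , E = s ∙ t , ifzero₁ β refl f g , Decomposition-∙ o θ D E
    subst-Den⁻ o θ τ own (ifzero _ d _ e) (ifzero₂ β refl a≢0 x y)
      with subst-Den⁻ o θ τ (λ z → own z ∘ inj₁) d x | subst-Den⁻ o θ τ (λ z → own z ∘ inj₂ ∘ inj₂) e y
    ... | s , f , D | t , g , E = s ∙ t , ifzero₂ β refl a≢0 f g , Decomposition-∙ o θ D E
    subst-Den⁻ o θ τ own (lam {M = M} d) (lam x)
      with subst-Den⁻ (liftRen o) (liftSub θ) (liftSub-⊩ τ) (Owner-lift {M = M} (λ x → own x)) d x
    ... | t ∷ s , f , D with Decomposition-lift⁻ D
    ...   | refl , D′ = s , lam f , D′
    subst-Den⁻ o θ τ own (app dis d e) (app refl _ x xs)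
      with subst-Den⁻ o θ τ (λ z → own z ∘ inj₁) d x | subst-Star⁻ o θ τ (λ z → own z ∘ inj₂) e xs
    -- Disjointness is needed for the traces before substitution, and there it comes from the typing
    -- of the application.
    ... | s , f , D | t , fs , E = s ∙ t , app refl (disjoint⇒# dis f fs) f fs , Decomposition-∙ o θ D E
    subst-Den⁻ o θ τ own (new {M = M} _ d) (new γ c x)
      with subst-Den⁻ (liftRen o) (liftSub θ) (liftSub-⊩ τ) (Owner-lift {M = M} (λ x → own x)) d x
    ... | t ∷ s , f , D with Decomposition-lift⁻ D
    ...   | refl , D′ = s , new γ c f , D′

    subst-Star⁻ : {Γ : Cxt m} {Θ : Cxt n} (o : Fin n → Fin m) (θ : Fin m → Tm n) →
                  (∀ x → Θ ⊩ θ x ∶ lookup Γ x) →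
                  ∀ {M r bs} → Owner o θ M → Γ ⊩ M ∶ A → Star (Den Θ (subst θ M) B) r bs →
                  ∃[ s ] Star (Den Γ M B) s bs × Decomposition o θ r s
    subst-Star⁻ o θ τ own d [] = ε , [] , Decomposition-ε o θ
    subst-Star⁻ o θ τ own d (x ∷ xs) with subst-Den⁻ o θ τ own d x | subst-Star⁻ o θ τ own d xs
    ... | s , f , D | t , fs , E = s ∙ t , f ∷ fs , Decomposition-∙ o θ D E

  module _ {Γ : Cxt n} {M : Tm (suc n)} {N : Tm n} (dis : ∀ x → Occ (suc x) M → ¬ Occ x N) where

    private

      owner : Fin n → Fin (suc n)
      -- Identifiers of `N` belong to the variable being replaced, all others to themselves; by
      -- `dis` no other identifier of `M` is among those of `N`.
      owner y with Occ? y N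
      ... | yes _ = zero
      ... | no  _ = suc y

      own : Owner owner (single N) M
      own zero p y q with Occ? y N
      ... | yes _ = refl
      ... | no ¬q = contradiction q ¬q
      own (suc x) p y refl with Occ? y N
      ... | yes q = contradiction q (dis y p)
      ... | no _  = refl

      single-⊩ : Γ ⊩ N ∶ A → ∀ x → Γ ⊩ single N x ∶ lookup (A ∷ Γ) x
      single-⊩ e zero    = e
      single-⊩ e (suc x) = ident refl

    β-⊩ : A ∷ Γ ⊩ M ∶ B → Γ ⊩ N ∶ A → Γ ⊩ M [ N ] ∶ B
    β-⊩ d e = subst-⊩ owner (single N) (single-⊩ e) own d

    β-Den⁻ : A ∷ Γ ⊩ M ∶ B → Γ ⊩ N ∶ A → ∀ {r b} → Den Γ (M [ N ]) B r b →
             ∃[ s ] ∃[ t ] ∃[ as ] r ≡ s ∙ t × Den (A ∷ Γ) M B (as ∷ s) b × Star (Den Γ N A) t as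
    β-Den⁻ d e {r} x with subst-Den⁻ owner (single N) (single-⊩ e) own d x
    ... | as ∷ s , y , D = s , restrict owner r zero , as , traces-ext lemma , y , part D zero refl
      where
      -- At identifiers of `N` the trace `s` is empty, and elsewhere the share of `N` is, so one of
      -- the two factors is always all of `r`.
      lemma : ∀ x {A} (p : lookup Γ x ≡ A) → get r x p ≡ get (s ∙ restrict owner r zero) x p
      lemma x p rewrite get-∙ s (restrict owner r zero) x p
          with Star-ident p (part D (suc x) p) | Occ? x N in eq
      ... | e | yes q = trans (sym (get-restrict-≡ owner r p o≡))
                  (cong (List._++ _) (trans
                      (sym (get-restrict-≢ owner r p (λ e → case trans (sym o≡) e of λ ()))) e))
        where o≡ : owner x ≡ zero
              o≡ rewrite eq = refl
      ... | e | no ¬q = trans (trans (sym (get-restrict-≡ owner r p o≡)) e)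
                  (trans (sym (++-identityʳ _))
                    (cong (get s x p List.++_)
                        (sym (get-restrict-≢ owner r p (λ e → case trans (sym o≡) e of λ ())))))
        where o≡ : owner x ≡ suc x
              o≡ rewrite eq = refl

  -- Soundness of evaluation

  vars : ∀ n → Cxt n
  vars n = replicate n var

  -- `Cell` with the final content made explicit, so that traces of a cell can be composed and cut.
  data Acts : ℕ → List VarAct → ℕ → Set where
    []    : ∀ {v} → Acts v [] v
    read  : ∀ {v w s} → Acts v s w → Acts v (read v ∷ s) w
    write : ∀ {u v w s} → Acts u s w → Acts v (write u ∷ s) w

  Acts⇒Cell : ∀ {v s w} → Acts v s w → Cell v s
  Acts⇒Cell []        = []
  Acts⇒Cell (read a)  = read (Acts⇒Cell a)
  Acts⇒Cell (write a) = write (Acts⇒Cell a)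

  Cell⇒Acts : ∀ {v s} → Cell v s → ∃[ w ] Acts v s w
  Cell⇒Acts []        = _ , []
  Cell⇒Acts (read c)  = _ , read (proj₂ (Cell⇒Acts c))
  Cell⇒Acts (write c) = _ , write (proj₂ (Cell⇒Acts c))

  Acts-++ : ∀ {u s v t w} → Acts u s v → Acts v t w → Acts u (s List.++ t) w
  Acts-++ []        b = b
  Acts-++ (read a)  b = read (Acts-++ a b)
  Acts-++ (write a) b = write (Acts-++ a b)

  Acts-split : ∀ {u} s {t w} → Acts u (s List.++ t) w → ∃[ v ] Acts u s v × Acts v t w
  Acts-split []            a         = _ , [] , a
  Acts-split (read _ ∷ s)  (read a)  = case Acts-split s a of λ (_ , b , c) → _ , read b , c
  Acts-split (write _ ∷ s) (write a) = case Acts-split s a of λ (_ , b , c) → _ , write b , c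

  data Steps : Store n → Traces (vars n) → Store n → Set where
    []  : Steps [] [] []
    _∷_ : ∀ {n v s w} {σ σ′ : Store n} {u} → Acts v s w → Steps σ u σ′ → Steps (v ∷ σ) (s ∷ u) (w ∷ σ′)

  Steps-ε : (σ : Store n) → Steps σ ε σ
  Steps-ε []      = []
  Steps-ε (v ∷ σ) = [] ∷ Steps-ε σ

  Steps-∙ : {σ σ′ σ″ : Store n} {u u′ : Traces (vars n)} → Steps σ u σ′ → Steps σ′ u′ σ″ →
      Steps σ (u ∙ u′) σ″
  Steps-∙ []       []       = []
  Steps-∙ (a ∷ as) (b ∷ bs) = Acts-++ a b ∷ Steps-∙ as bs

  Steps-split : {σ σ″ : Store n} (u : Traces (vars n)) {u′ : Traces (vars n)} →
                Steps σ (u ∙ u′) σ″ → ∃[ σ′ ] Steps σ u σ′ × Steps σ′ u′ σ″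
  Steps-split {n = zero}  []      {[]}    []       = [] , [] , []
  Steps-split {n = suc n} (s ∷ u) {_ ∷ _} (a ∷ as) with Acts-split s a | Steps-split u as
  ... | _ , b , c | _ , bs , cs = _ , b ∷ bs , c ∷ cs

  vars-lookup : (x : Fin n) → lookup (vars n) x ≡ var
  vars-lookup x = lookup-replicate x var

  Steps-write : (σ : Store n) (x : Fin n) → ∀ a (p : lookup (vars n) x ≡ var) →
                Steps σ (single-trace x p (write a)) (σ [ x ]≔ a)
  Steps-write (v ∷ σ) zero    a refl = write [] ∷ Steps-ε σ
  Steps-write (v ∷ σ) (suc x) a p    = [] ∷ Steps-write σ x a p

  Steps-read : (σ : Store n) (x : Fin n) (p : lookup (vars n) x ≡ var) →
               Steps σ (single-trace x p (read (lookup σ x))) σ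
  Steps-read (v ∷ σ) zero    refl = read [] ∷ Steps-ε σ
  Steps-read (v ∷ σ) (suc x) p    = [] ∷ Steps-read σ x p

  ⇓-value : ∀ {σ σ′ : Store n} {M V} → σ ∣ M ⇓ σ′ ∣ V → Value V
  ⇓-value (value v)         = v
  ⇓-value (app _ d)         = ⇓-value d
  ⇓-value (arith _ _)       = num _
  ⇓-value (assign _ _)      = skip
  ⇓-value (deref _)         = num _
  ⇓-value (seq _ d)         = ⇓-value d
  ⇓-value (stop _ _)        = skip
  ⇓-value (loop _ _ _)      = skip
  ⇓-value (ifzero₁ _ d)     = ⇓-value d
  ⇓-value (ifzero₂ _ _ d)   = ⇓-value d
  ⇓-value (new {V = V} d)   = unweaken V (⇓-value d)
    where
    unweaken : (V : Tm n) → Value (weaken V) → Value V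
    unweaken (num a)   _ = num a
    unweaken skip      _ = skip
    unweaken (ident i) _ = ident i
    unweaken (ƛ A M)   _ = ƛ A M

  data GroundValue {n} : Tm n → Ty → Set where
    num  : ∀ {a} → GroundValue (num a) nat
    skip : GroundValue skip comm

  groundValue : ∀ {V : Tm n} → Ground B → Value V → vars n ⊩ V ∶ B → GroundValue V B
  groundValue nat  (num a)   num       = num
  groundValue comm skip      skip      = skip
  groundValue nat  (ident i) (ident p) = case trans (sym p) (vars-lookup i) of λ ()
  groundValue comm (ident i) (ident p) = case trans (sym p) (vars-lookup i) of λ ()

  groundValue-unweaken : ∀ (V : Tm n) → GroundValue (weaken V) B → GroundValue V B
  groundValue-unweaken (num a) num  = num
  groundValue-unweaken skip    skip = skip

  -- The bound on identifiers belongs to the induction: once the function has evaluated to an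
  -- abstraction, it keeps the body disjoint from the argument, as the substitution lemma requires.
  preservation : {σ σ′ : Store n} → ∀ {M V} → vars n ⊩ M ∶ A → σ ∣ M ⇓ σ′ ∣ V →
                 vars n ⊩ V ∶ A × (∀ y → Occ y V → Occ y M)
  preservation d (value _) = d , λ _ p → p
  preservation (app dis d e) (app {M′ = M′} {N = N} x y) with preservation d x
  ... | lam d′ , f with preservation (β-⊩ (λ y p → dis y (f y p)) d′ e) y
  ...   | g , h = g , λ z p → occ z (Occ-subst⁻ (single N) M′ (h z p))
    where
    occ : ∀ z → ∃[ x ] Occ x M′ × Occ z (single N x) → _
    occ z (zero  , p , q)    = inj₂ q
    occ z (suc x , p , refl) = inj₁ (f x p)
  preservation (arith _ _) (arith _ _) = num , λ _ ()
  preservation (assign _ _) (assign _ _) = skip , λ _ ()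
  preservation (deref _) (deref _) = num , λ _ ()
  preservation (seq _ _ d) (seq _ y) = case preservation d y of λ (e , f) → e , λ z p → inj₂ (f z p)
  preservation (while _ _) (stop _ _) = skip , λ _ ()
  preservation (while _ _) (loop _ _ _) = skip , λ _ ()
  preservation (ifzero _ _ d _) (ifzero₁ _ y) =
    case preservation d y of λ (e , f) → e , λ z p → inj₂ (inj₁ (f z p))
  preservation (ifzero _ _ _ d) (ifzero₂ _ _ y) =
    case preservation d y of λ (e , f) → e , λ z p → inj₂ (inj₂ (f z p))
  preservation (new γ d) (new {V = V} x)
    -- Values of ground type are numerals or `skip`, hence typed without the local cell as well.
    with groundValue-unweaken V (groundValue γ (⇓-value x) (proj₁ (preservation d x)))
  ... | num  = num , λ _ ()
  ... | skip = skip , λ _ ()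

  -- A value may be an identifier or an abstraction, which acts only when it is used. The statement
  -- therefore carries a trace `s` of its later use, preceded by the actions `u` of the evaluation.
  sound : {σ σ′ : Store n} → ∀ {M V} → vars n ⊩ M ∶ A → σ ∣ M ⇓ σ′ ∣ V →
          ∀ {s a} → Den (vars n) V A s a → ∃[ u ] Steps σ u σ′ × Den (vars n) M A (u ∙ s) a
  sound {σ = σ} d (value _) x = ε , Steps-ε σ , Den-cong (sym (∙-identityˡ _)) x
  sound (app {M = M} dis d e) (app {M′ = M′} x y) {s} v with preservation d x
  ... | lam d′ , f with sound (β-⊩ (λ z p → dis z (f z p)) d′ e) y v
  ...   | u₂ , σ₂ , z with β-Den⁻ (λ z p → dis z (f z p)) d′ e z
  -- The trace `u₂ ∙ s` of the reduct splits into a part `s′` of the body and a part `t` of the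
  -- argument; `lam w` is then the later use of the evaluated function.
  ...     | s′ , t , as , eq , w , ws with sound d x (lam w)
  ...       | u₁ , σ₁ , w′ = u₁ ∙ u₂ , Steps-∙ σ₁ σ₂ ,
              app (trans (∙-assoc u₁ u₂ s) (trans (cong (u₁ ∙_) eq) (sym (∙-assoc u₁ s′ t))))
                (disjoint⇒# dis w′ ws) w′ ws
  sound (arith d e) (arith x y) (num refl)
    with sound d x (num refl) | sound e y (num refl)
  ... | u₁ , σ₁ , v | u₂ , σ₂ , w =
    u₁ ∙ u₂ , Steps-∙ σ₁ σ₂ ,
    arith (trans (∙-identityʳ _) (sym (cong₂ _∙_ (∙-identityʳ u₁) (∙-identityʳ u₂)))) refl v w
  sound (assign d e) (assign {a = a} {x = i} x y) (skip refl)
    with sound e x (num refl) | sound d y (ident (vars-lookup i) refl)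
  ... | u₁ , σ₁ , v | u₂ , σ₂ , w =
    -- `M` evaluates to the identifier `i`, and the write to it is the later use that follows `u₂`.
    u₁ ∙ (u₂ ∙ single-trace i (vars-lookup i) (write a)) ,
    Steps-∙ σ₁ (Steps-∙ σ₂ (Steps-write _ i a (vars-lookup i))) ,
    assign (trans (∙-identityʳ _) (cong (_∙ _) (sym (∙-identityʳ u₁)))) v w
  sound (deref d) (deref {σ′ = σ′} {x = i} x) (num refl)
    with sound d x (ident (vars-lookup i) refl)
  ... | u , σ₁ , v =
    u ∙ single-trace i (vars-lookup i) (read (lookup σ′ i)) ,
    Steps-∙ σ₁ (Steps-read σ′ i (vars-lookup i)) ,
    deref (Den-cong (sym (∙-identityʳ _)) v)
  sound (seq β d e) (seq x y) {s} v with sound e y v | sound d x (skip refl)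
  ... | u₂ , σ₂ , w | u₁ , σ₁ , z =
    u₁ ∙ u₂ , Steps-∙ σ₁ σ₂ ,
    seq β (trans (∙-assoc u₁ u₂ s) (cong (_∙ _) (sym (∙-identityʳ u₁)))) z w
  sound (while d e) (stop x a≢0) (skip refl) with sound d x (num refl)
  ... | u , σ₁ , v = u , σ₁ , stop a≢0 v
  sound (while d e) (loop x y z) (skip refl)
    with sound d x (num refl) | sound e y (skip refl) | sound (while d e) z (skip refl)
  ... | u₁ , σ₁ , v₁ | u₂ , σ₂ , v₂ | u₃ , σ₃ , v₃ =
    u₁ ∙ (u₂ ∙ u₃) , Steps-∙ σ₁ (Steps-∙ σ₂ σ₃) ,
    loop (trans (∙-identityʳ _)
      (sym (cong₂ _∙_ (∙-identityʳ u₁) (cong₂ _∙_ (∙-identityʳ u₂) (∙-identityʳ u₃))))) v₁ v₂ v₃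
  sound (ifzero β d e _) (ifzero₁ x y) {s} v with sound e y v | sound d x (num refl)
  ... | u₂ , σ₂ , w | u₁ , σ₁ , z =
    u₁ ∙ u₂ , Steps-∙ σ₁ σ₂ ,
    ifzero₁ β (trans (∙-assoc u₁ u₂ s) (cong (_∙ _) (sym (∙-identityʳ u₁)))) z w
  sound (ifzero β d _ e) (ifzero₂ x a≢0 y) {s} v with sound e y v | sound d x (num refl)
  ... | u₂ , σ₂ , w | u₁ , σ₁ , z =
    u₁ ∙ u₂ , Steps-∙ σ₁ σ₂ ,
    ifzero₂ β (trans (∙-assoc u₁ u₂ s) (cong (_∙ _) (sym (∙-identityʳ u₁)))) a≢0 z w
  sound (new γ d) (new x) {s} v with sound d x (Den-cong (push-weak s) (rename-Den weakEmb v))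
  ... | t ∷ u , a ∷ σ₁ , w =
    u , σ₁ , new γ (Acts⇒Cell a) (Den-cong (cong (_∷ _) (++-identityʳ t)) w)

  -- Renaming and substitution calculus

  cong₃ : ∀ {A B C D : Set} (f : A → B → C → D) {a a′ b b′ c c′} →
          a ≡ a′ → b ≡ b′ → c ≡ c′ → f a b c ≡ f a′ b′ c′
  cong₃ f refl refl refl = refl

  rename-rename : {ρ : Fin m → Fin n} {ρ′ : Fin n → Fin k} {τ : Fin m → Fin k} →
                  (∀ x → ρ′ (ρ x) ≡ τ x) → ∀ M → rename ρ′ (rename ρ M) ≡ rename τ M
  rename-rename e (num a)         = refl
  rename-rename e (M ⟨ o ⟩ N)     = cong₂ (_⟨ o ⟩_) (rename-rename e M) (rename-rename e N)
  rename-rename e skip            = refl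
  rename-rename e (M ⨾ N)         = cong₂ _⨾_ (rename-rename e M) (rename-rename e N)
  rename-rename e (M := N)        = cong₂ _:=_ (rename-rename e M) (rename-rename e N)
  rename-rename e (! M)           = cong !_ (rename-rename e M)
  rename-rename e (while M N)     = cong₂ while (rename-rename e M) (rename-rename e N)
  rename-rename e (ifzero M N N′) =
    cong₃ ifzero (rename-rename e M) (rename-rename e N) (rename-rename e N′)
  rename-rename e (ident i)       = cong ident (e i)
  rename-rename e (ƛ A M)         =
      cong (ƛ A) (rename-rename (λ { zero → refl ; (suc x) → cong suc (e x) }) M)
  rename-rename e (M · N)         = cong₂ _·_ (rename-rename e M) (rename-rename e N)
  rename-rename e (new M)         =
      cong new (rename-rename (λ { zero → refl ; (suc x) → cong suc (e x) }) M)

  rename-id : {ρ : Fin n → Fin n} → (∀ x → ρ x ≡ x) → ∀ M → rename ρ M ≡ M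
  rename-id e (num a)         = refl
  rename-id e (M ⟨ o ⟩ N)     = cong₂ (_⟨ o ⟩_) (rename-id e M) (rename-id e N)
  rename-id e skip            = refl
  rename-id e (M ⨾ N)         = cong₂ _⨾_ (rename-id e M) (rename-id e N)
  rename-id e (M := N)        = cong₂ _:=_ (rename-id e M) (rename-id e N)
  rename-id e (! M)           = cong !_ (rename-id e M)
  rename-id e (while M N)     = cong₂ while (rename-id e M) (rename-id e N)
  rename-id e (ifzero M N N′) = cong₃ ifzero (rename-id e M) (rename-id e N) (rename-id e N′)
  rename-id e (ident i)       = cong ident (e i)
  rename-id e (ƛ A M)         = cong (ƛ A) (rename-id (λ { zero → refl ; (suc x) → cong suc (e x) }) M)
  rename-id e (M · N)         = cong₂ _·_ (rename-id e M) (rename-id e N)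
  rename-id e (new M)         = cong new (rename-id (λ { zero → refl ; (suc x) → cong suc (e x) }) M)

  subst-rename : {ρ : Fin m → Fin n} {θ : Fin n → Tm k} {η : Fin m → Tm k} →
                 (∀ x → θ (ρ x) ≡ η x) → ∀ M → subst θ (rename ρ M) ≡ subst η M
  subst-rename e (num a)         = refl
  subst-rename e (M ⟨ o ⟩ N)     = cong₂ (_⟨ o ⟩_) (subst-rename e M) (subst-rename e N)
  subst-rename e skip            = refl
  subst-rename e (M ⨾ N)         = cong₂ _⨾_ (subst-rename e M) (subst-rename e N)
  subst-rename e (M := N)        = cong₂ _:=_ (subst-rename e M) (subst-rename e N)
  subst-rename e (! M)           = cong !_ (subst-rename e M)
  subst-rename e (while M N)     = cong₂ while (subst-rename e M) (subst-rename e N)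
  subst-rename e (ifzero M N N′) =
      cong₃ ifzero (subst-rename e M) (subst-rename e N) (subst-rename e N′)
  subst-rename e (ident i)       = e i
  subst-rename e (ƛ A M)         =
      cong (ƛ A) (subst-rename (λ { zero → refl ; (suc x) → cong weaken (e x) }) M)
  subst-rename e (M · N)         = cong₂ _·_ (subst-rename e M) (subst-rename e N)
  subst-rename e (new M)         =
      cong new (subst-rename (λ { zero → refl ; (suc x) → cong weaken (e x) }) M)

  rename-lift-weaken : (ρ : Fin m → Fin n) → ∀ M → rename (liftRen ρ) (weaken M) ≡ weaken (rename ρ M)
  rename-lift-weaken ρ M =
    trans (rename-rename (λ _ → refl) M) (sym (rename-rename (λ _ → refl) M))

  rename-liftSub : {ρ : Fin n → Fin k} {θ : Fin m → Tm n} {η : Fin m → Tm k} →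
                   (∀ x → rename ρ (θ x) ≡ η x) → ∀ x → rename (liftRen ρ) (liftSub θ x) ≡ liftSub η x
  rename-liftSub e zero    = refl
  rename-liftSub {ρ = ρ} {θ} e (suc x) = trans (rename-lift-weaken ρ (θ x)) (cong weaken (e x))

  rename-subst : {ρ : Fin n → Fin k} {θ : Fin m → Tm n} {η : Fin m → Tm k} →
                 (∀ x → rename ρ (θ x) ≡ η x) → ∀ M → rename ρ (subst θ M) ≡ subst η M
  rename-subst e (num a)         = refl
  rename-subst e (M ⟨ o ⟩ N)     = cong₂ (_⟨ o ⟩_) (rename-subst e M) (rename-subst e N)
  rename-subst e skip            = refl
  rename-subst e (M ⨾ N)         = cong₂ _⨾_ (rename-subst e M) (rename-subst e N)
  rename-subst e (M := N)        = cong₂ _:=_ (rename-subst e M) (rename-subst e N)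
  rename-subst e (! M)           = cong !_ (rename-subst e M)
  rename-subst e (while M N)     = cong₂ while (rename-subst e M) (rename-subst e N)
  rename-subst e (ifzero M N N′) =
      cong₃ ifzero (rename-subst e M) (rename-subst e N) (rename-subst e N′)
  rename-subst e (ident i)       = e i
  rename-subst e (ƛ A M)         = cong (ƛ A) (rename-subst (rename-liftSub e) M)
  rename-subst e (M · N)         = cong₂ _·_ (rename-subst e M) (rename-subst e N)
  rename-subst e (new M)         = cong new (rename-subst (rename-liftSub e) M)

  subst-liftSub : {θ : Fin m → Tm n} {θ′ : Fin n → Tm k} {η : Fin m → Tm k} →
                  (∀ x → subst θ′ (θ x) ≡ η x) → ∀ x → subst (liftSub θ′) (liftSub θ x) ≡ liftSub η x
  subst-liftSub e zero = refl
  subst-liftSub {θ = θ} e (suc x) =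
    trans (subst-rename (λ _ → refl) (θ x))
      (trans (sym (rename-subst (λ _ → refl) (θ x))) (cong weaken (e x)))

  subst-subst : {θ : Fin m → Tm n} {θ′ : Fin n → Tm k} {η : Fin m → Tm k} →
                (∀ x → subst θ′ (θ x) ≡ η x) → ∀ M → subst θ′ (subst θ M) ≡ subst η M
  subst-subst e (num a)         = refl
  subst-subst e (M ⟨ o ⟩ N)     = cong₂ (_⟨ o ⟩_) (subst-subst e M) (subst-subst e N)
  subst-subst e skip            = refl
  subst-subst e (M ⨾ N)         = cong₂ _⨾_ (subst-subst e M) (subst-subst e N)
  subst-subst e (M := N)        = cong₂ _:=_ (subst-subst e M) (subst-subst e N)
  subst-subst e (! M)           = cong !_ (subst-subst e M)
  subst-subst e (while M N)     = cong₂ while (subst-subst e M) (subst-subst e N)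
  subst-subst e (ifzero M N N′) = cong₃ ifzero (subst-subst e M) (subst-subst e N) (subst-subst e N′)
  subst-subst e (ident i)       = e i
  subst-subst e (ƛ A M)         = cong (ƛ A) (subst-subst (subst-liftSub e) M)
  subst-subst e (M · N)         = cong₂ _·_ (subst-subst e M) (subst-subst e N)
  subst-subst e (new M)         = cong new (subst-subst (subst-liftSub e) M)

  subst-idents : {ρ : Fin m → Fin n} {θ : Fin m → Tm n} → (∀ x → θ x ≡ ident (ρ x)) → ∀ M →
      subst θ M ≡ rename ρ M
  subst-idents e (num a)         = refl
  subst-idents e (M ⟨ o ⟩ N)     = cong₂ (_⟨ o ⟩_) (subst-idents e M) (subst-idents e N)
  subst-idents e skip            = refl
  subst-idents e (M ⨾ N)         = cong₂ _⨾_ (subst-idents e M) (subst-idents e N)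
  subst-idents e (M := N)        = cong₂ _:=_ (subst-idents e M) (subst-idents e N)
  subst-idents e (! M)           = cong !_ (subst-idents e M)
  subst-idents e (while M N)     = cong₂ while (subst-idents e M) (subst-idents e N)
  subst-idents e (ifzero M N N′) =
      cong₃ ifzero (subst-idents e M) (subst-idents e N) (subst-idents e N′)
  subst-idents e (ident i)       = e i
  subst-idents e (ƛ A M)         =
    cong (ƛ A) (subst-idents (λ { zero → refl ; (suc x) → cong weaken (e x) }) M)
  subst-idents e (M · N)         = cong₂ _·_ (subst-idents e M) (subst-idents e N)
  subst-idents e (new M)         =
    cong new (subst-idents (λ { zero → refl ; (suc x) → cong weaken (e x) }) M)

  rename-[] : (ρ : Fin m → Fin n) → ∀ M N → rename ρ (M [ N ]) ≡ rename (liftRen ρ) M [ rename ρ N ]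
  rename-[] ρ M N =
    trans (rename-subst (λ _ → refl) M)
      (sym (subst-rename (λ { zero → refl ; (suc _) → refl }) M))

  extendSub : (Fin n → Fin k) → (Fin m → Tm n) → Tm k → Fin (suc m) → Tm k
  extendSub ρ θ N zero    = N
  extendSub ρ θ N (suc x) = rename ρ (θ x)

  -- A substitution, a growth of the store along `ρ` and a β-step amount to one extended
  -- substitution. This is how abstractions meet their arguments in the adequacy proof.
  subst-extend : (ρ : Fin n → Fin k) (θ : Fin m → Tm n) → ∀ M N →
                 rename (liftRen ρ) (subst (liftSub θ) M) [ N ] ≡ subst (extendSub ρ θ N) M
  subst-extend {n = n} {k = k} ρ θ M N =
    trans (subst-rename {η = η} (λ { zero → refl ; (suc _) → refl }) (subst (liftSub θ) M))
      (subst-subst (λ { zero → refl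
                      ; (suc x) → trans (subst-rename (λ _ → refl) (θ x))
                          (subst-idents (λ _ → refl) (θ x)) }) M)
    where
    η : Fin (suc n) → Tm k
    η zero    = N
    η (suc i) = ident (ρ i)

  lookup-ext : {σ τ : Store n} → (∀ i → lookup σ i ≡ lookup τ i) → σ ≡ τ
  lookup-ext {σ = []}    {[]}    e = refl
  lookup-ext {σ = _ ∷ _} {_ ∷ _} e = cong₂ _∷_ (e zero) (lookup-ext (e ∘ suc))

  -- A frame property: evaluation sees the store only through the identifiers of its term. Results
  -- carry over to stores with additional cells, whose contents persist.
  ⇓-rename : {σ σ′ : Store m} → ∀ {M V} → σ ∣ M ⇓ σ′ ∣ V →
             (ρ : Fin m → Fin n) → Injective _≡_ _≡_ ρ → (τ : Store n) →
                 (∀ i → lookup τ (ρ i) ≡ lookup σ i) →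
             ∃[ τ′ ] (τ ∣ rename ρ M ⇓ τ′ ∣ rename ρ V) × (∀ i → lookup τ′ (ρ i) ≡ lookup σ′ i) ×
                     (∀ j → (∀ i → ρ i ≢ j) → lookup τ′ j ≡ lookup τ j)
  ⇓-rename (value v) ρ inj τ e = τ , value (rename-value v) , e , λ _ _ → refl
    where
    rename-value : ∀ {V} → Value V → Value (rename ρ V)
    rename-value (num a)   = num a
    rename-value skip      = skip
    rename-value (ident i) = ident (ρ i)
    rename-value (ƛ A M)   = ƛ A (rename (liftRen ρ) M)
  ⇓-rename (app {M′ = M′} {N = N} x y) ρ inj τ e with ⇓-rename x ρ inj τ e
  ... | τ₁ , x′ , e₁ , f₁ with ⇓-rename y ρ inj τ₁ e₁
  ...   | τ₂ , y′ , e₂ , f₂ =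
    τ₂ , app x′ (transport (λ K → _ ∣ K ⇓ _ ∣ _) (rename-[] ρ M′ N) y′) , e₂ , λ j f →
        trans (f₂ j f) (f₁ j f)
  ⇓-rename (arith x y) ρ inj τ e with ⇓-rename x ρ inj τ e
  ... | τ₁ , x′ , e₁ , f₁ with ⇓-rename y ρ inj τ₁ e₁
  ...   | τ₂ , y′ , e₂ , f₂ = τ₂ , arith x′ y′ , e₂ , λ j f → trans (f₂ j f) (f₁ j f)
  ⇓-rename (assign {σ″ = σ₂} {a = a} {x = i} x y) ρ inj τ e with ⇓-rename x ρ inj τ e
  ... | τ₁ , x′ , e₁ , f₁ with ⇓-rename y ρ inj τ₁ e₁
  ...   | τ₂ , y′ , e₂ , f₂ = τ₂ [ ρ i ]≔ a , assign x′ y′ , e₃ , λ j f →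
            trans (lookup∘update′ (λ e → f i (sym e)) τ₂ a) (trans (f₂ j f) (f₁ j f))
    where
    e₃ : ∀ j → lookup (τ₂ [ ρ i ]≔ a) (ρ j) ≡ lookup (σ₂ [ i ]≔ a) j
    e₃ j with j ≟ i
    ... | yes refl = trans (lookup∘update (ρ i) τ₂ a) (sym (lookup∘update i σ₂ a))
    ... | no j≢i   = trans (lookup∘update′ (j≢i ∘ inj) τ₂ a)
        (trans (e₂ j) (sym (lookup∘update′ j≢i σ₂ a)))
  ⇓-rename (deref {σ′ = σ₁} {x = i} x) ρ inj τ e with ⇓-rename x ρ inj τ e
  ... | τ₁ , x′ , e₁ , f₁ =
    τ₁ , transport (λ a → _ ∣ _ ⇓ _ ∣ num a) (e₁ i) (deref x′) , e₁ , f₁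
  ⇓-rename (seq x y) ρ inj τ e with ⇓-rename x ρ inj τ e
  ... | τ₁ , x′ , e₁ , f₁ with ⇓-rename y ρ inj τ₁ e₁
  ...   | τ₂ , y′ , e₂ , f₂ = τ₂ , seq x′ y′ , e₂ , λ j f → trans (f₂ j f) (f₁ j f)
  ⇓-rename (stop x a≢0) ρ inj τ e with ⇓-rename x ρ inj τ e
  ... | τ₁ , x′ , e₁ , f₁ = τ₁ , stop x′ a≢0 , e₁ , f₁
  ⇓-rename (loop x y z) ρ inj τ e with ⇓-rename x ρ inj τ e
  ... | τ₁ , x′ , e₁ , f₁ with ⇓-rename y ρ inj τ₁ e₁
  ...   | τ₂ , y′ , e₂ , f₂ with ⇓-rename z ρ inj τ₂ e₂
  ...     | τ₃ , z′ , e₃ , f₃ =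
    τ₃ , loop x′ y′ z′ , e₃ , λ j f → trans (f₃ j f) (trans (f₂ j f) (f₁ j f))
  ⇓-rename (ifzero₁ x y) ρ inj τ e with ⇓-rename x ρ inj τ e
  ... | τ₁ , x′ , e₁ , f₁ with ⇓-rename y ρ inj τ₁ e₁
  ...   | τ₂ , y′ , e₂ , f₂ = τ₂ , ifzero₁ x′ y′ , e₂ , λ j f → trans (f₂ j f) (f₁ j f)
  ⇓-rename (ifzero₂ x a≢0 y) ρ inj τ e with ⇓-rename x ρ inj τ e
  ... | τ₁ , x′ , e₁ , f₁ with ⇓-rename y ρ inj τ₁ e₁
  ...   | τ₂ , y′ , e₂ , f₂ = τ₂ , ifzero₂ x′ a≢0 y′ , e₂ , λ j f → trans (f₂ j f) (f₁ j f)
  ⇓-rename (new {V = V} x) ρ inj τ e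
    with ⇓-rename x (liftRen ρ) (lift-inj inj) (0 ∷ τ) (λ { zero → refl ; (suc i) → e i })
    where
    lift-inj : Injective _≡_ _≡_ ρ → Injective _≡_ _≡_ (liftRen ρ)
    lift-inj inj {zero}  {zero}  _ = refl
    lift-inj inj {suc i} {suc j} e = cong suc (inj (suc-injective e))
  ... | a ∷ τ′ , x′ , e′ , f′ =
    τ′ , new (transport (λ K → 0 ∷ τ ∣ _ ⇓ a ∷ τ′ ∣ K) (rename-lift-weaken ρ V) x′) ,
    e′ ∘ suc , λ j f → f′ (suc j) (λ { (suc i) e → f i (suc-injective e) })

  -- Adequacy

  Word : ℕ → Set
  Word n = Fin n → List VarAct

  Runs : Store n → Word n → Store n → Set
  Runs σ w σ′ = ∀ i → Acts (lookup σ i) (w i) (lookup σ′ i)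

  Acts-[] : ∀ {v s w} → s ≡ [] → Acts v s w → v ≡ w
  Acts-[] refl [] = refl

  Runs-split : (σ σ″ : Store n) {w u v : Word n} → (∀ i → w i ≡ u i List.++ v i) → Runs σ w σ″ →
               ∃[ σ′ ] Runs σ u σ′ × Runs σ′ v σ″
  Runs-split σ σ″ {w} {u} {v} e run =
    tabulate mid ,
    (λ i → transport (Acts _ (u i)) (sym (lookup∘tabulate mid i)) (proj₁ (proj₂ (cut i)))) ,
    (λ i → transport (λ x → Acts x (v i) _) (sym (lookup∘tabulate mid i)) (proj₂ (proj₂ (cut i))))
    where
    cut : ∀ i → ∃[ x ] Acts (lookup σ i) (u i) x × Acts x (v i) (lookup σ″ i)
    cut i = Acts-split (u i) (transport (λ s → Acts _ s _) (e i) (run i))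
    mid : Fin _ → ℕ
    mid i = proj₁ (cut i)

  data Pieces {n} {X : Set} (R : Word n → X → Set) (w : Word n) : List X → Set where
    []  : (∀ i → w i ≡ []) → Pieces R w []
    cut : ∀ {u v a as} → (∀ i → w i ≡ u i List.++ v i) → R u a → Pieces R v as → Pieces R w (a ∷ as)

  -- Worlds grow along injective renamings, since new extends the store; a word
  -- is carried along without touching the additional cells.
  Carried : (Fin m → Fin n) → Word m → Word n → Set
  Carried ρ w w′ = (∀ i → w′ (ρ i) ≡ w i) × (∀ j → (∀ i → ρ i ≢ j) → w′ j ≡ [])

  -- A term of type `var` evaluates to a mere identifier; its action is what is done to that cell
  -- next. So `read a` looks into the final store, while `write a` produces it from the store in
  -- which evaluation ends.
  Result : (A : Ty) → Store n → Tm n → Store n → α A → Set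
  Result nat σ P σ′ a = σ ∣ P ⇓ σ′ ∣ num a
  Result comm σ P σ′ _ = σ ∣ P ⇓ σ′ ∣ skip
  Result var σ P σ′ (read a) = ∃[ x ] (σ ∣ P ⇓ σ′ ∣ ident x) × lookup σ′ x ≡ a
  Result {n} var σ P σ′ (write a) = ∃[ x ] Σ (Store n) λ σ″ → (σ ∣ P ⇓ σ″ ∣ ident x) × σ′ ≡ σ″ [ x ]≔ a
  Result (A ⊸ B) σ P σ′ a = ⊥

  -- A word orders the actions on each cell and leaves the interleaving of different cells open. As
  -- function and argument act on different cells, concatenating `w′` and `v` describes every way in
  -- which evaluation may alternate between them.
  Realises : (A : Ty) → Tm n → Word n → α A → Set
  Realises nat  P w a = ∀ σ σ′ → Runs σ w σ′ → Result nat σ P σ′ a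
  Realises comm P w a = ∀ σ σ′ → Runs σ w σ′ → Result comm σ P σ′ a
  Realises var  P w a = ∀ σ σ′ → Runs σ w σ′ → Result var σ P σ′ a
  Realises {n} (A ⊸ B) P w (t , b) =
    ∀ {k} (ρ : Fin n → Fin k) → Injective _≡_ _≡_ ρ → ∀ w′ → Carried ρ w w′ →
    ∀ N v → Pieces (Realises A N) v t → (∀ i → w′ i ≡ [] ⊎ v i ≡ []) →
    ∀ r → (∀ i → r i ≡ w′ i List.++ v i) → Realises B (rename ρ P · N) r b

  base⇒ : ∀ {P : Tm n} {w b} → Base B → (∀ σ σ′ → Runs σ w σ′ → Result B σ P σ′ b) → Realises B P w b
  base⇒ nat  f = f
  base⇒ comm f = f
  base⇒ var  f = f

  ⇒base : ∀ {P : Tm n} {w b} → Base B → Realises B P w b → ∀ σ σ′ → Runs σ w σ′ → Result B σ P σ′ b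
  ⇒base nat  f = f
  ⇒base comm f = f
  ⇒base var  f = f

  Result-expand : ∀ {σ σ₁ σ′ : Store n} {P P′} B {b} → (∀ {σ″ V} → σ₁ ∣ P ⇓ σ″ ∣ V → σ ∣ P′ ⇓ σ″ ∣ V) →
                  Result B σ₁ P σ′ b → Result B σ P′ σ′ b
  Result-expand nat  f x = f x
  Result-expand comm f x = f x
  Result-expand var {read _}  f (i , x , e) = i , f x , e
  Result-expand var {write _} f (i , σ″ , x , e) = i , σ″ , f x , e

  Realises-≗ : ∀ A {P : Tm n} {w w′ a} → (∀ i → w i ≡ w′ i) → Realises A P w a → Realises A P w′ a
  Realises-≗ nat  e R σ σ′ run = R σ σ′ (λ i → transport (λ s → Acts _ s _) (sym (e i)) (run i))
  Realises-≗ comm e R σ σ′ run = R σ σ′ (λ i → transport (λ s → Acts _ s _) (sym (e i)) (run i))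
  Realises-≗ var  e R σ σ′ run = R σ σ′ (λ i → transport (λ s → Acts _ s _) (sym (e i)) (run i))
  Realises-≗ (A ⊸ B) e R ρ inj w″ (image , fresh) =
    R ρ inj w″ ((λ i → trans (image i) (sym (e i))) , fresh)

  infix 4 _↝_

  -- Head reduction, which does not involve the store. At function types `Realises` speaks of
  -- applications only, so closure under expansion of these redexes is what the case of an
  -- abstraction requires.
  data _↝_ {n} : Tm n → Tm n → Set where
    beta : ∀ A M N → ƛ A M · N ↝ M [ N ]
    appˡ : ∀ {M M′} → M ↝ M′ → ∀ N → M · N ↝ M′ · N

  ↝-rename : (ρ : Fin m → Fin n) {P P′ : Tm m} → P ↝ P′ → rename ρ P ↝ rename ρ P′
  ↝-rename ρ (beta A M N) = transport (rename ρ (ƛ A M · N) ↝_) (sym (rename-[] ρ M N)) (beta A _ _)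
  ↝-rename ρ (appˡ s N) = appˡ (↝-rename ρ s) _

  ↝-⇓ : ∀ {σ σ′ : Store n} {P P′ V} → P ↝ P′ → σ ∣ P′ ⇓ σ′ ∣ V → σ ∣ P ⇓ σ′ ∣ V
  ↝-⇓ (beta A M N)  x         = app (value (ƛ A M)) x
  ↝-⇓ (appˡ s N) (app x y) = app (↝-⇓ s x) y
  ↝-⇓ (appˡ s N) (value ())

  Realises-expand : ∀ A {P P′ : Tm n} {w a} → P ↝ P′ → Realises A P′ w a → Realises A P w a
  Realises-expand nat  s R σ σ′ run = Result-expand nat (↝-⇓ s) (R σ σ′ run)
  Realises-expand comm s R σ σ′ run = Result-expand comm (↝-⇓ s) (R σ σ′ run)
  Realises-expand var  s R σ σ′ run = Result-expand var (↝-⇓ s) (R σ σ′ run)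
  Realises-expand (A ⊸ B) s R ρ inj w′ c N v ps dis r e =
    Realises-expand B (appˡ (↝-rename ρ s) N) (R ρ inj w′ c N v ps dis r e)

  Carried-∘ : {ρ : Fin m → Fin n} {ρ′ : Fin n → Fin k} {w : Word m} {w′ : Word n} {w″ : Word k} →
              Carried ρ w w′ → Carried ρ′ w′ w″ → Carried (ρ′ ∘ ρ) w w″
  Carried-∘ {ρ = ρ} {ρ′} {w} {w′} {w″} (im , fr) (im′ , fr′) =
    (λ i → trans (im′ (ρ i)) (im i)) , λ j f → lemma j f (any? (λ i → ρ′ i ≟ j))
    where
    lemma : ∀ j → (∀ i → ρ′ (ρ i) ≢ j) → Dec (∃[ i ] ρ′ i ≡ j) → w″ j ≡ []
    lemma j f (yes (i , refl)) = trans (im′ i) (fr i (λ i′ e → f i′ (cong ρ′ e)))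
    lemma j f (no ¬p) = fr′ j (λ i e → ¬p (i , e))

  Result-rename : ∀ B {σ σ′ : Store m} {P b} (ρ : Fin m → Fin n) → Injective _≡_ _≡_ ρ →
      Result B σ P σ′ b →
                  ∀ τ τ′ → (∀ i → lookup τ (ρ i) ≡ lookup σ i) → (∀ i → lookup τ′ (ρ i) ≡ lookup σ′ i) →
                  (∀ j → (∀ i → ρ i ≢ j) → lookup τ j ≡ lookup τ′ j) →
                  Result B τ (rename ρ P) τ′ b
  Result-rename {m} {n} B {σ} {σ′} {P₀} ρ inj res τ τ′ e e′ f = go B res
    where
    agree : (σ₁ : Store m) {τ₁ τ₂ : Store n} →
            (∀ i → lookup τ₁ (ρ i) ≡ lookup σ₁ i) → (∀ i → lookup τ₂ (ρ i) ≡ lookup σ₁ i) →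
            (∀ j → (∀ i → ρ i ≢ j) → lookup τ₁ j ≡ lookup τ₂ j) → τ₁ ≡ τ₂
    agree _ {τ₁ = τ₁} {τ₂} g g′ h = lookup-ext λ j → lemma j (any? (λ i → ρ i ≟ j))
      where
      lemma : ∀ j → Dec (∃[ i ] ρ i ≡ j) → lookup τ₁ j ≡ lookup τ₂ j
      lemma j (yes (i , refl)) = trans (g i) (sym (g′ i))
      lemma j (no ¬p)          = h j (λ i e → ¬p (i , e))
    run : ∀ {σ₁ P V} → σ ∣ P ⇓ σ₁ ∣ V → ∃[ τ₁ ] (τ ∣ rename ρ P ⇓ τ₁ ∣ rename ρ V) ×
          (∀ i → lookup τ₁ (ρ i) ≡ lookup σ₁ i) × (∀ j → (∀ i → ρ i ≢ j) → lookup τ₁ j ≡ lookup τ j)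
    run x = ⇓-rename x ρ inj τ e
    run≡ : ∀ {P V} → σ ∣ P ⇓ σ′ ∣ V → τ ∣ rename ρ P ⇓ τ′ ∣ rename ρ V
    run≡ x with run x
    ... | τ₁ , y , g , h =
        transport (λ τ₁ → τ ∣ _ ⇓ τ₁ ∣ _) (agree σ′ g e′ (λ j p → trans (h j p) (f j p))) y
    go : ∀ B {b} → Result B σ P₀ σ′ b → Result B τ (rename ρ P₀) τ′ b
    go nat  x = run≡ x
    go comm x = run≡ x
    go var {read _}  (i , x , q) = ρ i , run≡ x , trans (e′ i) q
    go var {write a} (i , σ″ , x , refl) with run x
    ... | τ₁ , y , g , h = ρ i , τ₁ , y ,
      agree (σ″ [ i ]≔ a) e′ upd
          (λ j p → trans (sym (f j p)) (sym (trans (lookup∘update′ (λ q → p i (sym q)) τ₁ a) (h j p))))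
      where
      upd : ∀ j → lookup (τ₁ [ ρ i ]≔ a) (ρ j) ≡ lookup (σ″ [ i ]≔ a) j
      upd j with j ≟ i
      ... | yes refl = trans (lookup∘update (ρ i) τ₁ a) (sym (lookup∘update i σ″ a))
      ... | no j≢i   = trans (lookup∘update′ (j≢i ∘ inj) τ₁ a)
          (trans (g j) (sym (lookup∘update′ j≢i σ″ a)))

  Realises-rename-base : Base B → ∀ {P : Tm m} {w a} (ρ : Fin m → Fin n) → Injective _≡_ _≡_ ρ →
      ∀ {w′} →
                         Carried ρ w w′ → Realises B P w a → Realises B (rename ρ P) w′ a
  Realises-rename-base {B = B} β {w = w} ρ inj (im , fr) R = base⇒ β λ τ τ′ run →
    Result-rename B ρ inj
      -- The small stores are read off the large ones along `ρ`; cells outside its image keep their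
      -- contents because their words are empty.
      (⇒base β R (tabulate (lookup τ ∘ ρ)) (tabulate (lookup τ′ ∘ ρ)) λ i →
        transport₃ (sym (lookup∘tabulate _ i)) (im i) (sym (lookup∘tabulate _ i)) (run (ρ i)))
      τ τ′ (λ i → sym (lookup∘tabulate _ i)) (λ i → sym (lookup∘tabulate _ i))
      (λ j f → Acts-[] (fr j f) (run j))
    where
    transport₃ : ∀ {u u′ s s′ v v′} → u ≡ u′ → s ≡ s′ → v ≡ v′ → Acts u s v → Acts u′ s′ v′
    transport₃ refl refl refl a = a

  Realises-rename : ∀ A {P : Tm m} {w a} (ρ : Fin m → Fin n) → Injective _≡_ _≡_ ρ → ∀ {w′} →
      Carried ρ w w′ →
                    Realises A P w a → Realises A (rename ρ P) w′ a
  Realises-rename nat  ρ inj c R = Realises-rename-base nat ρ inj c R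
  Realises-rename comm ρ inj c R = Realises-rename-base comm ρ inj c R
  Realises-rename var  ρ inj c R = Realises-rename-base var ρ inj c R
  Realises-rename (A ⊸ B) {P} ρ inj c R ρ′ inj′ w″ c′ N v ps dis r e =
    transport (λ K → Realises B (K · N) r _) (sym (rename-rename (λ _ → refl) P))
      (R (ρ′ ∘ ρ) (inj ∘ inj′) w″ (Carried-∘ c c′) N v ps dis r e)

  Pieces-split : ∀ {n} {X : Set} {R : Word n → X → Set} (as : List X) {bs} {w} →
      Pieces R w (as List.++ bs) →
                 ∃[ u ] ∃[ v ] (∀ i → w i ≡ u i List.++ v i) × Pieces R u as × Pieces R v bs
  Pieces-split [] {w = w} ps = (λ _ → []) , w , (λ _ → refl) , [] (λ _ → refl) , ps
  Pieces-split (a ∷ as) (cut {u = u} e r ps) with Pieces-split as ps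
  ... | u′ , v , e′ , qs , qs′ =
    (λ i → u i List.++ u′ i) , v ,
    (λ i → trans (e i) (trans (cong (u i List.++_) (e′ i)) (sym (++-assoc (u i) (u′ i) (v i))))) ,
    cut (λ _ → refl) r qs , qs′

  Pieces-[] : ∀ {n} {X : Set} {R : Word n → X → Set} {w as} → Pieces R w as → as ≡ [] → ∀ i → w i ≡ []
  Pieces-[] ([] e) refl = e

  Pieces-map : ∀ {m n} {X : Set} {R : Word m → X → Set} {S : Word n → X → Set} (f : Word m → Word n) →
               (∀ {w u v} → (∀ i → w i ≡ u i List.++ v i) → ∀ j → f w j ≡ f u j List.++ f v j) →
               (∀ {w} → (∀ i → w i ≡ []) → ∀ j → f w j ≡ []) →
               (∀ {w a} → R w a → S (f w) a) → ∀ {w as} → Pieces R w as → Pieces S (f w) as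
  Pieces-map f f-++ f-[] g ([] e)       = [] (f-[] e)
  Pieces-map f f-++ f-[] g (cut e r ps) = cut (f-++ e) (g r) (Pieces-map f f-++ f-[] g ps)

  -- w merges words over disjoint sets of cells, one word for each variable.
  Merge : (Fin m → Word n) → Word n → Set
  Merge parts w = ∀ y → (w y ≡ [] × ∀ x → parts x y ≡ []) ⊎
                        ∃[ x ] w y ≡ parts x y × ∀ x′ → x′ ≢ x → parts x′ y ≡ []

  Merge-[] : {parts : Fin m → Word n} {w : Word n} → Merge parts w → ∀ y → w y ≡ [] → ∀ x →
      parts x y ≡ []
  Merge-[] merge y e x with merge y
  ... | inj₁ (_ , f) = f x
  ... | inj₂ (x₀ , e₀ , f) with x ≟ x₀
  ...   | yes refl = trans (sym e₀) e
  ...   | no x≢x₀  = f x x≢x₀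

  -- `realised` meets the demands on each variable, and `merge` keeps the variables on different
  -- cells, as `Owner` does for identifiers.
  record Env {Γ : Cxt m} (θ : Fin m → Tm n) (s : Traces Γ) (w : Word n) : Set where
    constructor env
    field
      parts    : Fin m → Word n
      realised : ∀ x {A} (p : lookup Γ x ≡ A) → Pieces (Realises A (θ x)) (parts x) (get s x p)
      merge    : Merge parts w

  open Env

  Env-ε : {Γ : Cxt m} {θ : Fin m → Tm n} {w : Word n} → Env {Γ = Γ} θ ε w → ∀ y → w y ≡ []
  Env-ε {Γ = Γ} E y with merge E y
  ... | inj₁ (e , _) = e
  ... | inj₂ (x , e , _) = trans e (Pieces-[] (realised E x refl) (get-ε Γ x refl) y)

  -- Every part is cut by `Pieces-split`, and at each cell `w` follows the one variable that may use
  -- it. If `s # t`, one of the two demands on that variable is empty, and so is one half of the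
  -- word at that cell.
  Env-∙ : {Γ : Cxt m} {θ : Fin m → Tm n} (s t : Traces Γ) {w : Word n} → Env θ (s ∙ t) w →
          ∃[ u ] ∃[ v ] (∀ i → w i ≡ u i List.++ v i) × Env θ s u × Env θ t v ×
                        (s # t → ∀ i → u i ≡ [] ⊎ v i ≡ [])
  Env-∙ {m = m} {n = n} {Γ} {θ} s t {w} E =
      u , v , w≡ , env left realisedˡ mergeˡ , env right realisedʳ mergeʳ , disj
    where
    halves : ∀ x → ∃[ u ] ∃[ v ] (∀ i → parts E x i ≡ u i List.++ v i) ×
                   Pieces (Realises _ (θ x)) u (get s x refl) ×
                       Pieces (Realises _ (θ x)) v (get t x refl)
    halves x = Pieces-split (get s x refl)
                 (transport (Pieces _ (parts E x)) (get-∙ s t x refl) (realised E x refl))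
    left right : Fin m → Word n
    left  x = proj₁ (halves x)
    right x = proj₁ (proj₂ (halves x))
    parts≡ : ∀ x i → parts E x i ≡ left x i List.++ right x i
    parts≡ x = proj₁ (proj₂ (proj₂ (halves x)))
    realisedˡ : ∀ x {A} (p : lookup Γ x ≡ A) → Pieces (Realises A (θ x)) (left x) (get s x p)
    realisedˡ x refl = proj₁ (proj₂ (proj₂ (proj₂ (halves x))))
    realisedʳ : ∀ x {A} (p : lookup Γ x ≡ A) → Pieces (Realises A (θ x)) (right x) (get t x p)
    realisedʳ x refl = proj₂ (proj₂ (proj₂ (proj₂ (halves x))))
    choose : (Fin m → Word n) → Word n
    choose f y with merge E y
    ... | inj₁ _       = []
    ... | inj₂ (x , _) = f x y
    u v : Word n
    u = choose left
    v = choose right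
    w≡ : ∀ y → w y ≡ u y List.++ v y
    w≡ y with merge E y
    ... | inj₁ (e , _)     = e
    ... | inj₂ (x , e , _) = trans e (parts≡ x y)
    emptyˡ : ∀ x y → parts E x y ≡ [] → left x y ≡ []
    emptyˡ x y e = ++-conicalˡ _ _ (trans (sym (parts≡ x y)) e)
    emptyʳ : ∀ x y → parts E x y ≡ [] → right x y ≡ []
    emptyʳ x y e = ++-conicalʳ (left x y) _ (trans (sym (parts≡ x y)) e)
    mergeˡ : Merge left u
    mergeˡ y with merge E y
    ... | inj₁ (_ , f)     = inj₁ (refl , λ x → emptyˡ x y (f x))
    ... | inj₂ (x , _ , f) = inj₂ (x , refl , λ x′ ≢ → emptyˡ x′ y (f x′ ≢))
    mergeʳ : Merge right v
    mergeʳ y with merge E y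
    ... | inj₁ (_ , f)     = inj₁ (refl , λ x → emptyʳ x y (f x))
    ... | inj₂ (x , _ , f) = inj₂ (x , refl , λ x′ ≢ → emptyʳ x′ y (f x′ ≢))
    disj : s # t → ∀ y → u y ≡ [] ⊎ v y ≡ []
    disj s#t y with merge E y
    ... | inj₁ _       = inj₁ refl
    ... | inj₂ (x , _) with s#t x refl
    ...   | inj₁ e = inj₁ (Pieces-[] (realisedˡ x refl) e y)
    ...   | inj₂ e = inj₂ (Pieces-[] (realisedʳ x refl) e y)

  Env-single : {Γ : Cxt m} {θ : Fin m → Tm n} {w : Word n} → ∀ i (p : lookup Γ i ≡ A) {a} →
               Env {Γ = Γ} θ (single-trace i p a) w → Realises A (θ i) w a
  Env-single {Γ = Γ} {w = w} i p E
    with transport (Pieces _ (parts E i)) (get-single Γ i p p _) (realised E i p)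
  ... | cut {u} {v} e r ([] v≡[]) = Realises-≗ _ u≡w r
    where
    part≡ : ∀ y → parts E i y ≡ u y
    part≡ y = trans (e y) (trans (cong (u y List.++_) (v≡[] y)) (++-identityʳ (u y)))
    u≡w : ∀ y → u y ≡ w y
    u≡w y with merge E y
    ... | inj₁ (f , g) = trans (sym (part≡ y)) (trans (g i) (sym f))
    ... | inj₂ (x , f , g) with i ≟ x
    ...   | yes refl = trans (sym (part≡ y)) (sym f)
    ...   | no i≢x   = trans (sym (part≡ y)) (trans (g i i≢x)
                         (sym (trans f (Pieces-[] (realised E x refl)
                             (get-single-≢ Γ p refl _ i≢x) y))))

  carry : (Fin m → Fin n) → Word m → Word n
  carry ρ w j with any? (λ i → ρ i ≟ j)
  ... | yes (i , _) = w i
  ... | no _        = []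

  carry-image : (ρ : Fin m → Fin n) → Injective _≡_ _≡_ ρ → ∀ w i → carry ρ w (ρ i) ≡ w i
  carry-image ρ inj w i with any? (λ i′ → ρ i′ ≟ ρ i)
  ... | yes (i′ , e) = cong w (inj e)
  ... | no ¬p        = contradiction (i , refl) ¬p

  carry-fresh : (ρ : Fin m → Fin n) → ∀ w j → (∀ i → ρ i ≢ j) → carry ρ w j ≡ []
  carry-fresh ρ w j f with any? (λ i → ρ i ≟ j)
  ... | yes (i , e) = contradiction e (f i)
  ... | no _        = refl

  Pieces-carry : ∀ A {P : Tm m} {w as} (ρ : Fin m → Fin n) → Injective _≡_ _≡_ ρ →
                 Pieces (Realises A P) w as → Pieces (Realises A (rename ρ P)) (carry ρ w) as
  Pieces-carry A ρ inj = Pieces-map (carry ρ) carry-++ carry-[]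
    (Realises-rename A ρ inj (carry-image ρ inj _ , carry-fresh ρ _))
    where
    carry-++ : ∀ {w u v} → (∀ i → w i ≡ u i List.++ v i) → ∀ j →
        carry ρ w j ≡ carry ρ u j List.++ carry ρ v j
    carry-++ e j with any? (λ i → ρ i ≟ j)
    ... | yes (i , _) = e i
    ... | no _        = refl
    carry-[] : ∀ {w} → (∀ i → w i ≡ []) → ∀ j → carry ρ w j ≡ []
    carry-[] e j with any? (λ i → ρ i ≟ j)
    ... | yes (i , _) = e i
    ... | no _        = refl

  Env-extend : {Γ : Cxt m} {θ : Fin m → Tm n} {s : Traces Γ} {w : Word n} → Env θ s w →
               (ρ : Fin n → Fin k) → Injective _≡_ _≡_ ρ → ∀ {w′} → Carried ρ w w′ →
               ∀ N {v t} → Pieces (Realises A N) v t → (∀ i → w′ i ≡ [] ⊎ v i ≡ []) →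
               ∀ {r} → (∀ i → r i ≡ w′ i List.++ v i) →
               Env {Γ = A ∷ Γ} (extendSub ρ θ N) (t ∷ s) r
  Env-extend {Γ = Γ} {θ} {s} {w} E ρ inj {w′} (im , fr) N {v} {t} ps dis {r} e =
      env parts′ realised′ merge′
    where
    parts′ : Fin _ → Word _
    parts′ zero    = v
    parts′ (suc x) = carry ρ (parts E x)
    realised′ : ∀ x {B} (p : lookup (_ ∷ Γ) x ≡ B) →
                Pieces (Realises B (extendSub ρ θ N x)) (parts′ x) (get (t ∷ s) x p)
    realised′ zero    refl = ps
    realised′ (suc x) p    = Pieces-carry _ ρ inj (realised E x p)
    old : ∀ y → w′ y ≡ [] → ∀ x → carry ρ (parts E x) y ≡ []
    old y f x with any? (λ i → ρ i ≟ y)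
    ... | yes (i , refl) = Merge-[] (merge E) i (trans (sym (im i)) f) x
    ... | no _           = refl
    merge′ : Merge parts′ r
    merge′ y with dis y
    ... | inj₁ w′≡[] = inj₂ (zero , trans (e y) (cong (List._++ v y) w′≡[]) ,
                             λ { zero ≢ → contradiction refl ≢ ; (suc x) _ → old y w′≡[] x })
    ... | inj₂ v≡[] with any? (λ i → ρ i ≟ y)
    ...   | no ¬p = inj₁ (trans r≡ (fr y f) , λ { zero → v≡[] ; (suc x) → carry-fresh ρ _ y f })
      where
      r≡ : r y ≡ w′ y
      r≡ = trans (e y) (trans (cong (w′ y List.++_) v≡[]) (++-identityʳ (w′ y)))
      f : ∀ i → ρ i ≢ y
      f i q = ¬p (i , q)
    ...   | yes (i , refl) with merge E i
    ...     | inj₁ (f , g) =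
        inj₁ (trans r≡ f , λ { zero → v≡[] ; (suc x) → trans (carry-image ρ inj _ i) (g x) })
      where
      r≡ : r y ≡ w i
      r≡ = trans (e y) (trans (cong₂ List._++_ (im i) v≡[]) (++-identityʳ (w i)))
    ...     | inj₂ (x , f , g) =
      inj₂ (suc x , trans r≡ (trans f (sym (carry-image ρ inj _ i))) ,
            λ { zero _ → v≡[] ; (suc x′) ≢ → trans (carry-image ρ inj _ i) (g x′ (≢ ∘ cong suc)) })
      where
      r≡ : r y ≡ w i
      r≡ = trans (e y) (trans (cong₂ List._++_ (im i) v≡[]) (++-identityʳ (w i)))

  atZero : List VarAct → Word (suc n)
  atZero t zero    = t
  atZero t (suc _) = []

  Realises-cell : ∀ a → Realises var (ident {suc n} zero) (atZero (a ∷ [])) a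
  Realises-cell (read a) (_ ∷ σ) (_ ∷ σ′) run with run zero
  ... | read [] = zero ,
      transport (λ τ → (a ∷ σ) ∣ ident zero ⇓ τ ∣ ident zero) (cong (a ∷_) rest) (value (ident zero)) ,
      refl
    where
    rest : σ ≡ σ′
    rest = lookup-ext (λ i → Acts-[] refl (run (suc i)))
  Realises-cell (write a) (v ∷ σ) (_ ∷ σ′) run with run zero
  ... | write [] = zero , v ∷ σ , value (ident zero) , cong (a ∷_) (sym rest)
    where
    rest : σ ≡ σ′
    rest = lookup-ext (λ i → Acts-[] refl (run (suc i)))

  Pieces-cell : ∀ t → Pieces (Realises var (ident {suc n} zero)) (atZero t) t
  Pieces-cell []      = [] λ { zero → refl ; (suc _) → refl }
  Pieces-cell (a ∷ t) = cut (λ { zero → refl ; (suc _) → refl }) (Realises-cell a) (Pieces-cell t)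

  Env-new : {Γ : Cxt m} {θ : Fin m → Tm n} {s : Traces Γ} {w : Word n} → Env θ s w →
      ∀ t {r : Word (suc n)} →
            r zero ≡ t → (∀ i → r (suc i) ≡ w i) → Env {Γ = var ∷ Γ} (liftSub θ) (t ∷ s) r
  Env-new {m = m} {n} {Γ} {θ} {s} {w} E t {r} r0 rs = env parts′ realised′ merge′
    where
    parts′ : Fin (suc m) → Word (suc n)
    parts′ zero    = atZero t
    parts′ (suc x) = carry suc (parts E x)
    realised′ : ∀ x {B} (p : lookup (var ∷ Γ) x ≡ B) →
        Pieces (Realises B (liftSub θ x)) (parts′ x) (get (t ∷ s) x p)
    realised′ zero    refl = Pieces-cell t
    realised′ (suc x) p    = Pieces-carry _ suc suc-injective (realised E x p)
    merge′ : Merge parts′ r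
    merge′ zero    = inj₂ (zero , r0 , λ { zero ≢ → contradiction refl ≢
                                         ; (suc x) _ → carry-fresh suc (parts E x) zero (λ _ ()) })
    merge′ (suc y) with merge E y
    ... | inj₁ (f , g) = inj₁ (trans (rs y) f , λ { zero → refl ; (suc x) → trans (image x) (g x) })
      where
      image : ∀ x → carry suc (parts E x) (suc y) ≡ parts E x y
      image x = carry-image suc suc-injective (parts E x) y
    ... | inj₂ (x , f , g) =
      inj₂ (suc x , trans (rs y) (trans f (sym (image x))) ,
            λ { zero _ → refl ; (suc x′) ≢ → trans (image x′) (g x′ (≢ ∘ cong suc)) })
      where
      image : ∀ x → carry suc (parts E x) (suc y) ≡ parts E x y
      image x = carry-image suc suc-injective (parts E x) y

  Runs-[] : {σ σ′ : Store n} {w : Word n} → (∀ i → w i ≡ []) → Runs σ w σ′ → σ ≡ σ′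
  Runs-[] e run = lookup-ext (λ i → Acts-[] (e i) (run i))

  mutual

    -- The fundamental lemma of the relation: actions on variables in `s` are replaced by the store
    -- actions with which the environment meets them.
    Den⇒Realises : {Γ : Cxt m} {θ : Fin m → Tm n} → ∀ {M s a w} →
                   Den Γ M A s a → Env θ s w → Realises A (subst θ M) w a
    Den⇒Realises (num refl) E σ σ′ run =
        transport (λ τ → σ ∣ _ ⇓ τ ∣ _) (Runs-[] (Env-ε E) run) (value (num _))
    Den⇒Realises (skip refl) E σ σ′ run =
        transport (λ τ → σ ∣ _ ⇓ τ ∣ _) (Runs-[] (Env-ε E) run) (value skip)
    Den⇒Realises (ident {i = i} p refl) E = Env-single i p E
    Den⇒Realises (arith {s = s} {t} refl refl d e) E σ σ′ run with Env-∙ s t E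
    ... | u , v , w≡ , E₁ , E₂ , _ with Runs-split σ σ′ w≡ run
    ...   | σ₁ , r₁ , r₂ = arith (Den⇒Realises d E₁ σ σ₁ r₁) (Den⇒Realises e E₂ σ₁ σ′ r₂)
    Den⇒Realises (seq {s = s} {t} β refl d e) E = base⇒ β λ σ σ′ run → lemma σ σ′ run
      where
      lemma : ∀ σ σ′ → Runs σ _ σ′ → Result _ σ _ σ′ _
      lemma σ σ′ run with Env-∙ s t E
      ... | u , v , w≡ , E₁ , E₂ , _ with Runs-split σ σ′ w≡ run
      ...   | σ₁ , r₁ , r₂ =
        Result-expand _ (seq (Den⇒Realises d E₁ σ σ₁ r₁)) (⇒base β (Den⇒Realises e E₂) σ₁ σ′ r₂)
    Den⇒Realises (assign {s = s} {t} refl d e) E σ σ′ run with Env-∙ s t E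
    ... | u , v , w≡ , E₁ , E₂ , _ with Runs-split σ σ′ w≡ run
    ...   | σ₁ , r₁ , r₂ with Den⇒Realises e E₂ σ₁ σ′ r₂
    ...     | x , σ₂ , z , refl = assign (Den⇒Realises d E₁ σ σ₁ r₁) z
    Den⇒Realises (deref d) E σ σ′ run with Den⇒Realises d E σ σ′ run
    ... | x , z , refl = deref z
    Den⇒Realises (stop a≢0 d) E σ σ′ run = stop (Den⇒Realises d E σ σ′ run) a≢0
    Den⇒Realises (loop {s = s} {t} {u} refl d e f) E σ σ′ run with Env-∙ s (t ∙ u) E
    ... | _ , _ , w≡ , E₁ , E₂₃ , _ with Env-∙ t u E₂₃ | Runs-split σ σ′ w≡ run
    ...   | _ , _ , v≡ , E₂ , E₃ , _ | σ₁ , r₁ , r₂₃ with Runs-split σ₁ σ′ v≡ r₂₃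
    ...     | σ₂ , r₂ , r₃ =
      loop (Den⇒Realises d E₁ σ σ₁ r₁) (Den⇒Realises e E₂ σ₁ σ₂ r₂) (Den⇒Realises f E₃ σ₂ σ′ r₃)
    Den⇒Realises (ifzero₁ {s = s} {t} β refl d e) E = base⇒ β λ σ σ′ run → lemma σ σ′ run
      where
      lemma : ∀ σ σ′ → Runs σ _ σ′ → Result _ σ _ σ′ _
      lemma σ σ′ run with Env-∙ s t E
      ... | u , v , w≡ , E₁ , E₂ , _ with Runs-split σ σ′ w≡ run
      ...   | σ₁ , r₁ , r₂ =
        Result-expand _ (ifzero₁ (Den⇒Realises d E₁ σ σ₁ r₁)) (⇒base β (Den⇒Realises e E₂) σ₁ σ′ r₂)
    Den⇒Realises (ifzero₂ {s = s} {t} β refl a≢0 d e) E = base⇒ β λ σ σ′ run → lemma σ σ′ run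
      where
      lemma : ∀ σ σ′ → Runs σ _ σ′ → Result _ σ _ σ′ _
      lemma σ σ′ run with Env-∙ s t E
      ... | u , v , w≡ , E₁ , E₂ , _ with Runs-split σ σ′ w≡ run
      ...   | σ₁ , r₁ , r₂ =
        Result-expand _ (ifzero₂ (Den⇒Realises d E₁ σ σ₁ r₁) a≢0) (⇒base β (Den⇒Realises e E₂) σ₁ σ′ r₂)
    Den⇒Realises {θ = θ} (lam {A = A} {B = B} {M = M} d) E ρ inj w′ c N v ps dis r e =
      Realises-expand B (beta A (rename (liftRen ρ) (subst (liftSub θ) M)) N)
        (transport (λ K → Realises B K r _) (sym (subst-extend ρ θ M N))
          (Den⇒Realises d (Env-extend E ρ inj c N ps dis e)))
    Den⇒Realises {θ = θ} (app {M = M} {N} {s = s} {t} refl s#t d ds) E with Env-∙ s t E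
    ... | u , v , w≡ , E₁ , E₂ , dis =
      transport (λ K → Realises _ (K · subst θ N) _ _) (rename-id (λ _ → refl) (subst θ M))
        -- No cell is allocated here, so the function is used at the identity renaming.
        (Den⇒Realises d E₁ (λ i → i) (λ e → e) u ((λ _ → refl) , λ j f → contradiction refl (f j))
          (subst θ N) v (Star⇒Pieces ds E₂) (dis s#t) _ w≡)
    Den⇒Realises {n = n} {θ = θ} {w = w} (new {M = M} {t = t} γ c d) E = ground γ (Den⇒Realises d E′)
      where
      r : Word (suc n)
      r zero    = t
      r (suc i) = w i
      E′ : Env (liftSub θ) (t ∷ _) r
      E′ = Env-new E t refl (λ _ → refl)
      -- A cell trace is a run from content 0; the content it ends with is the one discarded by the
      -- rule for `new`.
      run′ : ∀ {σ σ′} → Runs σ w σ′ → Runs (0 ∷ σ) r (proj₁ (Cell⇒Acts c) ∷ σ′)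
      run′ run zero    = proj₂ (Cell⇒Acts c)
      run′ run (suc i) = run i
      ground : ∀ {B b} → Ground B → Realises B (subst (liftSub θ) M) r b →
          Realises B (new (subst (liftSub θ) M)) w b
      ground nat  R σ σ′ run = new (R _ _ (run′ run))
      ground comm R σ σ′ run = new (R _ _ (run′ run))

    Star⇒Pieces : {Γ : Cxt m} {θ : Fin m → Tm n} → ∀ {M s as w} →
                  Star (Den Γ M A) s as → Env θ s w → Pieces (Realises A (subst θ M)) w as
    Star⇒Pieces [] E = [] (Env-ε E)
    Star⇒Pieces (_∷_ {t = s} {u = t} d ds) E with Env-∙ s t E
    ... | u , v , w≡ , E₁ , E₂ , _ = cut w≡ (Den⇒Realises d E₁) (Star⇒Pieces ds E₂)

  adequate : ∀ {M b} → Den [] M B [] b → Ground B → Result B [] M [] b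
  adequate {M = M} d γ = transport (λ K → Result _ [] K [] _) eq (ground γ (Den⇒Realises d E))
    where
    θ : Fin 0 → Tm 0
    θ ()
    E : Env {Γ = []} θ [] (λ ())
    E = env (λ ()) (λ ()) (λ ())
    eq : subst θ M ≡ M
    eq = trans (subst-idents {ρ = λ i → i} (λ ()) M) (rename-id (λ ()) M)
    ground : ∀ {B b P} → Ground B → Realises B P (λ ()) b → Result B [] P [] b
    ground nat  R = R [] [] (λ ())
    ground comm R = R [] [] (λ ())

  -- Determinism

  -- Coherence of histories: after a first difference two runs may diverge freely, and one may stop
  -- before the other, so prefixes are coherent.
  CohList : {X : Set} → (X → X → Set) → List X → List X → Set
  CohList R []      _       = ⊤
  CohList R (_ ∷ _) []      = ⊤
  CohList R (a ∷ s) (b ∷ t) = R a b × (a ≡ b → CohList R s t)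

  -- Coherence spaces: a variable answers every write, and reads of one value
  -- only; functions are cliques in the sense of linear logic. Terms being
  -- deterministic, their denotations are cliques.
  Coh : (A : Ty) → α A → α A → Set
  Coh nat     a         b         = a ≡ b
  Coh comm    _         _         = ⊤
  Coh var     (read a)  (read b)  = a ≡ b
  Coh var     (read _)  (write _) = ⊤
  Coh var     (write _) _         = ⊤
  Coh (A ⊸ B) (s , a)   (t , b)   = CohList (Coh A) s t → Coh B a b × (a ≡ b → s ≡ t)

  CohList-prefix : {X : Set} {R : X → X → Set} (s s′ : List X) {t t′ : List X} →
                   CohList R (s List.++ t) (s′ List.++ t′) → CohList R s s′
  CohList-prefix []      _        _       = tt
  CohList-prefix (_ ∷ _) []       _       = tt
  CohList-prefix (_ ∷ s) (_ ∷ s′) (c , f) = c , CohList-prefix s s′ ∘ f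

  CohList-cancel : {X : Set} {R : X → X → Set} (s : List X) {t t′ : List X} →
                   CohList R (s List.++ t) (s List.++ t′) → CohList R t t′
  CohList-cancel []      c       = c
  CohList-cancel (_ ∷ s) (_ , f) = CohList-cancel s (f refl)

  CohList-refl : {X : Set} {R : X → X → Set} → (∀ a → R a a) → ∀ s → CohList R s s
  CohList-refl R-refl []      = tt
  CohList-refl R-refl (a ∷ s) = R-refl a , λ _ → CohList-refl R-refl s

  Coh-refl : ∀ A a → Coh A a a
  Coh-refl nat     a         = refl
  Coh-refl comm    _         = tt
  Coh-refl var     (read _)  = refl
  Coh-refl var     (write _) = tt
  Coh-refl (A ⊸ B) (s , b) _ = Coh-refl B b , λ _ → refl

  infix 4 _≍_

  record _≍_ {Γ : Cxt n} (s t : Traces Γ) : Set where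
    constructor coherent
    field at : ∀ i {A} (p : lookup Γ i ≡ A) → CohList (Coh A) (get s i p) (get t i p)

  open _≍_

  ≍-∷ : {Γ : Cxt n} {s s′ : Traces Γ} {t t′ : List (α A)} → CohList (Coh A) t t′ → s ≍ s′ →
        _≍_ {Γ = A ∷ Γ} (t ∷ s) (t′ ∷ s′)
  ≍-∷ c _ .at zero    refl = c
  ≍-∷ _ c .at (suc i) p    = at c i p

  ≍-prefix : {Γ : Cxt n} (s s′ : Traces Γ) {t t′ : Traces Γ} → s ∙ t ≍ s′ ∙ t′ → s ≍ s′
  ≍-prefix s s′ {t} {t′} c .at i p = CohList-prefix (get s i p) (get s′ i p)
    (subst₂ (CohList _) (get-∙ s t i p) (get-∙ s′ t′ i p) (at c i p))

  ≍-cancel : {Γ : Cxt n} {s s′ : Traces Γ} → s ≡ s′ → {t t′ : Traces Γ} → s ∙ t ≍ s′ ∙ t′ → t ≍ t′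
  ≍-cancel {s = s} refl {t} {t′} c .at i p = CohList-cancel (get s i p)
    (subst₂ (CohList _) (get-∙ s t i p) (get-∙ s t′ i p) (at c i p))

  -- Suffixes of coherent traces need not be coherent in general. Here, where both `t` and `t′` act,
  -- `s` and `s′` do not, so the components compared are those of `t` and `t′` alone.
  ≍-right : {Γ : Cxt n} {s s′ t t′ : Traces Γ} → s # t → s′ # t′ → s ∙ t ≍ s′ ∙ t′ → t ≍ t′
  ≍-right {s = s} {s′} {t} {t′} d d′ c .at i p
    with get s i p | get t i p | get s′ i p | get t′ i p | d i p | d′ i p
       | subst₂ (CohList _) (get-∙ s t i p) (get-∙ s′ t′ i p) (at c i p)
  ... | _ | _ ∷ _ | _ | _ ∷ _ | inj₁ refl | inj₁ refl | e = e
  ... | _ | []    | _ | _     | _         | _         | _ = tt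
  ... | _ | _ ∷ _ | _ | []    | _         | _         | _ = tt

  Cell-coherent : ∀ {v s t} → Cell v s → Cell v t → CohList (Coh var) s t
  Cell-coherent []        _         = tt
  Cell-coherent (read _)  []        = tt
  Cell-coherent (write _) []        = tt
  Cell-coherent (read c)  (read d)  = refl , λ _ → Cell-coherent c d
  Cell-coherent (read _)  (write _) = tt , λ ()
  Cell-coherent (write _) (read _)  = tt , λ ()
  Cell-coherent (write c) (write d) = tt , λ { refl → Cell-coherent c d }

  mutual

    -- In sequential constructs the first subterm sees coherent prefixes; where its results agree
    -- its traces do, and cancelling them leaves coherent traces for the second. In an application
    -- the clique conditions of function and argument compose as in linear logic.
    deterministic : {Γ : Cxt n} → ∀ {M s s′ a a′} → Γ ⊩ M ∶ A → Den Γ M A s a → Den Γ M A s′ a′ →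
        s ≍ s′ →
                    Coh A a a′ × (a ≡ a′ → s ≡ s′)
    deterministic d (num refl) (num refl) c = refl , λ _ → refl
    deterministic d (skip refl) (skip refl) c = tt , λ _ → refl
    deterministic {Γ = Γ} d (ident {i = i} refl refl) (ident refl refl) c =
      proj₁ (subst₂ (CohList _) (get-single Γ i refl refl _) (get-single Γ i refl refl _)
          (at c i refl)) ,
      λ { refl → refl }
    deterministic (arith d e) (arith {s = s} {t} refl refl x y) (arith {s = s′} {t′} refl refl x′ y′) c
      with deterministic d x x′ (≍-prefix s s′ c)
    ... | refl , f with f refl
    ...   | refl with deterministic e y y′ (≍-cancel {s = s} refl c)
    ...     | refl , g = refl , λ _ → cong (s ∙_) (g refl)
    deterministic (seq _ d e) (seq {s = s} _ refl x y) (seq {s = s′} _ refl x′ y′) c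
      with proj₂ (deterministic d x x′ (≍-prefix s s′ c)) refl
    ... | refl with deterministic e y y′ (≍-cancel {s = s} refl c)
    ...   | h , g = h , λ q → cong (s ∙_) (g q)
    deterministic (assign d e) (assign {s = s} refl x y) (assign {s = s′} refl x′ y′) c
      with deterministic e x x′ (≍-prefix s s′ c)
    ... | refl , f with f refl
    ...   | refl with deterministic d y y′ (≍-cancel {s = s} refl c)
    ...     | _ , g = tt , λ _ → cong (s ∙_) (g refl)
    deterministic (deref d) (deref x) (deref x′) c with deterministic d x x′ c
    ... | h , f = h , λ { refl → f refl }
    deterministic (while d e) (stop _ x) (stop _ x′) c with deterministic d x x′ c
    ... | refl , f = tt , λ _ → f refl
    deterministic (while d e) (stop {s = s} a≢0 x) (loop {s = s′} refl x′ y′ z′) c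
      -- With an empty rest appended, the final guard of one run is compared with the first guard of
      -- the other.
      with deterministic d x x′ (≍-prefix s s′ (transport (_≍ _) (sym (∙-identityʳ s)) c))
    ... | refl , _ = contradiction refl a≢0
    deterministic (while d e) (loop {s = s} refl x y z) (stop {s = s′} a≢0 x′) c
      with deterministic d x x′ (≍-prefix s s′ (transport (_ ≍_) (sym (∙-identityʳ s′)) c))
    ... | refl , _ = contradiction refl a≢0
    deterministic (while d e) (loop {s = s} {t} refl x y z) (loop {s = s′} {t′} refl x′ y′ z′) c
      with proj₂ (deterministic d x x′ (≍-prefix s s′ c)) refl
    ... | refl with ≍-cancel {s = s} refl c
    ...   | c₂ with proj₂ (deterministic e y y′ (≍-prefix t t′ c₂)) refl
    ...     | refl =
      tt , λ _ → cong (λ u → s ∙ (t ∙ u))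
          (proj₂ (deterministic (while d e) z z′ (≍-cancel {s = t} refl c₂)) refl)
    deterministic (ifzero _ d e _) (ifzero₁ {s = s} _ refl x y) (ifzero₁ {s = s′} _ refl x′ y′) c
      with proj₂ (deterministic d x x′ (≍-prefix s s′ c)) refl
    ... | refl with deterministic e y y′ (≍-cancel {s = s} refl c)
    ...   | h , g = h , λ q → cong (s ∙_) (g q)
    deterministic (ifzero _ d _ _) (ifzero₁ {s = s} _ refl x y) (ifzero₂ {s = s′} _ refl a≢0 x′ y′) c
      with deterministic d x x′ (≍-prefix s s′ c)
    ... | refl , _ = contradiction refl a≢0
    deterministic (ifzero _ d _ _) (ifzero₂ {s = s} _ refl a≢0 x y) (ifzero₁ {s = s′} _ refl x′ y′) c
      with deterministic d x x′ (≍-prefix s s′ c)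
    ... | refl , _ = contradiction refl a≢0
    deterministic (ifzero _ d _ e) (ifzero₂ {s = s} _ refl _ x y) (ifzero₂ {s = s′} _ refl _ x′ y′) c
      with deterministic d x x′ (≍-prefix s s′ c)
    ... | refl , f with f refl
    ...   | refl with deterministic e y y′ (≍-cancel {s = s} refl c)
    ...     | h , g = h , λ q → cong (s ∙_) (g q)
    deterministic (lam d) (lam x) (lam x′) c =
        -- Equal actions contain the same argument trace, which is coherent with itself.
        lemma , λ { refl → cong tail
        (proj₂ (deterministic d x x′ (≍-∷ (CohList-refl (Coh-refl _) _) c)) refl) }
      where
      lemma = λ c′ → case deterministic d x x′ (≍-∷ c′ c) of λ (h , f) → h , λ q → cong head (f q)
    deterministic (app _ d e) (app {s = s} {t} refl s#t x xs) (app {s = s′} {t′} refl s′#t′ x′ xs′) c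
      with Den-type d x | Den-type d x′
    ... | refl | refl with deterministic d x x′ (≍-prefix s s′ c)
        | deterministic-Star e xs xs′ (≍-right s#t s′#t′ c)
    ...   | h , f | k , g with h k
    ...     | h₁ , h₂ = h₁ , λ q → cong₂ _∙_ (f (cong₂ _,_ (h₂ q) q)) (g (h₂ q))
    deterministic (new _ d) (new _ k x) (new _ k′ x′) c
        with deterministic d x x′ (≍-∷ (Cell-coherent k k′) c)
    ... | h , f = h , λ q → cong tail (f q)

    deterministic-Star : {Γ : Cxt n} → ∀ {M s s′ as as′} → Γ ⊩ M ∶ A → Star (Den Γ M A) s as →
        Star (Den Γ M A) s′ as′ →
                         s ≍ s′ → CohList (Coh A) as as′ × (as ≡ as′ → s ≡ s′)
    deterministic-Star d [] [] c = tt , λ _ → refl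
    deterministic-Star d [] (_ ∷ _) c = tt , λ ()
    deterministic-Star d (_ ∷ _) [] c = tt , λ ()
    deterministic-Star d (_∷_ {t = s} x xs) (_∷_ {t = s′} x′ xs′) c
      with deterministic d x x′ (≍-prefix s s′ c)
    ... | h , f = (h , λ q → proj₁ (deterministic-Star d xs xs′ (≍-cancel (f q) c))) ,
      λ q → cong₂ _∙_ (f (∷-injectiveˡ q))
              (proj₂ (deterministic-Star d xs xs′ (≍-cancel (f (∷-injectiveˡ q)) c)) (∷-injectiveʳ q))

  -- The order of acceptance

  -- Passes A a′ a: the trace a′ is accepted by the test for a below; dually,
  -- Supplied A a′ a: the argument emulating a may exhibit a′. A cell holding n
  -- cannot tell whether n has been read from it or written to it, so
  -- acceptance is only a partial order; determinism restores equality.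
  mutual

    Passes : (A : Ty) → α A → α A → Set
    Passes nat     a′        a         = a′ ≤ a
    Passes comm    _         _         = ⊤
    Passes var     (read a′)  (read a)  = a′ ≤ a
    Passes var     (write a′) (write a) = a′ ≡ a
    Passes var     _          _         = ⊥
    Passes (A ⊸ B) (t′ , b′)  (t , b)   = Pointwise (Supplied A) t′ t × Passes B b′ b

    Supplied : (A : Ty) → α A → α A → Set
    Supplied nat     a′         a         = a′ ≡ a
    Supplied comm    _          _         = ⊤
    Supplied var     (read a′)  (read a)  = a′ ≡ a
    Supplied var     (write a′) (read a)  = a′ ≤ a
    Supplied var     (write a′) (write a) = a′ ≤ a
    Supplied var     (read _)   (write _) = ⊥
    Supplied (A ⊸ B) (r′ , b′)  (r , b)   = Pointwise (Passes A) r′ r × Supplied B b′ b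

  mutual

    Passes-trans : ∀ A {a b c} → Passes A a b → Passes A b c → Passes A a c
    Passes-trans nat     p q = ≤-trans p q
    Passes-trans comm    p q = tt
    Passes-trans var {read _}  {read _}  {read _}  p q = ≤-trans p q
    Passes-trans var {write _} {write _} {write _} p q = trans p q
    Passes-trans (A ⊸ B) (p , p′) (q , q′) =
      Pointwise.transitive (Supplied-trans A) p q , Passes-trans B p′ q′

    Supplied-trans : ∀ A {a b c} → Supplied A a b → Supplied A b c → Supplied A a c
    Supplied-trans nat     p q = trans p q
    Supplied-trans comm    p q = tt
    Supplied-trans var {read _}  {read _}  {read _}  p q = trans p q
    Supplied-trans var {write _} {read _}  {read _}  p refl = p
    Supplied-trans var {write _} {write _} {read _}  p q = ≤-trans p q
    Supplied-trans var {write _} {write _} {write _} p q = ≤-trans p q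
    Supplied-trans (A ⊸ B) (p , p′) (q , q′) =
      Pointwise.transitive (Passes-trans A) p q , Supplied-trans B p′ q′

  Pointwise-antisym : {X : Set} {R : X → X → Set} → (∀ {a b} → R a b → R b a → a ≡ b) →
                      ∀ {s t} → Pointwise R s t → Pointwise R t s → s ≡ t
  Pointwise-antisym f []       []       = refl
  Pointwise-antisym f (p ∷ ps) (q ∷ qs) = cong₂ _∷_ (f p q) (Pointwise-antisym f ps qs)

  mutual

    Passes-antisym : ∀ A {a b} → Passes A a b → Passes A b a → a ≡ b
    Passes-antisym nat     p q = ≤-antisym p q
    Passes-antisym comm    p q = refl
    Passes-antisym var {read _}  {read _}  p q = cong read (≤-antisym p q)
    Passes-antisym var {write _} {write _} p q = cong write p
    Passes-antisym (A ⊸ B) (p , p′) (q , q′) =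
      cong₂ _,_ (Pointwise-antisym (Supplied-antisym A) p q) (Passes-antisym B p′ q′)

    -- At `var` a `write` may be supplied for a `read` but never the reverse, so actions of
    -- different kinds cannot replace each other both ways.
    Supplied-antisym : ∀ A {a b} → Supplied A a b → Supplied A b a → a ≡ b
    Supplied-antisym nat     p q = p
    Supplied-antisym comm    p q = refl
    Supplied-antisym var {read _}  {read _}  p q = cong read p
    Supplied-antisym var {write _} {write _} p q = cong write (≤-antisym p q)
    Supplied-antisym (A ⊸ B) (p , p′) (q , q′) =
      cong₂ _,_ (Pointwise-antisym (Passes-antisym A) p q) (Supplied-antisym B p′ q′)

  Pointwise-Coh : {X : Set} {R S : X → X → Set} → (∀ {a b} → R a b → S a b) →
                  ∀ {s t} → Pointwise R s t → CohList S s t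
  Pointwise-Coh f []       = tt
  Pointwise-Coh f (p ∷ ps) = f p , λ _ → Pointwise-Coh f ps

  Pointwise-≡ : {X : Set} {R S : X → X → Set} → (∀ {a b} → R a b → S a b → a ≡ b) →
                ∀ {s t} → Pointwise R s t → CohList S s t → s ≡ t
  Pointwise-≡ f []       _        = refl
  Pointwise-≡ f (p ∷ ps) (c , cs) = cong₂ _∷_ (f p c) (Pointwise-≡ f ps (cs (f p c)))

  mutual

    -- Passing and supplying exchange roles at arguments, hence the joint induction. For a function,
    -- supplied arguments are coherent, so the clique condition makes the results coherent; by
    -- induction these are equal, and then the converse half of `Coh` makes the arguments equal.
    Passes-Coh-≡ : ∀ A {a b} → Passes A a b → Coh A a b → a ≡ b
    Passes-Coh-≡ nat     p c = c
    Passes-Coh-≡ comm    p c = refl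
    Passes-Coh-≡ var {read _}  {read _}  p c = cong read c
    Passes-Coh-≡ var {write _} {write _} p c = cong write p
    Passes-Coh-≡ (A ⊸ B) (p , q) c with c (Pointwise-Coh (Supplied⇒Coh A) p)
    ... | h , f with Passes-Coh-≡ B q h
    ...   | refl = cong (_, _) (f refl)

    Supplied⇒Coh : ∀ A {a b} → Supplied A a b → Coh A a b
    Supplied⇒Coh nat     p = p
    Supplied⇒Coh comm    p = tt
    Supplied⇒Coh var {read _}  {read _}  p = p
    Supplied⇒Coh var {write _} {read _}  p = tt
    Supplied⇒Coh var {write _} {write _} p = tt
    Supplied⇒Coh (A ⊸ B) (p , q) c = Supplied⇒Coh B q , λ _ → Pointwise-≡ (Passes-Coh-≡ A) p c

  -- Typing under embeddings.

  private

    ⊢-cast : {Γ Θ : Cxt n} {M N : Tm n} → Γ ≡ Θ → M ≡ N → Γ ⊢ M ∶ A → Θ ⊢ N ∶ A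
    ⊢-cast refl refl d = d

    insert-⊢ : (Θ : Cxt (suc n)) (j : Fin (suc n)) {M : Tm n} →
               tabulate (λ i → lookup Θ (punchIn j i)) ⊢ M ∶ A → Θ ⊢ rename (punchIn j) M ∶ A
    insert-⊢ {n = n} Θ j {M} d =
      ⊢-cast Ξ≡ (rename-rename (insert-punchIn zero j id) M) (exchange π (weak {A = lookup Θ j} d))
      where
      π : Permutation′ (suc n)
      π = insert zero j id
      Ξ : Cxt (suc n)
      Ξ = lookup Θ j ∷ tabulate (λ i → lookup Θ (punchIn j i))
      image : ∀ k → lookup Ξ k ≡ lookup Θ (π ⟨$⟩ʳ k)
      image zero    = refl
      image (suc k) = trans (lookup∘tabulate _ k) (cong (lookup Θ) (sym (insert-punchIn zero j id k)))
      Ξ≡ : permute π Ξ ≡ Θ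
      Ξ≡ = trans (tabulate-cong (λ i → trans (image (π ⟨$⟩ˡ i)) (cong (lookup Θ) (inverseʳ π))))
          (tabulate∘lookup Θ)

  -- Embeddings are composites of weakenings and exchanges. An identifier of `Θ` outside the image
  -- is removed and put back by weakening; if there is none, the embedding is a permutation.
  embed-⊢ : ∀ {n} {Γ : Cxt m} {Θ : Cxt n} (φ : Emb Γ Θ) {M} → Γ ⊢ M ∶ A → Θ ⊢ rename (fun φ) M ∶ A
  embed-⊢ {n = n} φ d with any? (λ j → ¬? (any? (λ i → fun φ i ≟ j)))
  embed-⊢ {m = m} {n = suc n} {Γ} {Θ} φ {M} d | yes (j , fresh) =
    ⊢-cast refl (rename-rename (λ i → punchIn-punchOut (j≢ i)) M) (insert-⊢ Θ j (embed-⊢ φ′ d))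
    where
    j≢ : ∀ i → j ≢ fun φ i
    j≢ i e = fresh (i , sym e)
    φ′ : Emb Γ (tabulate (λ i → lookup Θ (punchIn j i)))
    φ′ .fun i = punchOut (j≢ i)
    φ′ .injective e = injective φ (punchOut-injective (j≢ _) (j≢ _) e)
    φ′ .typed i = trans (lookup∘tabulate _ (punchOut (j≢ i)))
      (trans (cong (lookup Θ) (punchIn-punchOut (j≢ i))) (typed φ i))
  -- The bijection forces `m ≡ n`; generalising over the permutation lets this equation be matched.
  embed-⊢ {m = m} {n = n} {Γ} {Θ} φ {M} d | no onto = go (↔⇒≡ π₀) π₀ (λ _ → refl)
    where
    preimage : ∀ j → ∃[ i ] fun φ i ≡ j
    preimage j = decidable-stable (any? (λ i → fun φ i ≟ j)) (λ f → onto (j , f))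
    π₀ : Permutation m n
    π₀ = permutation (fun φ) (proj₁ ∘ preimage) (λ j → proj₂ (preimage j))
           (λ i → injective φ (proj₂ (preimage (fun φ i))))
    go : m ≡ n → (π : Permutation m n) → (∀ i → π ⟨$⟩ʳ i ≡ fun φ i) → Θ ⊢ rename (fun φ) M ∶ _
    go refl π e = ⊢-cast Γ≡ (trans (sym (rename-id (λ _ → refl) _)) (rename-rename e M)) (exchange π d)
      where
      Γ≡ : permute π Γ ≡ Θ
      Γ≡ = trans (tabulate-cong
          (λ i → trans (sym (typed φ _)) (cong (lookup Θ) (trans (sym (e _)) (inverseʳ π)))))
                 (tabulate∘lookup Θ)

  ident-⊢ : (Γ : Cxt n) (i : Fin n) → lookup Γ i ≡ A → Γ ⊢ ident i ∶ A
  ident-⊢ {A = A} Γ i p = embed-⊢ φ axiom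
    where
    φ : Emb (A ∷ []) Γ
    φ .fun _ = i
    φ .injective {zero} {zero} _ = refl
    φ .typed zero = p

  emptyEmb : (Γ : Cxt n) → Emb [] Γ
  emptyEmb Γ .fun ()
  emptyEmb Γ .injective {()}
  emptyEmb Γ .typed ()

  num-⊢ : (Γ : Cxt n) → ∀ a → Γ ⊢ num a ∶ nat
  num-⊢ Γ a = embed-⊢ (emptyEmb Γ) numeral

  skip-⊢ : (Γ : Cxt n) → Γ ⊢ skip ∶ comm
  skip-⊢ Γ = embed-⊢ (emptyEmb Γ) skip

  -- Tests

  -- Loops continue on guard 0, so this one diverges.
  Ω : Tm n
  Ω = while (num 0) skip

  infixl 6 _⊝_

  _⊝_ : Tm n → Tm n → Tm n
  M ⊝ N = M ⟨ minus ⟩ N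

  -- Applied to `M ⊝ N` it accepts if the first number is at most the second, evaluating each once.
  -- This is the source of `≤` in `Passes` and `Supplied`.
  assertZero : Tm n → Tm n
  assertZero M = ifzero M skip Ω

  cell : ∀ k → Fin 2 → Tm (k + 2)
  cell k j = ident (k ↑ʳ j)

  default : ∀ A → α A
  default nat     = 0
  default comm    = tt
  default var     = read 0
  default (A ⊸ B) = [] , default B

  -- `suc a` is the least content refused by a later check against `a`, so that omitting a required
  -- `write a` is noticed. For `read a` both values are `a`: the value is on offer, and a larger
  -- content left behind is refused.
  pre post : ∀ A → α A → ℕ
  pre nat     _         = 0
  pre comm    _         = 0
  pre var     (read a)  = a
  pre var     (write a) = suc a
  pre (A ⊸ B) (_ , b)   = pre B b
  post nat     _         = 0
  post comm    _         = 0
  post var     (read a)  = a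
  post var     (write a) = a
  post (A ⊸ B) (_ , b)   = post B b

  finalPost : ∀ A → ℕ → List (α A) → ℕ
  finalPost A p []      = p
  finalPost A p (a ∷ t) = finalPost A (post A a) t

  -- The emulation of t uses two cells. Cell 1 counts the elements of t supplied
  -- so far; cell 0 is the variable handed out when the elements of t end in an
  -- action on a variable. Before an action its content is set to pre, so that a
  -- write n has to change it; at the next call it is checked to be at most post.
  prepare : ℕ → ℕ → ℕ → Tm 2
  prepare i p q = assertZero (! cell 0 zero ⊝ num p) ⨾ cell 0 (suc zero) := num
      (suc i) ⨾ cell 0 zero := num q

  script : ∀ A → ℕ → ℕ → List (α A) → List (Tm 2 × α A)
  script A i p []      = []
  script A i p (a ∷ t) = (prepare i p (pre A a) , a) ∷ script A (suc i) (post A a) t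

  -- Calls beyond the script diverge, so a counter of at least the length of `t` means that `t` has
  -- been used exactly.
  check : ∀ A → List (α A) → Tm 2
  check A t = assertZero (num (List.length t) ⊝ ! cell 0 (suc zero)) ⨾ assertZero
      (! cell 0 zero ⊝ num (finalPost A 0 t))

  result : ∀ k A → α A → Tm (k + 2)
  result k nat     a = num a
  result k comm    _ = skip
  result k var     _ = cell k zero
  result k (A ⊸ B) _ = skip

  -- The guard tests only whether the counter is at most `i`; entries are tried in increasing order,
  -- so the first success means equality. The default result after `Ω` supplies the type.
  dispatch : ∀ k A → ℕ → List (Tm (k + 2) × α A) → Tm (k + 2)
  dispatch k A i []            = Ω ⨾ result k A (default A)
  dispatch k A i ((N , a) ∷ L) =
    ifzero (! cell k (suc zero) ⊝ num i) (N ⨾ result k A a) (dispatch k A (suc i) L)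

  mutual

    test : ∀ A → α A → Tm n → Tm n
    test nat     a         N = assertZero (N ⊝ num a)
    test comm    _         N = N
    test var     (read a)  N = assertZero (! N ⊝ num a)
    test var     (write a) N = N := num a
    test {n} (A ⊸ B) (t , b) N =
      -- Fresh cells hold 0, hence the initial counter 0 and bound 0. The emulation mentions only
      -- its own two cells, so `N` may be applied to it.
      new (new (test B b (rename (2 ↑ʳ_) N · rename (_↑ˡ n) (emulate 0 A (script A 0 0 t))) ⨾
                rename (_↑ˡ n) (check A t)))

    tests : ∀ A → List (α A) → Tm n → Tm n
    tests A []      N = skip
    tests A (a ∷ s) N = test A a N ⨾ tests A s N

    -- Nothing is executed before a base type is reached. So the commands of the script travel under
    -- the abstractions, and each collects on the way the tests for the argument traces of its
    -- element.
    emulate : ∀ k A → List (Tm (k + 2) × α A) → Tm (k + 2)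
    emulate k nat     L = dispatch k nat 0 L
    emulate k comm    L = dispatch k comm 0 L
    emulate k var     L = dispatch k var 0 L
    emulate k (A ⊸ B) L = ƛ A (emulate (suc k) B (List.map (curry-step k A B) L))

    curry-step : ∀ k A B → Tm (k + 2) × α (A ⊸ B) → Tm (suc k + 2) × α B
    curry-step k A B (N , s , b) = (weaken N ⨾ tests A s (ident zero)) , b

  Ω-⊢ : (Γ : Cxt n) → Γ ⊢ Ω ∶ comm
  Ω-⊢ Γ = while (num-⊢ Γ 0) (skip-⊢ Γ)

  assertZero-⊢ : {Γ : Cxt n} {M : Tm n} → Γ ⊢ M ∶ nat → Γ ⊢ assertZero M ∶ comm
  assertZero-⊢ {Γ = Γ} d = ifzero comm d (skip-⊢ Γ) (Ω-⊢ Γ)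

  cell-⊢ : (Ys : Cxt k) (j : Fin 2) → Ys ++ vars 2 ⊢ cell k j ∶ var
  cell-⊢ {k} Ys j = ident-⊢ (Ys ++ vars 2) (k ↑ʳ j) (trans (lookup-++ʳ Ys (vars 2) j) (vars-lookup j))

  prepare-⊢ : ∀ i p q → vars 2 ⊢ prepare i p q ∶ comm
  prepare-⊢ i p q = seq comm (assertZero-⊢ (arith (deref (cell-⊢ [] zero)) (num-⊢ _ p)))
    (seq comm (assign (cell-⊢ [] (suc zero)) (num-⊢ _ (suc i))) (assign (cell-⊢ [] zero) (num-⊢ _ q)))

  script-⊢ : ∀ A i p t → ListAll (λ (N , _) → vars 2 ⊢ N ∶ comm) (script A i p t)
  script-⊢ A i p []      = []
  script-⊢ A i p (a ∷ t) = prepare-⊢ i p (pre A a) ∷ script-⊢ A (suc i) (post A a) t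

  check-⊢ : ∀ A t → vars 2 ⊢ check A t ∶ comm
  check-⊢ A t = seq comm (assertZero-⊢ (arith (num-⊢ _ _) (deref (cell-⊢ [] (suc zero)))))
    (assertZero-⊢ (arith (deref (cell-⊢ [] zero)) (num-⊢ _ _)))

  result-⊢ : (Ys : Cxt k) → Base A → ∀ a → Ys ++ vars 2 ⊢ result k A a ∶ A
  result-⊢ Ys nat  a = num-⊢ _ a
  result-⊢ Ys comm a = skip-⊢ _
  result-⊢ Ys var  a = cell-⊢ Ys zero

  dispatch-⊢ : (Ys : Cxt k) → Base A → ∀ i {L} → ListAll (λ (N , _) → Ys ++ vars 2 ⊢ N ∶ comm) L →
               Ys ++ vars 2 ⊢ dispatch k A i L ∶ A
  dispatch-⊢ {A = A} Ys β i []       = seq β (Ω-⊢ _) (result-⊢ Ys β (default A))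
  dispatch-⊢ Ys β i (d ∷ ds) =
    ifzero β (arith (deref (cell-⊢ Ys (suc zero))) (num-⊢ _ i)) (seq β d (result-⊢ Ys β _))
        (dispatch-⊢ Ys β (suc i) ds)

  mutual

    test-⊢ : ∀ A a {Γ : Cxt n} {N} → Γ ⊢ N ∶ A → Γ ⊢ test A a N ∶ comm
    test-⊢ nat     a         d = assertZero-⊢ (arith d (num-⊢ _ a))
    test-⊢ comm    a         d = d
    test-⊢ var     (read a)  d = assertZero-⊢ (arith (deref d) (num-⊢ _ a))
    test-⊢ var     (write a) d = assign d (num-⊢ _ a)
    test-⊢ (A ⊸ B) (t , b) {Γ} d =
      new comm (new comm (seq comm (test-⊢ B b (probe-⊢ A t d))
          (embed-⊢ (leftEmb (vars 2) Γ) (check-⊢ A t))))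

    probe-⊢ : ∀ A t {Γ : Cxt n} {N} → Γ ⊢ N ∶ A ⊸ B →
              vars 2 ++ Γ ⊢ rename (2 ↑ʳ_) N · rename (_↑ˡ n) (emulate 0 A (script A 0 0 t)) ∶ B
    probe-⊢ A t d = app d (emulate-⊢ [] A (script-⊢ A 0 0 t))

    tests-⊢ : ∀ A s {Γ : Cxt n} {N} → Γ ⊢ N ∶ A → Γ ⊢ tests A s N ∶ comm
    tests-⊢ A []      d = skip-⊢ _
    tests-⊢ A (a ∷ s) d = seq comm (test-⊢ A a d) (tests-⊢ A s d)

    emulate-⊢ : (Ys : Cxt k) → ∀ A {L} → ListAll (λ (N , _) → Ys ++ vars 2 ⊢ N ∶ comm) L →
                Ys ++ vars 2 ⊢ emulate k A L ∶ A
    emulate-⊢ Ys nat     ds = dispatch-⊢ Ys nat 0 ds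
    emulate-⊢ Ys comm    ds = dispatch-⊢ Ys comm 0 ds
    emulate-⊢ Ys var     ds = dispatch-⊢ Ys var 0 ds
    emulate-⊢ {k} Ys (A ⊸ B) ds = lam (emulate-⊢ (A ∷ Ys) B (curry-⊢ ds))
      where
      curry-⊢ : ∀ {L} → ListAll (λ (N , _) → Ys ++ vars 2 ⊢ N ∶ comm) L →
                ListAll (λ (N , _) → A ∷ (Ys ++ vars 2) ⊢ N ∶ comm) (List.map (curry-step k A B) L)
      curry-⊢ []       = []
      curry-⊢ (_∷_ {N , s , b} d ds) =
          seq comm (weak d) (tests-⊢ A s (ident-⊢ _ zero refl)) ∷ curry-⊢ ds

  -- Runs of the two cells of an emulation

  ++⁺-split : (Δ : Cxt m) {Γ : Cxt n} (r : Traces (Δ ++ Γ)) →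
      ∃[ u ] ∃[ w ] r ≡ ++⁺ {xs = Δ} {ys = Γ} u w
  ++⁺-split []      r       = [] , r , refl
  ++⁺-split (_ ∷ Δ) (t ∷ r) = case ++⁺-split Δ r of λ (u , w , e) → t ∷ u , w , cong (t ∷_) e

  ++⁺-injective : {Δ : Cxt m} {Γ : Cxt n} (u u′ : Traces Δ) {w w′ : Traces Γ} →
                  ++⁺ u w ≡ ++⁺ u′ w′ → u ≡ u′ × w ≡ w′
  ++⁺-injective []      []       e = refl , e
  ++⁺-injective (_ ∷ u) (_ ∷ u′) e with ++⁺-injective u u′ (cong tail e)
  ... | e₁ , e₂ = cong₂ _∷_ (cong head e) e₁ , e₂

  ++⁺-∙⁻ : {Δ : Cxt m} {Γ : Cxt n} (u : Traces Δ) (w : Traces Γ) {r r′ : Traces (Δ ++ Γ)} →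
      ++⁺ u w ≡ r ∙ r′ →
           ∃[ u₁ ] ∃[ w₁ ] ∃[ u₂ ] ∃[ w₂ ] r ≡ ++⁺ {xs = Δ} u₁ w₁ × r′ ≡ ++⁺ {xs = Δ} u₂ w₂ ×
               u ≡ u₁ ∙ u₂ × w ≡ w₁ ∙ w₂
  ++⁺-∙⁻ {Δ = Δ} u w {r} {r′} e with ++⁺-split Δ r | ++⁺-split Δ r′
  ... | u₁ , w₁ , refl | u₂ , w₂ , refl with ++⁺-injective u (u₁ ∙ u₂) (trans e (++⁺-∙ u₁ u₂ w₁ w₂))
  ...   | eu , ew = u₁ , w₁ , u₂ , w₂ , refl , refl , eu , ew

  ++⁺-ε : (Δ : Cxt m) {Γ : Cxt n} → ++⁺ (ε {Γ = Δ}) (ε {Γ = Γ}) ≡ ε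
  ++⁺-ε []      = refl
  ++⁺-ε (_ ∷ Δ) = cong ([] ∷_) (++⁺-ε Δ)

  -- The actions on the two cells are executed from `σ` to `σ′` and hidden; only the trace on `Ys`
  -- stays visible. Introduction rules and inversions (`⁻`) for the constructs of tests follow, as
  -- in a program logic for exact executions.
  data Run {k} {Ys : Cxt k} (M : Tm (k + 2)) (A : Ty) (σ : Store 2) (u : Traces Ys) (a : α A)
      (σ′ : Store 2) : Set where
    run : ∀ {w} → Steps σ w σ′ → Den (Ys ++ vars 2) M A (++⁺ u w) a → Run M A σ u a σ′

  private
    variable
      σ σ′ σ″ : Store 2
      Ys : Cxt k

  Run-cong : ∀ {M a} {u u′ : Traces Ys} → u ≡ u′ → Run M A σ u a σ′ → Run M A σ u′ a σ′
  Run-cong refl r = r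

  Run-result : ∀ {M a a′} {u : Traces Ys} → a ≡ a′ → Run M A σ u a σ′ → Run M A σ u a′ σ′
  Run-result refl r = r

  Run-seq : ∀ {M N} {u v : Traces Ys} {b} → Base B → Run M comm σ u tt σ′ → Run N B σ′ v b σ″ →
            Run (M ⨾ N) B σ (u ∙ v) b σ″
  Run-seq {u = u} {v} β (run {w} x d) (run {w′} y e) =
      run (Steps-∙ x y) (seq β (sym (++⁺-∙ u v w w′)) d e)

  Run-seq⁻ : ∀ {M N} {r : Traces Ys} {b} → Run (M ⨾ N) B σ r b σ″ →
             ∃[ u ] ∃[ v ] ∃[ σ′ ] r ≡ u ∙ v × Run M comm σ u tt σ′ × Run N B σ′ v b σ″
  Run-seq⁻ {r = r} (run {w} x (seq β e d d′)) with ++⁺-∙⁻ r w e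
  ... | u , w₁ , v , w₂ , refl , refl , er , refl with Steps-split w₁ x
  ...   | σ₁ , x₁ , x₂ = u , v , σ₁ , er , run x₁ d , run x₂ d′

  Run-ifzero₁ : ∀ {M N N′} {u v : Traces Ys} {b} → Base B → Run M nat σ u 0 σ′ → Run N B σ′ v b σ″ →
                Run (ifzero M N N′) B σ (u ∙ v) b σ″
  Run-ifzero₁ {u = u} {v} β (run {w} x d) (run {w′} y e) =
      run (Steps-∙ x y) (ifzero₁ β (sym (++⁺-∙ u v w w′)) d e)

  Run-ifzero₂ : ∀ {M N N′} {u v : Traces Ys} {a b} → Base B → a ≢ 0 → Run M nat σ u a σ′ →
      Run N′ B σ′ v b σ″ →
                Run (ifzero M N N′) B σ (u ∙ v) b σ″
  Run-ifzero₂ {u = u} {v} β a≢0 (run {w} x d) (run {w′} y e) =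
    run (Steps-∙ x y) (ifzero₂ β (sym (++⁺-∙ u v w w′)) a≢0 d e)

  Run-ifzero⁻ : ∀ {M N N′} {r : Traces Ys} {b} → Run (ifzero M N N′) B σ r b σ″ →
                ∃[ u ] ∃[ v ] ∃[ a ] ∃[ σ′ ] r ≡ u ∙ v × Run M nat σ u a σ′ ×
                ((a ≡ 0 × Run N B σ′ v b σ″) ⊎ (a ≢ 0 × Run N′ B σ′ v b σ″))
  Run-ifzero⁻ {r = r} (run {w} x (ifzero₁ β e d d′)) with ++⁺-∙⁻ r w e
  ... | u , w₁ , v , w₂ , refl , refl , er , refl with Steps-split w₁ x
  ...   | σ₁ , x₁ , x₂ = u , v , 0 , σ₁ , er , run x₁ d , inj₁ (refl , run x₂ d′)
  Run-ifzero⁻ {r = r} (run {w} x (ifzero₂ β e a≢0 d d′)) with ++⁺-∙⁻ r w e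
  ... | u , w₁ , v , w₂ , refl , refl , er , refl with Steps-split w₁ x
  ...   | σ₁ , x₁ , x₂ = u , v , _ , σ₁ , er , run x₁ d , inj₂ (a≢0 , run x₂ d′)

  Steps-ε⁻ : {τ τ′ : Store n} → Steps τ ε τ′ → τ ≡ τ′
  Steps-ε⁻ {τ = []}    []       = refl
  Steps-ε⁻ {τ = _ ∷ _} ([] ∷ s) = cong (_ ∷_) (Steps-ε⁻ s)

  Run-num : ∀ a → Run {Ys = Ys} (num a) nat σ ε a σ
  Run-num {Ys = Ys} a = run (Steps-ε _) (num (++⁺-ε Ys))

  Run-num⁻ : ∀ {a b} {u : Traces Ys} → Run (num a) nat σ u b σ′ → u ≡ ε × b ≡ a × σ ≡ σ′
  Run-num⁻ {Ys = Ys} {u = u} (run x (num e)) with ++⁺-injective u ε (trans e (sym (++⁺-ε Ys)))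
  ... | refl , refl = refl , refl , Steps-ε⁻ x

  Run-skip : Run {Ys = Ys} skip comm σ ε tt σ
  Run-skip {Ys = Ys} = run (Steps-ε _) (skip (++⁺-ε Ys))

  Run-skip⁻ : {u : Traces Ys} → Run skip comm σ u tt σ′ → u ≡ ε × σ ≡ σ′
  Run-skip⁻ {Ys = Ys} {u = u} (run x (skip e)) with ++⁺-injective u ε (trans e (sym (++⁺-ε Ys)))
  ... | refl , refl = refl , Steps-ε⁻ x

  Den-Ω : ∀ {Γ : Cxt n} {s} → ¬ Den Γ Ω comm s tt
  Den-Ω (stop a≢0 (num _)) = a≢0 refl
  Den-Ω (loop _ _ _ d)     = Den-Ω d

  Run-Ω : {u : Traces Ys} → ¬ Run Ω comm σ u tt σ′
  Run-Ω (run _ d) = Den-Ω d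

  Run-assertZero : ∀ {M} {u : Traces Ys} → Run M nat σ u 0 σ′ → Run (assertZero M) comm σ u tt σ′
  Run-assertZero {u = u} r = Run-cong (∙-identityʳ u) (Run-ifzero₁ comm r Run-skip)

  Run-assertZero⁻ : ∀ {M} {u : Traces Ys} → Run (assertZero M) comm σ u tt σ′ → Run M nat σ u 0 σ′
  Run-assertZero⁻ r with Run-ifzero⁻ r
  ... | u , v , a , σ₁ , refl , x , inj₂ (_ , y) = contradiction y Run-Ω
  ... | u , v , a , σ₁ , refl , x , inj₁ (refl , y) with Run-skip⁻ y
  ...   | refl , refl = Run-cong (sym (∙-identityʳ u)) x

  Run-arith : ∀ {M N o} {u v : Traces Ys} {a b} → Run M nat σ u a σ′ → Run N nat σ′ v b σ″ →
              Run (M ⟨ o ⟩ N) nat σ (u ∙ v) (apply o a b) σ″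
  Run-arith {u = u} {v} (run {w} x d) (run {w′} y e) =
      run (Steps-∙ x y) (arith (sym (++⁺-∙ u v w w′)) refl d e)

  Run-arith⁻ : ∀ {M N o} {r : Traces Ys} {c} → Run (M ⟨ o ⟩ N) nat σ r c σ″ →
               ∃[ u ] ∃[ v ] ∃[ a ] ∃[ b ] ∃[ σ′ ] r ≡ u ∙ v × c ≡ apply o a b ×
               Run M nat σ u a σ′ × Run N nat σ′ v b σ″
  Run-arith⁻ {r = r} (run {w} x (arith e c d d′)) with ++⁺-∙⁻ r w e
  ... | u , w₁ , v , w₂ , refl , refl , er , refl with Steps-split w₁ x
  ...   | σ₁ , x₁ , x₂ = u , v , _ , _ , σ₁ , er , c , run x₁ d , run x₂ d′

  single-cell : (Ys : Cxt k) (j : Fin 2) (q : lookup (Ys ++ vars 2) (k ↑ʳ j) ≡ var) → ∀ a →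
                single-trace {Γ = Ys ++ vars 2} (k ↑ʳ j) q a ≡ ++⁺ (ε {Γ = Ys})
                    (single-trace {Γ = vars 2} j (vars-lookup j) a)
  single-cell Ys j q a =
      trans (sym (push-single (rightEmb Ys (vars 2)) j (vars-lookup j) q a)) (push-right {Δ = Ys} _)

  Run-cell : {Ys : Cxt k} → ∀ j a → Steps σ (single-trace j (vars-lookup j) a) σ′ →
      Run {Ys = Ys} (cell k j) var σ ε a σ′
  Run-cell {Ys = Ys} j a x =
      run x (ident _ (sym (single-cell Ys j (trans (lookup-++ʳ Ys (vars 2) j) (vars-lookup j)) a)))

  Run-cell⁻ : {Ys : Cxt k} → ∀ j {a} {u : Traces Ys} → Run (cell k j) var σ u a σ′ →
              u ≡ ε × Steps σ (single-trace j (vars-lookup j) a) σ′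
  Run-cell⁻ {Ys = Ys} j {a} {u} (run x (ident q e))
      with ++⁺-injective u ε (trans e (single-cell Ys j q a))
  ... | refl , refl = refl , x

  Run-deref : ∀ {M} {u : Traces Ys} {a} → Run M var σ u (read a) σ′ → Run (! M) nat σ u a σ′
  Run-deref (run x d) = run x (deref d)

  Run-deref⁻ : ∀ {M} {u : Traces Ys} {a} → Run (! M) nat σ u a σ′ → Run M var σ u (read a) σ′
  Run-deref⁻ (run x (deref d)) = run x d

  Steps-read⁻ : ∀ j {a} → Steps σ (single-trace j (vars-lookup j) (read a)) σ′ → σ ≡ σ′ × lookup σ j ≡ a
  Steps-read⁻ zero       (read [] ∷ [] ∷ []) = refl , refl
  Steps-read⁻ (suc zero) ([] ∷ read [] ∷ []) = refl , refl

  Steps-write⁻ : ∀ j {a} → Steps σ (single-trace j (vars-lookup j) (write a)) σ′ → σ′ ≡ σ [ j ]≔ a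
  Steps-write⁻ zero       (write [] ∷ [] ∷ []) = refl
  Steps-write⁻ (suc zero) ([] ∷ write [] ∷ []) = refl

  Run-!cell : {Ys : Cxt k} → ∀ j → Run {Ys = Ys} (! cell k j) nat σ ε (lookup σ j) σ
  Run-!cell j = Run-deref (Run-cell j _ (Steps-read _ j (vars-lookup j)))

  Run-!cell⁻ : {Ys : Cxt k} → ∀ j {a} {u : Traces Ys} → Run (! cell k j) nat σ u a σ′ →
      u ≡ ε × σ ≡ σ′ × lookup σ j ≡ a
  Run-!cell⁻ j r with Run-cell⁻ j (Run-deref⁻ r)
  ... | e , x = e , Steps-read⁻ j x

  Run-set : {Ys : Cxt k} → ∀ j a → Run {Ys = Ys} (cell k j := num a) comm σ ε tt (σ [ j ]≔ a)
  Run-set {σ = σ} {Ys = Ys} j a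
      with Run-num {Ys = Ys} {σ = σ} a
      | Run-cell {Ys = Ys} j (write a) (Steps-write σ j a (vars-lookup j))
  ... | run {w} x d | run {w′} y e =
    run (Steps-∙ x y) (assign
        (trans (cong (λ u → ++⁺ u (w ∙ w′)) (sym (∙-identityˡ ε))) (sym (++⁺-∙ ε ε w w′))) d e)

  Run-set⁻ : {Ys : Cxt k} → ∀ j {a} {u : Traces Ys} → Run (cell k j := num a) comm σ u tt σ′ →
      u ≡ ε × σ′ ≡ σ [ j ]≔ a
  Run-set⁻ {Ys = Ys} j {a} {u} (run {w} x (assign e d d′)) with ++⁺-∙⁻ u w e
  ... | u₁ , w₁ , u₂ , w₂ , refl , refl , refl , refl with Steps-split w₁ x
  ...   | σ₁ , x₁ , x₂ with Run-num⁻ {u = u₁} (run x₁ d)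
  ...     | refl , refl , refl with Run-cell⁻ j {u = u₂} (run x₂ d′)
  ...       | refl , y = ∙-identityˡ ε , Steps-write⁻ j y

  Run-cell∸ : {Ys : Cxt k} → ∀ j p → Run {Ys = Ys} (! cell k j ⊝ num p) nat σ ε (lookup σ j ∸ p) σ
  Run-cell∸ {σ = σ} j p with Run-arith {o = minus} (Run-!cell {σ = σ} j) (Run-num p)
  ... | r rewrite minus-∸ (lookup σ j) p = Run-cong (∙-identityˡ ε) r

  Run-cell∸⁻ : {Ys : Cxt k} → ∀ j {p a} {u : Traces Ys} → Run (! cell k j ⊝ num p) nat σ u a σ′ →
               u ≡ ε × σ ≡ σ′ × lookup σ j ∸ p ≡ a
  Run-cell∸⁻ j r with Run-arith⁻ r
  ... | u , v , _ , _ , σ₁ , refl , refl , x , y with Run-!cell⁻ j x | Run-num⁻ y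
  ...   | refl , refl , refl | refl , refl , refl = ∙-identityˡ ε , refl , sym (minus-∸ _ _)

  Run-∸cell : {Ys : Cxt k} → ∀ j p → Run {Ys = Ys} (num p ⊝ ! cell k j) nat σ ε (p ∸ lookup σ j) σ
  Run-∸cell {σ = σ} j p with Run-arith {o = minus} (Run-num p) (Run-!cell {σ = σ} j)
  ... | r rewrite minus-∸ p (lookup σ j) = Run-cong (∙-identityˡ ε) r

  Run-∸cell⁻ : {Ys : Cxt k} → ∀ j {p a} {u : Traces Ys} → Run (num p ⊝ ! cell k j) nat σ u a σ′ →
               u ≡ ε × σ ≡ σ′ × p ∸ lookup σ j ≡ a
  Run-∸cell⁻ j r with Run-arith⁻ r
  ... | u , v , _ , _ , σ₁ , refl , refl , x , y with Run-num⁻ x | Run-!cell⁻ j y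
  ...   | refl , refl , refl | refl , refl , refl = ∙-identityˡ ε , refl , sym (minus-∸ _ _)

  Run-prepare : ∀ {v c} i p q → v ≤ p →
      Run {Ys = []} (prepare i p q) comm (v ∷ c ∷ []) [] tt (q ∷ suc i ∷ [])
  Run-prepare {v} i p q v≤p =
    Run-seq comm (Run-assertZero (Run-result (m≤n⇒m∸n≡0 v≤p) (Run-cell∸ zero p)))
      (Run-seq comm (Run-set (suc zero) (suc i)) (Run-set zero q))

  Run-prepare⁻ : ∀ {v c} i p q {σ′} → Run {Ys = []} (prepare i p q) comm (v ∷ c ∷ []) [] tt σ′ →
                 v ≤ p × σ′ ≡ q ∷ suc i ∷ []
  Run-prepare⁻ i p q r with Run-seq⁻ r
  ... | [] , [] , _ , _ , x , y with Run-cell∸⁻ zero (Run-assertZero⁻ x) | Run-seq⁻ y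
  ...   | _ , refl , e | [] , [] , _ , _ , y₁ , y₂ with Run-set⁻ (suc zero) y₁ | Run-set⁻ zero y₂
  ...     | _ , refl | _ , refl = m∸n≡0⇒m≤n e , refl

  Run-check : ∀ {v} A t → v ≤ finalPost A 0 t →
      Run {Ys = []} (check A t) comm (v ∷ List.length t ∷ []) [] tt (v ∷ List.length t ∷ [])
  Run-check A t v≤p =
    Run-seq comm
      (Run-assertZero (Run-result (m≤n⇒m∸n≡0 (≤-refl {List.length t})) (Run-∸cell (suc zero) _)))
      (Run-assertZero (Run-result (m≤n⇒m∸n≡0 v≤p) (Run-cell∸ zero _)))

  Run-check⁻ : ∀ {v c σ′} A t → Run {Ys = []} (check A t) comm (v ∷ c ∷ []) [] tt σ′ →
               List.length t ≤ c × v ≤ finalPost A 0 t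
  Run-check⁻ A t r with Run-seq⁻ r
  ... | [] , [] , _ , _ , x , y with Run-∸cell⁻ (suc zero) (Run-assertZero⁻ x)
  ...   | _ , refl , e with Run-cell∸⁻ zero (Run-assertZero⁻ y)
  ...     | _ , refl , e′ = m∸n≡0⇒m≤n e , m∸n≡0⇒m≤n e′

  -- Traces accepted by tests

  -- The answer `a′` of an emulation whose commands have been run, where the script says `a`. A
  -- variable handed out is cell 0, on which any action is possible; whether it was acceptable shows
  -- only at the next check.
  Effect : ∀ A → α A → Store 2 → α A → Store 2 → Set
  Effect nat     a       σ a′        σ′ = a′ ≡ a × σ ≡ σ′
  Effect comm    _       σ _         σ′ = σ ≡ σ′
  Effect var     _       σ a′        σ′ = Steps σ (single-trace {Γ = vars 2} zero refl a′) σ′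
  Effect (A ⊸ B) (s , b) σ (s′ , b′) σ′ = Pointwise (Passes A) s′ s × Effect B b σ b′ σ′

  mutual

    Passes-refl : ∀ A {a} → Passes A a a
    Passes-refl nat             = ≤-refl
    Passes-refl comm            = tt
    Passes-refl var {read _}    = ≤-refl
    Passes-refl var {write _}   = refl
    Passes-refl (A ⊸ B)         = Pointwise.refl (Supplied-refl A) , Passes-refl B

    Supplied-refl : ∀ A {a} → Supplied A a a
    Supplied-refl nat           = refl
    Supplied-refl comm          = tt
    Supplied-refl var {read _}  = refl
    Supplied-refl var {write _} = ≤-refl
    Supplied-refl (A ⊸ B)       = Pointwise.refl (Passes-refl A) , Supplied-refl B

  drop-suc : ∀ {X : Set} i (L : List X) {x xs} → List.drop i L ≡ x ∷ xs → List.drop (suc i) L ≡ xs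
  drop-suc zero    (_ ∷ _) refl = refl
  drop-suc (suc i) (_ ∷ L) e    = drop-suc i L e

  Effect-self : ∀ A a c → Effect A a (pre A a ∷ c ∷ []) a (post A a ∷ c ∷ [])
  Effect-self nat     a         c = refl , refl
  Effect-self comm    a         c = refl
  Effect-self var     (read _)  c = read [] ∷ [] ∷ []
  Effect-self var     (write _) c = write [] ∷ [] ∷ []
  Effect-self (A ⊸ B) (s , b)   c = Pointwise.refl (Passes-refl A) , Effect-self B b c

  Effect⇒Supplied : ∀ A a {a′ c} → Effect A a (pre A a ∷ c ∷ []) a′ σ′ →
                    ∃[ v ] σ′ ≡ v ∷ c ∷ [] × (v ≤ post A a → Supplied A a′ a)
  Effect⇒Supplied nat     a         (e , refl)             = _ , refl , λ _ → e
  Effect⇒Supplied comm    a         refl                   = _ , refl , λ _ → tt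
  Effect⇒Supplied var     (read _)  (read [] ∷ [] ∷ [])    = _ , refl , λ _ → refl
  -- A write within the bound goes unnoticed where the script has a read.
  Effect⇒Supplied var     (read _)  (write [] ∷ [] ∷ [])   = _ , refl , λ v≤ → v≤
  -- Reading leaves the successor of the bound in the cell, and the check fails.
  Effect⇒Supplied var     (write _) (read [] ∷ [] ∷ [])    = _ , refl , λ v≤ → contradiction v≤ (n≮n _)
  Effect⇒Supplied var     (write _) (write [] ∷ [] ∷ [])   = _ , refl , λ v≤ → v≤
  Effect⇒Supplied (A ⊸ B) (s , b)   (p , e) with Effect⇒Supplied B b e
  ... | v , e′ , f = v , e′ , λ v≤ → p , f v≤

  Run-result-term : {Ys : Cxt k} → Base A → ∀ {a a′} → Effect A a σ a′ σ′ →
      Run {Ys = Ys} (result k A a) A σ ε a′ σ′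
  Run-result-term nat  {a} (refl , refl) = Run-num a
  Run-result-term comm refl              = Run-skip
  Run-result-term var  {a′ = a′} e       = Run-cell zero a′ e

  Run-result-term⁻ : {Ys : Cxt k} → Base A → ∀ {a a′} {u : Traces Ys} → Run (result k A a) A σ u a′ σ′ →
                     u ≡ ε × Effect A a σ a′ σ′
  Run-result-term⁻ nat  r = Run-num⁻ r
  Run-result-term⁻ comm r = Run-skip⁻ r
  Run-result-term⁻ var  r = Run-cell⁻ zero r

  -- `i` entries have been skipped and the counter exceeds them by `j`, so it is entry `j` of the
  -- remaining list that fires.
  Run-dispatch : {Ys : Cxt k} → Base A → ∀ i j {L N a rest v a′} {u : Traces Ys} →
                 List.drop j L ≡ (N , a) ∷ rest → Run N comm (v ∷ i + j ∷ []) u tt σ →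
                     Effect A a σ a′ σ′ →
                 Run (dispatch k A i L) A (v ∷ i + j ∷ []) u a′ σ′
  Run-dispatch β i zero {_ ∷ _} {u = u} refl r e =
    Run-cong (trans (∙-identityˡ _) (∙-identityʳ u))
      (Run-ifzero₁ β (Run-result (m≤n⇒m∸n≡0 (≤-reflexive (+-identityʳ i))) (Run-cell∸ (suc zero) i))
        (Run-seq β r (Run-result-term β e)))
  Run-dispatch {k = k} {A = A} {σ} {σ′} β i (suc j) {_ ∷ L} {N} {v = v} {a′} {u} eq r e =
    Run-cong (∙-identityˡ u)
      (Run-ifzero₂ β (λ q → m+1+n≰m i (m∸n≡0⇒m≤n q)) (Run-cell∸ (suc zero) i)
        (transport (λ c → Run (dispatch k A (suc i) L) A (v ∷ c ∷ []) u a′ σ′) (sym (+-suc i j))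
          (Run-dispatch β (suc i) j eq
              (transport (λ c → Run N comm (v ∷ c ∷ []) u tt σ) (+-suc i j) r) e)))

  Run-dispatch⁻ : {Ys : Cxt k} → Base A → ∀ i j {L v a′} {u : Traces Ys} →
                  Run (dispatch k A i L) A (v ∷ i + j ∷ []) u a′ σ′ →
                  ∃[ N ] ∃[ a ] ∃[ rest ] ∃[ σ ] List.drop j L ≡ (N , a) ∷ rest ×
                    Run N comm (v ∷ i + j ∷ []) u tt σ × Effect A a σ a′ σ′
  Run-dispatch⁻ β i j {[]} r with Run-seq⁻ r
  ... | _ , _ , _ , _ , x , _ = contradiction x Run-Ω
  Run-dispatch⁻ β i zero {(N , a) ∷ L} r with Run-ifzero⁻ r
  ... | _ , _ , _ , _ , refl , x , inj₂ (a≢0 , y) with Run-cell∸⁻ (suc zero) x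
  ...   | _ , refl , e = contradiction (trans (sym e) (m≤n⇒m∸n≡0 (≤-reflexive (+-identityʳ i)))) a≢0
  Run-dispatch⁻ β i zero {(N , a) ∷ L} r
      | _ , _ , _ , _ , refl , x , inj₁ (refl , y) with Run-cell∸⁻ (suc zero) x | Run-seq⁻ y
  ...   | refl , refl , e | u₁ , u₂ , σ₁ , refl , y₁ , y₂ with Run-result-term⁻ β y₂
  ...     | refl , f = N , a , L , σ₁ , refl ,
      Run-cong (sym (trans (∙-identityˡ _) (∙-identityʳ u₁))) y₁ , f
  Run-dispatch⁻ β i (suc j) {(N , a) ∷ L} r with Run-ifzero⁻ r
  ... | _ , _ , _ , _ , refl , x , inj₁ (refl , y) with Run-cell∸⁻ (suc zero) x
  ...   | _ , refl , e = contradiction (m∸n≡0⇒m≤n e) (m+1+n≰m i)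
  Run-dispatch⁻ β i (suc j) {(N , a) ∷ L} r
      | _ , v , _ , _ , refl , x , inj₂ (a≢0 , y) with Run-cell∸⁻ (suc zero) x
  ...   | refl , refl , e rewrite +-suc i j with Run-dispatch⁻ β (suc i) j {L} y
  ...     | N′ , a′ , rest , σ , eq , z , f =
      N′ , a′ , rest , σ , eq , Run-cong (sym (∙-identityˡ v)) z , f

  Run-weaken : {Ys : Cxt k} → ∀ {N} {u : Traces Ys} → Run N comm σ u tt σ′ →
               Run {Ys = A ∷ Ys} (weaken N) comm σ ([] ∷ u) tt σ′
  Run-weaken (run x d) = run x (Den-cong (push-weak _) (rename-Den weakEmb d))

  Run-weaken⁻ : {Ys : Cxt k} → ∀ N {t} {u : Traces Ys} →
      Run {Ys = A ∷ Ys} (weaken N) comm σ (t ∷ u) tt σ′ →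
                t ≡ [] × Run N comm σ u tt σ′
  Run-weaken⁻ N (run x d) with rename-Den⁻ weakEmb N d
  ... | s , e , d′ with trans e (push-weak s)
  ...   | refl = refl , run x d′

  Star-zero : {Γ : Cxt n} → ∀ as → Star (Den (A ∷ Γ) (ident zero) A) (as ∷ ε) as
  Star-zero []       = []
  Star-zero (a ∷ as) = Star-cong (cong (_ ∷_) (∙-identityˡ ε)) (ident refl refl ∷ Star-zero as)

  Star-zero⁻ : {Γ : Cxt n} → ∀ {r as} → Star (Den (A ∷ Γ) (ident zero) A) r as → r ≡ as ∷ ε
  Star-zero⁻ []                      = refl
  Star-zero⁻ (ident refl refl ∷ ds) with Star-zero⁻ ds
  ... | refl = cong (_ ∷_) (∙-identityˡ ε)

  mutual

    -- A trace passes its own test: the arguments are emulated exactly as prescribed and every check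
    -- succeeds. Tests and emulations are treated together, since an emulation tests the arguments
    -- it receives.
    test-Den : ∀ A a {Γ : Cxt n} {N s} → Γ ⊢ N ∶ A → Den Γ N A s a → Den Γ (test A a N) comm s tt
    test-Den nat a {s = s} d x =
      ifzero₁ comm (sym (∙-identityʳ s))
        (arith (sym (∙-identityʳ s)) (sym (trans (minus-∸ a a) (m≤n⇒m∸n≡0 (≤-refl {a})))) x (num refl))
            (skip refl)
    test-Den comm a d x = x
    test-Den var (read a) {s = s} d x =
      ifzero₁ comm (sym (∙-identityʳ s))
        (arith (sym (∙-identityʳ s)) (sym (trans (minus-∸ a a) (m≤n⇒m∸n≡0 (≤-refl {a})))) (deref x)
            (num refl)) (skip refl)
    test-Den var (write a) d x = assign (sym (∙-identityˡ _)) (num refl) x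
    test-Den (A ⊸ B) (t , b) {Γ} {N} {s} d x
      with script-Star A (script A 0 0 t) 0 0 t refl (≤-refl {0})
    ... | g , v , xs , gs , v≤ with Run-check A t v≤
    -- Probe and check together yield one trace for each of the two cells, as the two uses of `new`
    -- require.
    ...   | run {w = k} ks y with g ∙ k in eq | Steps-∙ gs ks
    ...     | tz ∷ tc ∷ [] | z ∷ c ∷ [] =
      new comm (Acts⇒Cell c) (new comm (Acts⇒Cell z)
        (seq comm trace
          (test-Den B b (probe-⊢ A t d)
            (app (push-++ g s) (right#left g s) (rename-Den (rightEmb (vars 2) Γ) x)
              (rename-Star (leftEmb (vars 2) Γ) xs)))
          (rename-Den (leftEmb (vars 2) Γ) y)))
      where
      trace : tz ∷ tc ∷ s ≡ ++⁺ g s ∙ push (leftEmb (vars 2) Γ) k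
      trace = sym (trans (cong (++⁺ g s ∙_) (push-left {Γ = Γ} k))
                (trans (++⁺-∙ g k s ε) (cong₂ ++⁺ eq (∙-identityʳ s))))

    test-Den⁻ : ∀ A a {Γ : Cxt n} {N s} → Γ ⊢ N ∶ A → Den Γ (test A a N) comm s tt →
                ∃[ a′ ] Passes A a′ a × Den Γ N A s a′
    test-Den⁻ nat a d (ifzero₁ {s = s} _ refl (arith {s = s′} {a = a′} refl e x (num refl))
        (skip refl)) =
      a′ , m∸n≡0⇒m≤n (sym (trans e (minus-∸ a′ a))) ,
      Den-cong (sym (trans (∙-identityʳ (s′ ∙ ε)) (∙-identityʳ s′))) x
    test-Den⁻ nat a d (ifzero₂ _ _ _ _ y) = contradiction y Den-Ω
    test-Den⁻ comm a d x = tt , tt , x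
    test-Den⁻ var (read a) d
        (ifzero₁ {s = s} _ refl (arith {s = s′} {a = a′} refl e (deref x) (num refl)) (skip refl)) =
      read a′ , m∸n≡0⇒m≤n (sym (trans e (minus-∸ a′ a))) ,
      Den-cong (sym (trans (∙-identityʳ (s′ ∙ ε)) (∙-identityʳ s′))) x
    test-Den⁻ var (read a) d (ifzero₂ _ _ _ _ y) = contradiction y Den-Ω
    test-Den⁻ var (write a) d (assign refl (num refl) x) =
        write a , refl , Den-cong (sym (∙-identityˡ _)) x
    test-Den⁻ (A ⊸ B) (t , b) {Γ} {N} {s} d (new {t = tc} _ cc (new {t = tz} _ cz (seq _ eq x y)))
      with ++⁺-∙⁻ (tz ∷ tc ∷ []) s eq | Cell⇒Acts cc | Cell⇒Acts cz
    ... | g , s₁ , k , s₂ , refl , refl , eqw , refl | vc , ac | vz , az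
      with test-Den⁻ B b (probe-⊢ A t d) x | rename-Den⁻ (leftEmb (vars 2) Γ) (check A t) y
         -- Cutting the run of the cells after the probe exposes the store on which `check` is run.
         | Steps-split g (transport (λ w → Steps (0 ∷ 0 ∷ []) w (vz ∷ vc ∷ [])) eqw (az ∷ ac ∷ []))
    ...   | b′ , pb , app e _ x₁ xs | k′ , ek , y′ | v₁ ∷ c₁ ∷ [] , gs , ks
      with rename-Den⁻ (rightEmb (vars 2) Γ) N x₁
          | rename-Star⁻ (leftEmb (vars 2) Γ) (emulate 0 A (script A 0 0 t)) xs
         | ++⁺-injective k k′ (trans ek (push-left {Γ = Γ} k′))
    ...     | s₁′ , refl , x₂ | g′ , refl , xs′ | refl , refl
      with Den-type (⊢⇒⊩ d) x₂ | ++⁺-injective g g′ (trans e (sym (push-++ g′ s₁′)))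
    ...       | refl | refl , refl with Run-check⁻ A t (run ks y′)
    ...         | t≤c , v≤ =
      (_ , b′) , (proj₂ (script-Star⁻ A (script A 0 0 t) 0 0 t refl xs′ gs t≤c v≤) , pb) ,
      Den-cong (sym (∙-identityʳ s₁)) x₂

    tests-Den : ∀ A as {Γ : Cxt n} {N s} → Γ ⊢ N ∶ A → Star (Den Γ N A) s as →
        Den Γ (tests A as N) comm s tt
    tests-Den A []       d []       = skip refl
    tests-Den A (a ∷ as) d (x ∷ xs) = seq comm refl (test-Den A a d x) (tests-Den A as d xs)

    tests-Den⁻ : ∀ A as {Γ : Cxt n} {N s} → Γ ⊢ N ∶ A → Den Γ (tests A as N) comm s tt →
                 ∃[ as′ ] Pointwise (Passes A) as′ as × Star (Den Γ N A) s as′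
    tests-Den⁻ A []       d (skip refl) = [] , [] , []
    tests-Den⁻ A (a ∷ as) d (seq _ refl x y) with test-Den⁻ A a d x | tests-Den⁻ A as d y
    ... | a′ , p , x′ | as′ , ps , xs = a′ ∷ as′ , p ∷ ps , x′ ∷ xs

    Run-emulate : {Ys : Cxt k} → ∀ A j {L N a rest v} {u : Traces Ys} →
                  List.drop j L ≡ (N , a) ∷ rest → Run N comm (v ∷ j ∷ []) u tt σ → Effect A a σ a σ′ →
                  Run (emulate k A L) A (v ∷ j ∷ []) u a σ′
    Run-emulate nat     j eq r e = Run-dispatch nat 0 j eq r e
    Run-emulate comm    j eq r e = Run-dispatch comm 0 j eq r e
    Run-emulate var     j eq r e = Run-dispatch var 0 j eq r e
    Run-emulate {k = k} {σ = σ} {Ys = Ys} (A ⊸ B) j {L} {N} {s , b} {rest} {u = u} eq r (_ , e)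
      with Run-emulate {Ys = A ∷ Ys} B j {List.map (curry-step k A B) L} {u = s ∷ u}
             (trans (drop-map j L) (cong (List.map (curry-step k A B)) eq))
             (Run-cong (cong (s ∷_) (∙-identityʳ u)) (Run-seq comm (Run-weaken r) used)) e
      where
      used : Run {Ys = A ∷ Ys} (tests A s (ident zero)) comm σ (s ∷ ε) tt σ
      used = run (Steps-ε σ) (tests-Den A s (ident-⊢ _ zero refl)
               (Star-cong (cong (s ∷_) (sym (++⁺-ε Ys))) (Star-zero s)))
    ... | run x d = run x (lam d)

    Run-emulate⁻ : {Ys : Cxt k} → ∀ A j {L v a′} {u : Traces Ys} →
                   Run (emulate k A L) A (v ∷ j ∷ []) u a′ σ′ →
                   ∃[ N ] ∃[ a ] ∃[ rest ] ∃[ σ ] List.drop j L ≡ (N , a) ∷ rest ×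
                     Run N comm (v ∷ j ∷ []) u tt σ × Effect A a σ a′ σ′
    Run-emulate⁻ nat     j r = Run-dispatch⁻ nat 0 j r
    Run-emulate⁻ comm    j r = Run-dispatch⁻ comm 0 j r
    Run-emulate⁻ var     j r = Run-dispatch⁻ var 0 j r
    Run-emulate⁻ {k = k} {Ys = Ys} (A ⊸ B) j {L} {a′ = s′ , b′} {u} (run x (lam d))
      with Run-emulate⁻ {Ys = A ∷ Ys} B j {List.map (curry-step k A B) L} {u = s′ ∷ u} (run x d)
    ... | N′ , b , rest , σ , eq , r , e with List.drop j L | trans (sym (drop-map j L)) eq
    ...   | (N , s , b) ∷ rest | refl with Run-seq⁻ r
    ...     | t₁ ∷ u₁ , t₂ ∷ u₂ , σ₁ , refl , r₁ , run {w = w} x₂ d₂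
      with Run-weaken⁻ N r₁ | tests-Den⁻ A s (ident-⊢ _ zero refl) d₂
    ...       | refl , r₁′ | s″ , ps , xs
      with ++⁺-injective (t₂ ∷ u₂) (s″ ∷ ε) (trans (Star-zero⁻ xs) (cong (s″ ∷_) (sym (++⁺-ε Ys))))
    ...         | refl , refl with Steps-ε⁻ x₂
    ...           | refl =
        N , (s , b) , rest , σ , refl , Run-cong (sym (∙-identityʳ u₁)) r₁′ , (ps , e)

    script-Star : ∀ A L i p t {v} → List.drop i L ≡ script A i p t → v ≤ p →
                  ∃[ g ] ∃[ v′ ] Star (Den (vars 2) (emulate 0 A L) A) g t ×
                    Steps (v ∷ i ∷ []) g (v′ ∷ i + List.length t ∷ []) × v′ ≤ finalPost A p t
    script-Star A L i p [] {v} eq v≤ =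
      ε , v , [] , transport (λ c → Steps (v ∷ i ∷ []) ε (v ∷ c ∷ [])) (sym (+-identityʳ i))
          (Steps-ε _) , v≤
    script-Star A L i p (a ∷ t) {v} eq v≤
      with Run-emulate A i eq (Run-prepare i p (pre A a) v≤) (Effect-self A a (suc i))
         | script-Star A L (suc i) (post A a) t (drop-suc i L eq) ≤-refl
    ... | run {w = g} gs x | g′ , v′ , xs , gs′ , v′≤ =
      g ∙ g′ , v′ , x ∷ xs ,
      transport (λ c → Steps (v ∷ i ∷ []) (g ∙ g′) (v′ ∷ c ∷ [])) (sym (+-suc i (List.length t)))
          (Steps-∙ gs gs′) , v′≤

    -- The content left by an element is examined only at the next call, or by `check` after the
    -- last one. So the bound on `v` is handed back to the preceding element, where it completes the
    -- proof of `Supplied`. The counter rules out sequences that are too short, divergence those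
    -- that are too long.
    script-Star⁻ : ∀ A L i p t {v g as v′ c′} → List.drop i L ≡ script A i p t →
                   Star (Den (vars 2) (emulate 0 A L) A) g as → Steps (v ∷ i ∷ []) g (v′ ∷ c′ ∷ []) →
                   i + List.length t ≤ c′ → v′ ≤ finalPost A p t → v ≤ p × Pointwise (Supplied A) as t
    script-Star⁻ A L i p [] eq [] gs t≤ v≤ with Steps-ε⁻ gs
    ... | refl = v≤ , []
    script-Star⁻ A L i p (_ ∷ _) eq [] gs t≤ v≤ with Steps-ε⁻ gs
    ... | refl = contradiction t≤ (m+1+n≰m i)
    script-Star⁻ A L i p [] eq (_∷_ {t = g} x xs) gs t≤ v≤ with Steps-split g gs
    ... | _ , gs₁ , _ with Run-emulate⁻ {Ys = []} A i {L} {u = []} (run gs₁ x)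
    ...   | _ , _ , _ , _ , eq′ , _ = case trans (sym eq) eq′ of λ ()
    script-Star⁻ A L i p (a ∷ t) {c′ = c′} eq (_∷_ {t = g} x xs) gs t≤ v≤ with Steps-split g gs
    ... | _ , gs₁ , gs₂ with Run-emulate⁻ {Ys = []} A i {L} {u = []} (run gs₁ x)
    ...   | _ , _ , _ , _ , eq′ , r , e with trans (sym eq) eq′
    ...     | refl with Run-prepare⁻ i p (pre A a) r
    ...       | v≤p , refl with Effect⇒Supplied A a e
    ...         | _ , refl , f
      with script-Star⁻ A L (suc i) (post A a) t (drop-suc i L eq) xs gs₂
          (transport (_≤ c′) (+-suc i (List.length t)) t≤) v≤
    ...           | v₁≤ , ps = v≤p , f v₁≤ ∷ ps

  -- Full abstraction

  holeEmb : {Γ : Cxt m} {Θ : Cxt n} (ρ : Fin m → Fin n) → Injective _≡_ _≡_ ρ →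
            (∀ i → lookup Θ (ρ i) ≡ lookup Γ i) → Emb Γ Θ
  holeEmb ρ inj τ .fun       = ρ
  holeEmb ρ inj τ .injective = inj
  holeEmb ρ inj τ .typed     = τ

  mutual

    -- `Den` is compositional on raw terms, so the terms around the hole need no typing. Capture is
    -- harmless because the inclusion is assumed for all traces of the captured identifiers.
    plug-Den : {Γ : Cxt m} {M N : Tm m} → (∀ {A s a} → Den Γ M A s a → Den Γ N A s a) →
               {Θ : Cxt n} (C : Context Γ Θ) → ∀ {A s a} → Den Θ (plug C M) A s a →
                   Den Θ (plug C N) A s a
    plug-Den {Γ = Γ} {M} f {Θ} (hole ρ inj τ) d with rename-Den⁻ (holeEmb {Γ = Γ} {Θ} ρ inj τ) M d
    ... | s , refl , x = rename-Den (holeEmb {Γ = Γ} {Θ} ρ inj τ) (f x)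
    plug-Den f (arithˡ C o N) (arith e c x y) = arith e c (plug-Den f C x) y
    plug-Den f (arithʳ N o C) (arith e c x y) = arith e c x (plug-Den f C y)
    plug-Den f (seqˡ C N) (seq β e x y) = seq β e (plug-Den f C x) y
    plug-Den f (seqʳ N C) (seq β e x y) = seq β e x (plug-Den f C y)
    plug-Den f (assignˡ C N) (assign e x y) = assign e x (plug-Den f C y)
    plug-Den f (assignʳ N C) (assign e x y) = assign e (plug-Den f C x) y
    plug-Den f (deref C) (deref x) = deref (plug-Den f C x)
    plug-Den f (whileˡ C N) (stop a≢0 x) = stop a≢0 (plug-Den f C x)
    plug-Den f (whileˡ C N) (loop e x y z) = loop e (plug-Den f C x) y (plug-Den f (whileˡ C N) z)
    plug-Den f (whileʳ N C) (stop a≢0 x) = stop a≢0 x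
    plug-Den f (whileʳ N C) (loop e x y z) = loop e x (plug-Den f C y) (plug-Den f (whileʳ N C) z)
    plug-Den f (ifzero₀ C N N′) (ifzero₁ β e x y) = ifzero₁ β e (plug-Den f C x) y
    plug-Den f (ifzero₀ C N N′) (ifzero₂ β e a≢0 x y) = ifzero₂ β e a≢0 (plug-Den f C x) y
    plug-Den f (ifzero₁ N C N′) (ifzero₁ β e x y) = ifzero₁ β e x (plug-Den f C y)
    plug-Den f (ifzero₁ N C N′) (ifzero₂ β e a≢0 x y) = ifzero₂ β e a≢0 x y
    plug-Den f (ifzero₂ N N′ C) (ifzero₁ β e x y) = ifzero₁ β e x y
    plug-Den f (ifzero₂ N N′ C) (ifzero₂ β e a≢0 x y) = ifzero₂ β e a≢0 x (plug-Den f C y)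
    plug-Den f (lam A C) (lam x) = lam (plug-Den f C x)
    plug-Den f (appˡ C N) (app e s#t x xs) = app e s#t (plug-Den f C x) xs
    plug-Den f (appʳ N C) (app e s#t x xs) = app e s#t x (plug-Star f C xs)
    plug-Den f (new C) (new γ c x) = new γ c (plug-Den f C x)

    plug-Star : {Γ : Cxt m} {M N : Tm m} → (∀ {A s a} → Den Γ M A s a → Den Γ N A s a) →
                {Θ : Cxt n} (C : Context Γ Θ) → ∀ {A s as} →
                Star (Den Θ (plug C M) A) s as → Star (Den Θ (plug C N) A) s as
    plug-Star f C []       = []
    plug-Star f C (x ∷ xs) = plug-Den f C x ∷ plug-Star f C xs

  closed≡ : (Θ : Cxt n) (P : Tm 0) → closed {n} P ≡ rename (fun (emptyEmb Θ)) P
  closed≡ Θ P = trans (cong closed (sym (rename-id {ρ = λ i → i} (λ _ → refl) P)))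
      (rename-rename (λ ()) P)

  plug-closed : {Γ : Cxt m} {M N : Tm m} → (∀ {A s a} → Den Γ M A s a → Den Γ N A s a) →
                {Θ : Cxt n} (C : Context Γ Θ) → ∀ {P Q} → plug C M ≡ closed P → plug C N ≡ closed Q →
                ∀ {s a} → Den [] P A s a → Den [] Q A [] a
  plug-closed f {Θ} C {P} {Q} eP eQ x
    with rename-Den⁻ (emptyEmb Θ) Q
           (transport (λ K → Den Θ K _ _ _) (trans eQ (closed≡ Θ Q))
             (plug-Den f C (transport (λ K → Den Θ K _ _ _) (sym (trans eP (closed≡ Θ P)))
                 (rename-Den (emptyEmb Θ) x))))
  ... | [] , _ , y = y

  ⊆⇒⇓ : {Γ : Cxt m} {M N : Tm m} → (∀ {A s a} → Den Γ M A s a → Den Γ N A s a) →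
        {Θ : Cxt n} (C : Context Γ Θ) → ∀ {P Q} → plug C M ≡ closed P → plug C N ≡ closed Q →
        Ground B → [] ⊢ P ∶ B → ∀ {V} → Value V → [] ⊢ V ∶ B → P ⇓ V → Q ⇓ V
  ⊆⇒⇓ f C eP eQ γ p v d x with groundValue γ v (⊢⇒⊩ d)
  ... | num  = adequate (plug-closed f C eP eQ (proj₂ (proj₂ (sound (⊢⇒⊩ p) x (num refl))))) nat
  ... | skip = adequate (plug-closed f C eP eQ (proj₂ (proj₂ (sound (⊢⇒⊩ p) x (skip refl))))) comm

  emptyTrace : ∀ {K s a} → Den [] K A s a → Den [] K A [] a
  emptyTrace {s = []} x = x

  -- Closing terms by abstraction and testing them.

  lams : Cxt n → Tm n → Tm 0
  lams []      M = M
  lams (A ∷ Γ) M = lams Γ (ƛ A M)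

  lamsTy : Cxt n → Ty → Ty
  lamsTy []      B = B
  lamsTy (A ∷ Γ) B = lamsTy Γ (A ⊸ B)

  lamsTrace : {Γ : Cxt n} → Traces Γ → α B → α (lamsTy Γ B)
  lamsTrace []      b = b
  lamsTrace (t ∷ s) b = lamsTrace s (t , b)

  lams-⊢ : (Γ : Cxt n) → ∀ {M} → Γ ⊢ M ∶ B → [] ⊢ lams Γ M ∶ lamsTy Γ B
  lams-⊢ []      d = d
  lams-⊢ (A ∷ Γ) d = lams-⊢ Γ (lam d)

  lams-Den : {Γ : Cxt n} (s : Traces Γ) → ∀ {M b} → Den Γ M B s b →
      Den [] (lams Γ M) (lamsTy Γ B) [] (lamsTrace s b)
  lams-Den []      x = x
  lams-Den (t ∷ s) x = lams-Den s (lam x)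

  lams-Den⁻ : {Γ : Cxt n} (s : Traces Γ) → ∀ {M b} → Den [] (lams Γ M) (lamsTy Γ B) [] (lamsTrace s b) →
      Den Γ M B s b
  lams-Den⁻ []      x = x
  lams-Den⁻ (t ∷ s) x = case lams-Den⁻ s x of λ { (lam y) → y }

  lamsContext : {Γ : Cxt m} (Θ : Cxt n) → Context Γ Θ → Context Γ []
  lamsContext []      C = C
  lamsContext (A ∷ Θ) C = lamsContext Θ (lam A C)

  plug-lamsContext : {Γ : Cxt m} (Θ : Cxt n) (C : Context Γ Θ) → ∀ M →
      plug (lamsContext Θ C) M ≡ lams Θ (plug C M)
  plug-lamsContext []      C M = refl
  plug-lamsContext (A ∷ Θ) C M = plug-lamsContext Θ (lam A C) M

  tester : ∀ A → α A → Tm 0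
  tester A a = ƛ A (test A a (ident zero))

  tester-⊢ : ∀ A a {K} → [] ⊢ K ∶ A → [] ⊢ tester A a · K ∶ comm
  tester-⊢ A a {K} d = transport (λ L → [] ⊢ L ∶ comm)
    (cong₂ _·_ (rename-id (λ _ → refl) (tester A a)) (rename-id (λ ()) K))
    (app (lam (test-⊢ A a (ident-⊢ (A ∷ []) zero refl))) d)

  tester-Den : ∀ A a {K} → Den [] K A [] a → Den [] (tester A a · K) comm [] tt
  tester-Den A a x = app refl (λ ())
    (lam (test-Den A a (ident-⊢ (A ∷ []) zero refl) (ident refl refl))) (_∷_ {u = []} x [])

  tester-Den⁻ : ∀ A a {K} → Den [] (tester A a · K) comm [] tt →
      ∃[ a′ ] Passes A a′ a × Den [] K A [] a′
  tester-Den⁻ A a (app {s = []} _ _ (lam x) xs) with test-Den⁻ A a (ident-⊢ (A ∷ []) zero refl) x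
  tester-Den⁻ A a (app {s = []} _ _ (lam x) (_∷_ {t = []} y [])) | a′ , p , ident refl refl = a′ , p , y

  -- `M` passes the test for its own trace, so by adequacy the tester applied to it converges; hence
  -- so does the tester applied to `N`, and soundness turns this into a trace of `N` that passes.
  -- Abstracting all of `Γ` lets a single tester deal with open terms.
  ≅⇒Passes : {Γ : Cxt n} (M N : Tm n) → Γ ⊢ M ∶ A → Γ ⊢ N ∶ A → Γ ⊢ M ≅ N →
             ∀ {a} → Den [] (lams Γ M) (lamsTy Γ A) [] a →
             ∃[ a′ ] Passes (lamsTy Γ A) a′ a × Den [] (lams Γ N) (lamsTy Γ A) [] a′
  ≅⇒Passes {A = A} {Γ} M N d e M≅N {a} x =
      tester-Den⁻ T a (emptyTrace
      (proj₂ (proj₂ (sound (⊢⇒⊩ (tester-⊢ T a (lams-⊢ Γ e))) converges (skip refl)))))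
    where
    T : Ty
    T = lamsTy Γ A
    C : Context Γ []
    C = appʳ (tester T a) (lamsContext Γ (hole (λ i → i) (λ q → q) (λ _ → refl)))
    plug≡ : ∀ K → plug C K ≡ closed (tester T a · lams Γ K)
    plug≡ K = trans (cong (tester T a ·_)
        (trans (plug-lamsContext Γ _ K) (cong (lams Γ) (rename-id (λ _ → refl) K))))
                    (sym (rename-id (λ ()) (tester T a · lams Γ K)))
    converges : tester T a · lams Γ N ⇓ skip
    converges = Equivalence.to
      (M≅N C _ _ (plug≡ M) (plug≡ N) comm (tester-⊢ T a (lams-⊢ Γ d))
          (tester-⊢ T a (lams-⊢ Γ e)) skip skip skip)
      (adequate (tester-Den T a x) comm)

  ≅-sym : {Γ : Cxt n} {M N : Tm n} → Γ ⊢ M ≅ N → Γ ⊢ N ≅ M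
  ≅-sym M≅N C P Q p q γ d e V v f = mk⇔ (Equivalence.from r) (Equivalence.to r)
    where r = M≅N C Q P q p γ e d V v f

  -- Coherence is available only between `a₂` and `a`, both traces of `K`. The trace `a₁`, which
  -- will come from the other term, is caught between them by antisymmetry.
  Passes-squeeze : ∀ {K a a₁ a₂} → [] ⊢ K ∶ A → Den [] K A [] a → Den [] K A [] a₂ →
                   Passes A a₁ a → Passes A a₂ a₁ → a₁ ≡ a
  Passes-squeeze {A = A} {a₁ = a₁} d x z p₁ p₂ =
    Passes-antisym A p₁ (transport (λ a → Passes A a a₁) a₂≡a p₂)
    where
    a₂≡a = Passes-Coh-≡ A (Passes-trans A p₂ p₁) (proj₁ (deterministic (⊢⇒⊩ d) z x (coherent (λ ()))))

  -- Local functions rather than with, which would normalise ≅⇒Passes and the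
  -- evaluations inside it.
  ≅⇒⊆ : {Γ : Cxt n} {M N : Tm n} (d : Γ ⊢ M ∶ A) (e : Γ ⊢ N ∶ A) → Γ ⊢ M ≅ N → ∀ {s a} → Den Γ M A s a →
      Den Γ N A s a
  ≅⇒⊆ {A = A} {Γ} {M} {N} d e M≅N {s} {b} x = lams-Den⁻ s (there (≅⇒Passes M N d e M≅N (lams-Den s x)))
    where
    T : Ty
    T = lamsTy Γ A
    a : α T
    a = lamsTrace s b
    back : ∀ {a₁} → Passes T a₁ a → Den [] (lams Γ N) T [] a₁ →
           ∃[ a₂ ] Passes T a₂ a₁ × Den [] (lams Γ M) T [] a₂ → Den [] (lams Γ N) T [] a
    back p₁ y (_ , p₂ , z) =
      transport (Den [] (lams Γ N) T []) (Passes-squeeze (lams-⊢ Γ d) (lams-Den s x) z p₁ p₂) y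
    there : ∃[ a₁ ] Passes T a₁ a × Den [] (lams Γ N) T [] a₁ → Den [] (lams Γ N) T [] a
    there (_ , p₁ , y) = back p₁ y (≅⇒Passes N M e d (≅-sym {M = M} {N} M≅N) y)

  ⟦⟧⊆⇒Den⊆ : {Γ : Cxt n} {M N : Tm n} (d : Γ ⊢ M ∶ A) (e : Γ ⊢ N ∶ A) →
      (∀ s a → ⟦ d ⟧ s a → ⟦ e ⟧ s a) →
             ∀ {B s a} → Den Γ M B s a → Den Γ N B s a
  ⟦⟧⊆⇒Den⊆ d e f x with Den-type (⊢⇒⊩ d) x
  ... | refl = ⟦⟧⇒Den e (f _ _ (Den⇒⟦⟧ d x))

  ≐⇒≅ : {Γ : Cxt n} {M N : Tm n} (d : Γ ⊢ M ∶ A) (e : Γ ⊢ N ∶ A) → ⟦ d ⟧ ≐ ⟦ e ⟧ → Γ ⊢ M ≅ N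
  ≐⇒≅ d e eq C P Q p q γ t u V v w = mk⇔
    (⊆⇒⇓ (⟦⟧⊆⇒Den⊆ d e (λ s b → Equivalence.to (eq s b))) C p q γ t v w)
    (⊆⇒⇓ (⟦⟧⊆⇒Den⊆ e d (λ s b → Equivalence.from (eq s b))) C q p γ u v w)

  ≅⇒≐ : {Γ : Cxt n} {M N : Tm n} (d : Γ ⊢ M ∶ A) (e : Γ ⊢ N ∶ A) → Γ ⊢ M ≅ N → ⟦ d ⟧ ≐ ⟦ e ⟧
  ≅⇒≐ {M = M} {N} d e M≅N s b = mk⇔
    (λ x → Den⇒⟦⟧ e (≅⇒⊆ d e M≅N (⟦⟧⇒Den d x)))
    (λ x → Den⇒⟦⟧ d (≅⇒⊆ e d (≅-sym {M = M} {N} M≅N) (⟦⟧⇒Den e x)))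

corollary9p6 : (𝓐 : Arithmetic) → let open SCI 𝓐 in
    ∀ {n : ℕ} (Γ : Cxt n) (A : Ty) (M N : Tm n)
    (d : Γ ⊢ M ∶ A) (e : Γ ⊢ N ∶ A) →
    (⟦ d ⟧ ≐ ⟦ e ⟧) ⇔ (Γ ⊢ M ≅ N)
corollary9p6 𝓐 Γ A M N d e = mk⇔ (≐⇒≅ d e) (≅⇒≐ d e)
  where open FullAbstraction 𝓐
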